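{- Let $\mathcal A$ be a vertex-failure global connectivity oracle with $\mathrm{poly}(n)$ preprocessing time, where $n$ is the number of vertices of the input graph. Assuming the Strong Exponential Time Hypothesis (SETH), $\mathcal A$ must spend $\hat\Omega(n)$ update time even when the deletion set $D$ has size $|D|=n^{o(1)}$. That is, assuming SETH, for no constants $c,\varepsilon>0$ is there a vertex-failure global connectivity oracle that, on all instances whose failure bound satisfies $d_\star=n^{o(1)}$, has preprocessing time $O(n^{c})$ and update time $O(n^{1-\varepsilon})$.
   Context: Vertex-failure global connectivity oracle problem: there are two phases. (1) Preprocessing: given an undirected graph $G=(V,E)$ with $n$ vertices and an integer $d_\star$, build a data structure. (2) Update: given a vertex set $D\subset V$ with $|D|=d\le d_\star$, return whether $G\setminus D$ (the graph after deleting the vertices of $D$ and incident edges) is connected. The update time is the time used in phase 2. $\hat\Omega(\cdot)$ hides an $n^{o(1)}$ factor. SETH: for every $\varepsilon>0$ there exists a $k$ such that SAT on $k$-CNF formulas on $N$ variables cannot be solved in time $\tilde O(2^{(1-\varepsilon)N})$ (where $\tilde O$ hides factors polynomial in the input size/logarithmic in the bound). -}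

module Defs where

open import Data.Bool using (Bool; true; false; if_then_else_; T)
open import Data.Fin using (Fin; toℕ)
open import Data.Fin.Subset using (Subset; ⊤; ∣_∣; _∉_; _⊂_)
open import Data.Fin.Subset.Properties using (_∈?_)
open import Data.Integer using () renaming (∣_∣ to abs)
open import Data.List using (List; []; _∷_; _++_; allFin; concatMap; filter; length; map)
open import Data.List.Relation.Unary.All using (All)
open import Data.List.Relation.Unary.Any using (Any)
open import Data.Nat using (ℕ; zero; suc; _+_; _∸_; _*_; _/_; _^_; _≤_; _<ᵇ_; _≡ᵇ_)
open import Data.Nat.Logarithm using (⌊log₂_⌋)
open import Data.Product using (Σ; ∃; ∃-syntax; _×_; _,_; proj₁; proj₂)
open import Data.Rational using (ℚ; 0ℚ; _<_; ↥_; ↧ₙ_)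
open import Function using (_∘_; const)
open import Relation.Binary.Construct.Closure.ReflexiveTransitive using (Star)
open import Relation.Binary.PropositionalEquality using (_≡_; _≢_)
open import Relation.Nullary using (¬_)
open import Relation.Nullary.Reflects using (Reflects)

------------------------------------------------------------------------
-- Machine model: a deterministic random access machine with logarithmic
-- cost, programmed in a structured language.  A program uses finitely
-- many variables and finitely many unbounded arrays, both named by
-- numerals.  Every number that is computed, tested, stored, or used as
-- an address is charged its bit length.  Up to polylogarithmic factors,
-- which all exponents below absorb, this is the word RAM with words of
-- O(log n) bits, but with no word length to fix in advance.

data Op : Set where
  add monus mul div : Op

⟦_⟧ : Op → ℕ → ℕ → ℕ
⟦ add   ⟧ x y       = x + y
⟦ monus ⟧ x y       = x ∸ y
⟦ mul   ⟧ x y       = x * y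
⟦ div   ⟧ x zero    = 0
⟦ div   ⟧ x (suc y) = x / suc y

data Expr : Set where
  lit : ℕ → Expr
  var : ℕ → Expr
  arr : ℕ → Expr → Expr
  bin : Op → Expr → Expr → Expr

infix  5 _≔_ _[_]≔_
infixr 4 _⨾_
infix  6 IF_THEN_ELSE_ WHILE_DO_

data Program : Set where
  skip          : Program
  _≔_           : ℕ → Expr → Program
  _[_]≔_        : ℕ → Expr → Expr → Program
  _⨾_           : Program → Program → Program
  IF_THEN_ELSE_ : Expr → Program → Program → Program
  WHILE_DO_     : Expr → Program → Program

record State : Set where
  constructor ⟨_,_⟩
  field
    vars : ℕ → ℕ
    arrs : ℕ → ℕ → ℕ

open State public

update : {A : Set} → (ℕ → A) → ℕ → A → ℕ → A
update f i x j = if i ≡ᵇ j then x else f j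

setVar : State → ℕ → ℕ → State
setVar s x v = ⟨ update (vars s) x v , arrs s ⟩

setCell : State → ℕ → ℕ → ℕ → State
setCell s a i v = ⟨ vars s , update (arrs s) a (update (arrs s a) i v) ⟩

eval : State → Expr → ℕ
eval s (lit c)      = c
eval s (var x)      = vars s x
eval s (arr a e)    = arrs s a (eval s e)
eval s (bin o e e′) = ⟦ o ⟧ (eval s e) (eval s e′)

bits : ℕ → ℕ
bits v = suc ⌊log₂ v ⌋

cost : State → Expr → ℕ
cost s e@(lit _)      = bits (eval s e)
cost s e@(var _)      = bits (eval s e)
cost s e@(arr _ i)    = bits (eval s e) + cost s i
cost s e@(bin _ l r)  = bits (eval s e) + (cost s l + cost s r)

infix 3 _⊢_⇓_within_

-- p ⊢ s ⇓ s′ within t : started in s, the program p halts in s′ after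
-- spending time exactly t.
data _⊢_⇓_within_ : Program → State → State → ℕ → Set where
  ⇓-skip   : ∀ {s} → skip ⊢ s ⇓ s within 1
  ⇓-assign : ∀ {s x e} →
             (x ≔ e) ⊢ s ⇓ setVar s x (eval s e) within cost s e
  ⇓-store  : ∀ {s a i e} →
             (a [ i ]≔ e) ⊢ s ⇓ setCell s a (eval s i) (eval s e)
               within (cost s i + cost s e)
  ⇓-seq    : ∀ {s s′ s″ p q t u} →
             p ⊢ s ⇓ s′ within t → q ⊢ s′ ⇓ s″ within u →
             (p ⨾ q) ⊢ s ⇓ s″ within (t + u)
  ⇓-then   : ∀ {s s′ e p q t} → eval s e ≢ 0 → p ⊢ s ⇓ s′ within t →
             (IF e THEN p ELSE q) ⊢ s ⇓ s′ within (cost s e + t)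
  ⇓-else   : ∀ {s s′ e p q t} → eval s e ≡ 0 → q ⊢ s ⇓ s′ within t →
             (IF e THEN p ELSE q) ⊢ s ⇓ s′ within (cost s e + t)
  ⇓-stop   : ∀ {s e p} → eval s e ≡ 0 →
             (WHILE e DO p) ⊢ s ⇓ s within cost s e
  ⇓-loop   : ∀ {s s′ s″ e p t u} → eval s e ≢ 0 →
             p ⊢ s ⇓ s′ within t → (WHILE e DO p) ⊢ s′ ⇓ s″ within u →
             (WHILE e DO p) ⊢ s ⇓ s″ within (cost s e + (t + u))

overwrite : List ℕ → (ℕ → ℕ) → ℕ → ℕ
overwrite []       f i       = f i
overwrite (x ∷ xs) f zero    = x
overwrite (x ∷ xs) f (suc i) = overwrite xs (f ∘ suc) i

-- The words are in array 0, the two parameters in variables 0 and 1, and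
-- everything else is 0.
input : ℕ → ℕ → List ℕ → State
input x y ws = ⟨ overwrite (x ∷ y ∷ []) (const 0)
               , update (const (const 0)) 0 (overwrite ws (const 0)) ⟩

accepts : State → Bool
accepts s = 0 <ᵇ vars s 0

bit : Bool → ℕ
bit b = if b then 1 else 0

------------------------------------------------------------------------
-- Exponents: a rational e > 0 is num e / den e.

num den : ℚ → ℕ
num e = abs (↥ e)
den e = ↧ₙ e

------------------------------------------------------------------------
-- Satisfiability and SETH

Literal : ℕ → Set
Literal N = Bool × Fin N

Clause : ℕ → Set
Clause N = List (Literal N)

CNF : ℕ → Set
CNF N = List (Clause N)

IsKCNF : ∀ {N} → ℕ → CNF N → Set
IsKCNF k φ = All (λ c → length c ≤ k) φ

Satisfiable : ∀ {N} → CNF N → Set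
Satisfiable {N} φ =
  Σ (Fin N → Bool) λ σ → All (Any λ l → σ (proj₂ l) ≡ proj₁ l) φ

-- Each clause is the list of its (nonzero) literal codes followed by 0.
encodeCNF : ∀ {N} → CNF N → List ℕ
encodeCNF = concatMap λ c →
  map (λ l → suc (2 * toℕ (proj₂ l) + bit (proj₁ l))) c ++ 0 ∷ []

inputCNF : ∀ {N} → CNF N → State
inputCNF {N} φ = input N (length (encodeCNF φ)) (encodeCNF φ)

sizeCNF : ∀ {N} → CNF N → ℕ
sizeCNF {N} φ = suc (N + length (encodeCNF φ))

DecidesSAT : ℕ → Program → Set
DecidesSAT k p = ∀ N (φ : CNF N) → IsKCNF k φ →
  ∃[ s ] ∃[ t ] p ⊢ inputCNF φ ⇓ s within t
              × Reflects (Satisfiable φ) (accepts s)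

-- With δ = a/b, the bound  t ≤ C′ · size^e′ · 2^((1 - δ) N)  is, after
-- raising to the power b and multiplying by 2^(a N),
--   t^b · 2^(a N) ≤ C · size^e · 2^(b N).
SATTime : ℕ → Program → ℚ → Set
SATTime k p δ = ∃[ C ] ∃[ e ] (∀ N (φ : CNF N) → IsKCNF k φ → ∀ s t →
  p ⊢ inputCNF φ ⇓ s within t →
  t ^ den δ * 2 ^ (num δ * N) ≤ C * sizeCNF φ ^ e * 2 ^ (den δ * N))

SETH : Set
SETH = ∀ (δ : ℚ) → 0ℚ < δ →
  ∃[ k ] ¬ (∃[ p ] DecidesSAT k p × SATTime k p δ)

------------------------------------------------------------------------
-- Graphs and vertex deletion

record Graph (n : ℕ) : Set where
  field
    adj     : Fin n → Fin n → Bool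
    adj-sym : ∀ u v → adj u v ≡ adj v u
    adj-irr : ∀ v → adj v v ≡ false

open Graph public

Edge∖ : ∀ {n} → Graph n → Subset n → Fin n → Fin n → Set
Edge∖ G D u v = u ∉ D × v ∉ D × T (adj G u v)

Connected∖ : ∀ {n} → Graph n → Subset n → Set
Connected∖ G D = ∀ u v → u ∉ D → v ∉ D → Star (Edge∖ G D) u v

------------------------------------------------------------------------
-- Vertex-failure global connectivity oracles

-- The adjacency matrix, row by row.
encodeGraph : ∀ {n} → Graph n → List ℕ
encodeGraph {n} G =
  concatMap (λ u → map (λ v → bit (adj G u v)) (allFin n)) (allFin n)

inputGraph : ∀ {n} → Graph n → ℕ → State
inputGraph {n} G d⋆ = input n d⋆ (encodeGraph G)

vertices : ∀ {n} → Subset n → List ℕ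
vertices {n} D = map toℕ (filter (_∈? D) (allFin n))

-- The update phase starts from the memory left by preprocessing, except
-- that ∣D∣ is put in variable 0 and the members of D in the first ∣D∣
-- cells of array 1.
loadQuery : ∀ {n} → Subset n → State → State
loadQuery D s =
  ⟨ update (vars s) 0 ∣ D ∣
  , update (arrs s) 1 (overwrite (vertices D) (arrs s 1)) ⟩

-- D ⊂ ⊤ is strict inclusion, so some vertex survives and the convention
-- for the connectivity of the empty graph plays no role.
record Oracle : Set where
  field
    preprocessing updating : Program
    correct : ∀ n (G : Graph n) d⋆ →
      ∃[ s ] ∃[ t ] preprocessing ⊢ inputGraph G d⋆ ⇓ s within t
        × (∀ (D : Subset n) → D ⊂ ⊤ → ∣ D ∣ ≤ d⋆ →
           ∃[ s′ ] ∃[ t′ ] updating ⊢ loadQuery D s ⇓ s′ within t′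
             × Reflects (Connected∖ G D) (accepts s′))

open Oracle public

-- f(n) = n^o(1): for every k, eventually f(n) ≤ n^(1/k).
Subpolynomial : (ℕ → ℕ) → Set
Subpolynomial f = ∀ k → ∃[ n₀ ] (∀ n → n₀ ≤ n → f n ^ k ≤ n)

-- On instances with d⋆ ≤ f(n), preprocessing takes O(n^c) time and
-- updates take O(n^(1 - ε)) time.  As above, the bound
-- t ≤ C′ · n^(1 - a/b) is written  t^b · n^a ≤ C · n^b.
RunsInTimeFor : Oracle → ℚ → ℚ → (ℕ → ℕ) → Set
RunsInTimeFor A c ε f = ∃[ C ] ∃[ n₀ ]
  (∀ n (G : Graph n) d⋆ → n₀ ≤ n → d⋆ ≤ f n → ∀ s t →
   preprocessing A ⊢ inputGraph G d⋆ ⇓ s within t →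
     t ^ den c ≤ C * n ^ num c
     × (∀ (D : Subset n) → D ⊂ ⊤ → ∣ D ∣ ≤ d⋆ → ∀ s′ t′ →
        updating A ⊢ loadQuery D s ⇓ s′ within t′ →
        t′ ^ den ε * n ^ num ε ≤ C * n ^ den ε))

RunsInTime : Oracle → ℚ → ℚ → Set
RunsInTime A c ε = ∀ f → Subpolynomial f → RunsInTimeFor A c ε f

-- Split the N variables of a k-CNF formula into a first block of γN
-- variables, for a small constant γ, and a second block.  Consider the
-- graph whose vertices are the clauses of width at most k, forming a
-- clique, and the assignments of the first block, each joined to the
-- clauses that it does not satisfy.  For an assignment τ of the second
-- block, delete the clauses that are not in the formula or are satisfied
-- by τ: then the assignment α of the first block becomes isolated exactly
-- if α and τ together satisfy the formula.  Thus one update per τ decides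
-- satisfiability.  There are only N^O(k) clauses, which is polylogarithmic
-- in the number n of vertices, and n^c is at most 2^((1 - δ)N) if γ is
-- small, while the updates take 2^((1 - γ)N) n^(1 - ε) = 2^((1 - γε)N) time,
-- up to factors polynomial in N.  This contradicts SETH.
--
-- All updates have to start from the memory left by preprocessing, which
-- is too large to copy.  The programs of the oracle are therefore compiled
-- to programs on a versioned memory, with constant overhead per access up
-- to a factor linear in N.

module Submission where

open import Defs
open import Data.Bool as Bool using (Bool; true; false; if_then_else_; T; _∧_)
open import Data.Bool.Properties using (T?)
open import Data.Empty using (⊥; ⊥-elim)
open import Data.Fin using (Fin; toℕ; fromℕ<)
open import Data.Fin.Properties using (toℕ<n; toℕ-fromℕ<; toℕ-injective)
open import Data.Fin.Subset as Subset using (Subset; ∣_∣; _∈_; _∉_; _⊂_)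
open import Data.Fin.Subset.Properties using (_∈?_; ∈⊤)
import Data.Integer as ℤ
open import Data.List using (List; []; _∷_; _++_; _∷ʳ_; allFin; applyUpTo; concat; filter; filterᵇ; foldl; length; map; tabulate; upTo)
open import Data.List.Properties using (++-assoc; ++-identityʳ; filter-++; length-++; length-applyUpTo; length-filter; length-map; length-upTo; map-cong; map-tabulate; upTo-∷ʳ)
open import Data.List.Relation.Unary.All as All using (All; []; _∷_)
open import Data.List.Relation.Unary.All.Properties using (++⁺)
open import Data.List.Relation.Unary.Any using (Any; here; there)
open import Data.Nat
open import Data.Nat.Coprimality using (1-coprimeTo)
open import Data.Nat.DivMod hiding (_div_; _mod_)
open import Data.Nat.Induction using (<-rec)
open import Data.Nat.Logarithm
open import Data.Nat.Properties
open import Data.Nat.Tactic.RingSolver using (solve-∀)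
open import Data.Product as Product using (Σ; ∃; ∃-syntax; _×_; _,_; proj₁; proj₂)
open import Data.Rational as ℚ using (ℚ; mkℚ; 0ℚ)
open import Data.Rational.Properties using (positive⁻¹)
open import Data.Sum as Sum using (_⊎_; inj₁; inj₂)
open import Data.Unit using (⊤; tt)
import Data.Vec as Vec
open import Data.Vec.Properties using ([]=⇒lookup; lookup⇒[]=; lookup∘tabulate)
open import Function using (_∘_; case_of_; const; id)
open import Relation.Binary.Construct.Closure.ReflexiveTransitive as Star using (Star; _◅_; _◅◅_; reverse)
open import Relation.Binary.Definitions using (tri<; tri≈; tri>)
open import Relation.Binary.PropositionalEquality
open import Relation.Nullary using (¬_; Dec; yes; no; contradiction)
open import Relation.Nullary.Decidable using (decidable-stable; _×-dec_; ¬?)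
open import Relation.Nullary.Reflects using (Reflects; ofʸ; ofⁿ)

-- Bit lengths and the cost of expressions

-- Let d be the denominator of ε. The update bound is weakened to n^(1 - 1/d) and the preprocessing
-- bound to n^m for an integer m ≥ 2; the 2 pays for writing the adjacency matrix. With Q = (m + 1)
-- d and h = ⌊N / Q⌋, the first block has about d h variables. Up to polynomial factors n^m is then
-- 2^(d h m), at most 2^(N - h) because d h m + h ≤ h Q ≤ N, and 2^(N - d h) updates of time 2^((d -
-- 1) h) take 2^(N - h) as well. So every phase saves a factor 2^h, which contradicts SETH at δ =
-- 1/Q.
--
-- The oracle's bounds hold only for n ≥ n₀, and n₀ depends on the failure bound f. Hence f is fixed
-- first, from Q and the clause width alone, and afterwards the first block is enlarged by a
-- constant number of positions, so that n ≥ n₀ even for small N.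
--
-- The oracle may compute numbers of any length. Compiled code is therefore charged against the
-- logarithmic cost that the original pays for the same values, whereas the solver's own numbers
-- obey one common bound `W` on their lengths.

n<2^n : ∀ n → n < 2 ^ n
n<2^n zero    = s≤s z≤n
n<2^n (suc n) = begin-strict
  suc n         <⟨ s≤s (n<2^n n) ⟩
  suc (2 ^ n)   ≤⟨ +-monoˡ-≤ (2 ^ n) (m^n>0 2 n) ⟩
  2 ^ n + 2 ^ n ≡⟨ cong (2 ^ n +_) (+-identityʳ (2 ^ n)) ⟨
  2 ^ suc n     ∎
  where open ≤-Reasoning

⌊n/2⌋-double : ∀ n → n ≤ suc (2 * ⌊ n /2⌋) × 2 * ⌊ n /2⌋ ≤ n
⌊n/2⌋-double zero = z≤n , z≤n
⌊n/2⌋-double (suc zero) = s≤s z≤n , z≤n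
⌊n/2⌋-double (suc (suc n)) rewrite +-suc ⌊ n /2⌋ (⌊ n /2⌋ + 0) =
  Product.map (s≤s ∘ s≤s) (s≤s ∘ s≤s) (⌊n/2⌋-double n)

⌊log₂⌋-half : ∀ n → 2 ≤ n → ⌊log₂ n ⌋ ≡ suc ⌊log₂ ⌊ n /2⌋ ⌋
⌊log₂⌋-half n 2≤n = begin
  ⌊log₂ n ⌋           ≡⟨ suc-pred ⌊log₂ n ⌋ {{>-nonZero (⌊log₂⌋-mono-≤ 2≤n)}} ⟨
  suc (⌊log₂ n ⌋ ∸ 1) ≡⟨ cong suc (⌊log₂⌊n/2⌋⌋≡⌊log₂n⌋∸1 n) ⟨
  suc ⌊log₂ ⌊ n /2⌋ ⌋ ∎
  where open ≡-Reasoning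

⌊log₂⌋-bounds : ∀ n → n < 2 ^ bits n × (0 < n → 2 ^ ⌊log₂ n ⌋ ≤ n)
⌊log₂⌋-bounds = <-rec _ go
  where
  lem : ∀ x → suc (suc (2 * x)) ≡ 2 * suc x
  lem = solve-∀
  go : ∀ n → (∀ {m} → m < n → m < 2 ^ bits m × (0 < m → 2 ^ ⌊log₂ m ⌋ ≤ m)) →
       n < 2 ^ bits n × (0 < n → 2 ^ ⌊log₂ n ⌋ ≤ n)
  go n ih with n ≤? 1
  ... | yes z≤n       = s≤s z≤n , λ ()
  ... | yes (s≤s z≤n) = s≤s (s≤s z≤n) , λ _ → s≤s z≤n
  ... | no n≰1 with ⌊n/2⌋-double n
  ...   | p , r =
    subst (λ l → n < 2 ^ suc l) (sym eq) (≤-trans (s≤s p)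
        (≤-trans (≤-reflexive (lem _)) (*-monoʳ-≤ 2 (proj₁ half)))) ,
    λ _ → subst (λ l → 2 ^ l ≤ n) (sym eq) (≤-trans (*-monoʳ-≤ 2 (proj₂ half (⌊n/2⌋-mono 2≤n))) r)
    where
    2≤n : 2 ≤ n
    2≤n = ≰⇒> n≰1
    eq : ⌊log₂ n ⌋ ≡ suc ⌊log₂ ⌊ n /2⌋ ⌋
    eq = ⌊log₂⌋-half n 2≤n
    half : ⌊ n /2⌋ < 2 ^ bits ⌊ n /2⌋ × (0 < ⌊ n /2⌋ → 2 ^ ⌊log₂ ⌊ n /2⌋ ⌋ ≤ ⌊ n /2⌋)
    half = ih (subst (λ m → ⌊ m /2⌋ < m) (suc-pred n {{>-nonZero (≤-trans (s≤s z≤n) 2≤n)}}) (⌊n/2⌋<n (pred n)))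

<2^bits : ∀ n → n < 2 ^ bits n
<2^bits n = proj₁ (⌊log₂⌋-bounds n)

2^⌊log₂⌋≤ : ∀ n → 0 < n → 2 ^ ⌊log₂ n ⌋ ≤ n
2^⌊log₂⌋≤ n = proj₂ (⌊log₂⌋-bounds n)

≤2^⇒bits≤ : ∀ {n w} → n ≤ 2 ^ w → bits n ≤ suc w
≤2^⇒bits≤ {n} {w} p = s≤s (≤-trans (⌊log₂⌋-mono-≤ p) (≤-reflexive (⌊log₂[2^n]⌋≡n w)))

bits-mono : ∀ {m n} → m ≤ n → bits m ≤ bits n
bits-mono p = s≤s (⌊log₂⌋-mono-≤ p)

<2^⇒bits≤ : ∀ {n w} → n < 2 ^ w → bits n ≤ w ⊔ 1
<2^⇒bits≤ {zero} p = m≤n⊔m _ 1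
<2^⇒bits≤ {suc n} {zero} (s≤s ())
<2^⇒bits≤ {suc n} {w} p with bits (suc n) ≤? w
... | yes q = ≤-trans q (m≤m⊔n w 1)
... | no ¬q = ⊥-elim (<⇒≱ p (≤-trans (^-monoʳ-≤ 2 (≤-pred (≰⇒> ¬q))) (2^⌊log₂⌋≤ (suc n) (s≤s z≤n))))

<2^⇒bits≤′ : ∀ {n w} → 1 ≤ w → n < 2 ^ w → bits n ≤ w
<2^⇒bits≤′ {n} {w} 1≤w p = ≤-trans (<2^⇒bits≤ p) (≤-reflexive (m≥n⇒m⊔n≡m 1≤w))

div≤ : ∀ x y → ⟦ div ⟧ x y ≤ x
div≤ x zero    = z≤n
div≤ x (suc y) = m/n≤m x (suc y)

bits-op : ∀ o x y → bits (⟦ o ⟧ x y) ≤ bits x + bits y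
bits-op add x y = <2^⇒bits≤′ (s≤s z≤n) (begin-strict
  x + y <⟨ +-mono-< (<2^bits x) (<2^bits y) ⟩
  2 ^ bits x + 2 ^ bits y ≤⟨ +-mono-≤ (^-monoʳ-≤ 2 (m≤m+n (bits x) ⌊log₂ y ⌋))
      (^-monoʳ-≤ 2 (s≤s (m≤n+m ⌊log₂ y ⌋ ⌊log₂ x ⌋))) ⟩
  2 ^ (bits x + ⌊log₂ y ⌋) + 2 ^ (bits x + ⌊log₂ y ⌋) ≡⟨ cong (2 ^ (bits x + ⌊log₂ y ⌋) +_) (+-identityʳ _) ⟨
  2 ^ suc (bits x + ⌊log₂ y ⌋) ≡⟨ cong (2 ^_) (+-suc (bits x) _) ⟨
  2 ^ (bits x + bits y) ∎)
  where open ≤-Reasoning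
bits-op monus x y = ≤-trans (bits-mono (m∸n≤m x y)) (m≤m+n (bits x) (bits y))
bits-op mul x y = <2^⇒bits≤′ (s≤s z≤n) (begin-strict
  x * y <⟨ *-mono-< (<2^bits x) (<2^bits y) ⟩
  2 ^ bits x * 2 ^ bits y ≡⟨ ^-distribˡ-+-* 2 (bits x) (bits y) ⟨
  2 ^ (bits x + bits y) ∎)
  where open ≤-Reasoning
bits-op div x y = ≤-trans (bits-mono (div≤ x y)) (m≤m+n (bits x) (bits y))

size : Expr → ℕ
size (lit c)     = bits c
size (var _)     = 1
size (arr _ e)   = suc (size e)
size (bin _ l r) = suc (size l + size r)

-- Only the cells that the evaluation actually reads are constrained; the lengths of intermediate
-- results follow, because bit lengths are subadditive under every operation.
Reads : State → ℕ → Expr → Set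
Reads s W (lit _)     = ⊤
Reads s W (var x)     = bits (vars s x) ≤ W
Reads s W (arr a e)   = bits (arrs s a (eval s e)) ≤ W × Reads s W e
Reads s W (bin _ l r) = Reads s W l × Reads s W r

Reads-mono : ∀ {s W W′} e → W ≤ W′ → Reads s W e → Reads s W′ e
Reads-mono (lit _)     p r       = tt
Reads-mono (var _)     p r       = ≤-trans r p
Reads-mono (arr _ e)   p (r , q) = ≤-trans r p , Reads-mono e p q
Reads-mono (bin _ l r) p (u , v) = Reads-mono l p u , Reads-mono r p v

≤-scale : ∀ x {y} → 1 ≤ y → x ≤ x * y
≤-scale x p = ≤-trans (≤-reflexive (sym (*-identityʳ x))) (*-monoʳ-≤ x p)

bits-eval : ∀ {s W} e → 1 ≤ W → Reads s W e → bits (eval s e) ≤ size e * W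
bits-eval {W = W} (lit c) p r = ≤-scale (bits c) p
bits-eval {W = W} (var x) p r = ≤-trans r (m≤m+n W 0)
bits-eval {W = W} (arr a e) p (r , _) = ≤-trans r (m≤m+n W _)
bits-eval {s} {W} (bin o l r) p (u , v) = begin
  bits (⟦ o ⟧ (eval s l) (eval s r)) ≤⟨ bits-op o (eval s l) (eval s r) ⟩
  bits (eval s l) + bits (eval s r) ≤⟨ +-mono-≤ (bits-eval l p u) (bits-eval r p v) ⟩
  size l * W + size r * W           ≡⟨ *-distribʳ-+ W (size l) (size r) ⟨
  (size l + size r) * W             ≤⟨ m≤n+m _ W ⟩
  size (bin o l r) * W              ∎
  where open ≤-Reasoning

-- There are at most `size e` subexpressions, and each has a value of at most `size e * W` bits;
-- hence the square.
cost-bound : ∀ {s W} e → 1 ≤ W → Reads s W e → cost s e ≤ size e * size e * W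
cost-bound {W = W} (lit c) p r = ≤-trans (≤-scale (bits c) {bits c} (s≤s z≤n)) (≤-scale (bits c * bits c) p)
cost-bound {W = W} (var x) p r = ≤-trans r (m≤m+n W 0)
cost-bound {s} {W} (arr a e) p (r , q) = begin
  bits (arrs s a (eval s e)) + cost s e ≤⟨ +-mono-≤ r (cost-bound e p q) ⟩
  W + size e * size e * W         ≤⟨ m≤m+n _ (2 * size e * W) ⟩
  W + size e * size e * W + 2 * size e * W  ≡⟨ lem (size e) W ⟩
  suc (size e) * suc (size e) * W ∎
  where
  open ≤-Reasoning
  lem : ∀ x w → w + x * x * w + 2 * x * w ≡ suc x * suc x * w
  lem = solve-∀
cost-bound {s} {W} e@(bin o l r) p (u , v) = begin
  bits (eval s e) + (cost s l + cost s r) ≤⟨ +-mono-≤ (bits-eval e p (u , v))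
      (+-mono-≤ (cost-bound l p u) (cost-bound r p v)) ⟩
  suc (x + y) * W + (x * x * W + y * y * W) ≤⟨ m≤m+n _ ((x + y + 2 * (x * y)) * W) ⟩
  suc (x + y) * W + (x * x * W + y * y * W) + (x + y + 2 * (x * y)) * W ≡⟨ lem x y W ⟩
  suc (x + y) * suc (x + y) * W ∎
  where
  open ≤-Reasoning
  x = size l
  y = size r
  lem : ∀ x y w → suc (x + y) * w + (x * x * w + y * y * w) + (x + y + 2 * (x * y)) * w ≡ suc (x + y) * suc
      (x + y) * w
  lem = solve-∀

bits≤cost : ∀ s e → bits (eval s e) ≤ cost s e
bits≤cost s (lit c)     = ≤-refl
bits≤cost s (var x)     = ≤-refl
bits≤cost s (arr a e)   = m≤m+n _ _
bits≤cost s (bin o l r) = m≤m+n _ _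

1≤cost : ∀ s e → 1 ≤ cost s e
1≤cost s e = ≤-trans (s≤s z≤n) (bits≤cost s e)

-- `SATTime` speaks about every run of a program. Determinism reduces this to the one run that is
-- constructed.
⇓-deterministic : ∀ {p s s₁ s₂ t₁ t₂} →
  p ⊢ s ⇓ s₁ within t₁ → p ⊢ s ⇓ s₂ within t₂ → s₁ ≡ s₂ × t₁ ≡ t₂
⇓-deterministic ⇓-skip ⇓-skip = refl , refl
⇓-deterministic ⇓-assign ⇓-assign = refl , refl
⇓-deterministic ⇓-store ⇓-store = refl , refl
⇓-deterministic (⇓-seq a b) (⇓-seq c d) with ⇓-deterministic a c
... | refl , refl with ⇓-deterministic b d
... | refl , refl = refl , refl
⇓-deterministic (⇓-then x a) (⇓-then y b) with ⇓-deterministic a b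
... | refl , refl = refl , refl
⇓-deterministic (⇓-then x a) (⇓-else y b) = ⊥-elim (x y)
⇓-deterministic (⇓-else x a) (⇓-then y b) = ⊥-elim (y x)
⇓-deterministic (⇓-else x a) (⇓-else y b) with ⇓-deterministic a b
... | refl , refl = refl , refl
⇓-deterministic (⇓-stop x) (⇓-stop y) = refl , refl
⇓-deterministic (⇓-stop x) (⇓-loop y _ _) = ⊥-elim (y x)
⇓-deterministic (⇓-loop x _ _) (⇓-stop y) = ⊥-elim (x y)
⇓-deterministic (⇓-loop x a b) (⇓-loop y c d) with ⇓-deterministic a c
... | refl , refl with ⇓-deterministic b d
... | refl , refl = refl , refl

≡ᵇ-refl : ∀ n → (n ≡ᵇ n) ≡ true
≡ᵇ-refl zero    = refl
≡ᵇ-refl (suc n) = ≡ᵇ-refl n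

≢⇒≡ᵇ-false : ∀ {m n} → m ≢ n → (m ≡ᵇ n) ≡ false
≢⇒≡ᵇ-false {m} {n} ne with m ≡ᵇ n in eq
... | false = refl
... | true  = ⊥-elim (ne (≡ᵇ⇒≡ m n (subst T (sym eq) tt)))

update-same : ∀ {A : Set} (f : ℕ → A) i x → update f i x i ≡ x
update-same f i x rewrite ≡ᵇ-refl i = refl

update-other : ∀ {A : Set} (f : ℕ → A) {i j} x → i ≢ j → update f i x j ≡ f j
update-other f x ne rewrite ≢⇒≡ᵇ-false ne = refl

update-cong : ∀ {A : Set} {f g : ℕ → A} i x {j} → f j ≡ g j → update f i x j ≡ update g i x j
update-cong i x {j} e with i ≡ᵇ j
... | true  = refl
... | false = e

update₂-same : ∀ (f : ℕ → ℕ → ℕ) a g i → update f a g a i ≡ g i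
update₂-same f a g i = cong (λ h → h i) (update-same f a g)

update₂-other : ∀ (f : ℕ → ℕ → ℕ) {a b} g i → a ≢ b → update f a g b i ≡ f b i
update₂-other f g i ne = cong (λ h → h i) (update-other f g ne)

-- A memory with constant-time rollback

-- Slot 0 holds the variables of the simulated program and slot suc a its
-- array a.
mem : State → ℕ → ℕ → ℕ
mem s zero    = vars s
mem s (suc a) = arrs s a

setMem : State → ℕ → ℕ → ℕ → State
setMem s zero    = setVar s
setMem s (suc a) = setCell s a

mem-setMem : ∀ s j i v j′ i′ →
  mem (setMem s j i v) j′ i′ ≡ update (mem s) j (update (mem s j) i v) j′ i′
mem-setMem s zero    i v zero     i′ = refl
mem-setMem s zero    i v (suc j′) i′ = refl
mem-setMem s (suc j) i v zero     i′ = refl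
mem-setMem s (suc j) i v (suc j′) i′ = refl

double+-mono-< : ∀ {i i′ b b′} → i < i′ → b ≤ 1 → 2 * i + b < 2 * i′ + b′
double+-mono-< {i} {i′} {b} {b′} i<i′ p = begin-strict
  2 * i + b   <⟨ +-monoʳ-< (2 * i) (s≤s p) ⟩
  2 * i + 2   ≡⟨ lem i ⟩
  2 * suc i   ≤⟨ *-monoʳ-≤ 2 i<i′ ⟩
  2 * i′      ≤⟨ m≤m+n _ b′ ⟩
  2 * i′ + b′ ∎
  where
  open ≤-Reasoning
  lem : ∀ i → 2 * i + 2 ≡ 2 * suc i
  lem = solve-∀

double+-injective : ∀ i i′ {b b′} → b ≤ 1 → b′ ≤ 1 →
  2 * i + b ≡ 2 * i′ + b′ → i ≡ i′ × b ≡ b′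
double+-injective i i′ {b} {b′} p q e with <-cmp i i′
... | tri≈ _ refl _ = refl , +-cancelˡ-≡ (2 * i) _ _ e
... | tri< i<i′ _ _ = ⊥-elim (<⇒≢ (double+-mono-< i<i′ p) e)
... | tri> _ _ i′<i = ⊥-elim (<⇒≢ (double+-mono-< i′<i q) (sym e))

-- Each cell of the simulated memory has a base copy, at an even address,
-- and an overlay copy, at the next odd address.  The overlay copy counts
-- only if the stamp of the cell is the current epoch q ≥ 1, kept in
-- variable 4.  Writing in epoch 0 changes the base copy, and in a later
-- epoch the overlay copy, so moving to the next epoch undoes all writes
-- since epoch 0 at the cost of one increment.
cellA stampA : ℕ → ℕ
cellA  j = 4 + (2 * j + 0)
stampA j = 4 + (2 * j + 1)

-- For v ≤ q this is 1 if v = q ≥ 1, and 0 otherwise. The test whether the overlay copy counts is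
-- thus arithmetic and can be part of an address, with no branching inside expressions.
overlaid : ℕ → ℕ → ℕ
overlaid q v = v ∸ (q ∸ 1)

overlaid≤1 : ∀ {q v} → v ≤ q → overlaid q v ≤ 1
overlaid≤1 {q} {v} p = begin
  v ∸ (q ∸ 1) ≤⟨ ∸-monoˡ-≤ (q ∸ 1) p ⟩
  q ∸ (q ∸ 1) ≤⟨ m≤n+o⇒m∸n≤o q (q ∸ 1) {1} (≤-trans (m≤n+m∸n q 1) (≤-reflexive (+-comm 1 _))) ⟩
  1 ∎
  where open ≤-Reasoning

epochE : Expr
epochE = var 4

tempE : Expr
tempE = arr 3 (lit 0)

overlaidE : Expr → Expr
overlaidE v = bin monus v (bin monus epochE (lit 1))

-- The index expression occurs twice, so compilation is exponential in the nesting depth of array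
-- accesses. That depth belongs to the program text, so the blow-up is a constant.
addrE : ℕ → Expr → Expr
addrE j e = bin add (bin mul (lit 2) e) (overlaidE (arr (stampA j) e))

readE : ℕ → Expr → Expr
readE j e = arr (cellA j) (addrE j e)

write : ℕ → Expr → Expr → Program
write j i e =
  -- The index is saved because the next store may change cells that `i` reads, as in an assignment
  -- to a[a[0]], and the stamp must still go to the old index.
  3 [ lit 0 ]≔ i ⨾
  cellA j [ bin add (bin mul (lit 2) tempE) (overlaidE epochE) ]≔ e ⨾
  stampA j [ tempE ]≔ epochE

⌜_⌝ᵉ : Expr → Expr
⌜ lit c ⌝ᵉ     = lit c
⌜ var x ⌝ᵉ     = readE 0 (lit x)
⌜ arr a e ⌝ᵉ   = readE (suc a) ⌜ e ⌝ᵉ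
⌜ bin o l r ⌝ᵉ = bin o ⌜ l ⌝ᵉ ⌜ r ⌝ᵉ

⌜_⌝ : Program → Program
⌜ skip ⌝               = skip
⌜ x ≔ e ⌝              = write 0 (lit x) ⌜ e ⌝ᵉ
⌜ a [ i ]≔ e ⌝         = write (suc a) ⌜ i ⌝ᵉ ⌜ e ⌝ᵉ
⌜ p ⨾ q ⌝              = ⌜ p ⌝ ⨾ ⌜ q ⌝
⌜ IF e THEN p ELSE q ⌝ = IF ⌜ e ⌝ᵉ THEN ⌜ p ⌝ ELSE ⌜ q ⌝
⌜ WHILE e DO p ⌝       = WHILE ⌜ e ⌝ᵉ DO ⌜ p ⌝

-- The bound on the stamps keeps `overlaid` at most 1, so that the copies of different cells never
-- collide, and it makes every stamp outdated as soon as the epoch grows.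
record Represents (q : ℕ) (R : ℕ → ℕ → ℕ) (s : State) : Set where
  field
    cells  : ∀ j i → mem s j i ≡ R (cellA j) (2 * i + overlaid q (R (stampA j) i))
    stamps : ∀ j i → R (stampA j) i ≤ q

open Represents

Represents-cong : ∀ {q R s s′} → (∀ j i → mem s′ j i ≡ mem s j i) →
  Represents q R s → Represents q R s′
Represents-cong e h .cells j i  = trans (e j i) (h .cells j i)
Represents-cong e h .stamps = h .stamps

eval-⌜⌝ : ∀ {q r s} e → vars r 4 ≡ q → Represents q (arrs r) s → eval r ⌜ e ⌝ᵉ ≡ eval s e
eval-⌜⌝ (lit c) eq h = refl
eval-⌜⌝ (var x) refl h = sym (h .cells 0 x)
eval-⌜⌝ {r = r} {s} (arr a e) refl h =
  trans (cong (λ i → arrs r (cellA (suc a)) (2 * i + overlaid (vars r 4) (arrs r (stampA (suc a)) i)))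
      (eval-⌜⌝ e refl h))
    (sym (h .cells (suc a) (eval s e)))
eval-⌜⌝ (bin o l r) eq h = cong₂ ⟦ o ⟧ (eval-⌜⌝ l eq h) (eval-⌜⌝ r eq h)

reads-readE : ∀ {q r s X} j e → vars r 4 ≡ q → Represents q (arrs r) s → bits q ≤ X →
  bits (mem s j (eval r e)) ≤ X → Reads r X e → Reads r X (readE j e)
reads-readE {r = r} j e refl h bq bv re =
  ≤-trans (≤-reflexive (cong bits (sym (h .cells j (eval r e))))) bv ,
  (tt , re) , (≤-trans (bits-mono (h .stamps j (eval r e))) bq , re) , bq , tt

-- A value that `e` reads in the original is part of its cost there, so `cost s e` bounds its length
-- although nothing else is known about it. Only the epoch and the stamps need `W`.
reads-⌜⌝ : ∀ {q r s W} e → vars r 4 ≡ q → Represents q (arrs r) s → bits q ≤ W →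
  Reads r (cost s e * W) ⌜ e ⌝ᵉ
reads-⌜⌝ (lit c) eq h bq = tt
reads-⌜⌝ {r = r} {s} {W} (var x) eq h bq =
  reads-readE {r = r} 0 (lit x) eq h (≤-trans bq (≤-trans (≤-scale W (1≤cost s (var x))) (≤-reflexive (*-comm W _))))
    (≤-scale _ (≤-trans (s≤s z≤n) bq)) tt
reads-⌜⌝ {r = r} {s} {W} (arr a e) eq h bq =
  reads-readE {r = r} (suc a) ⌜ e ⌝ᵉ eq h (≤-trans bq
      (≤-trans (≤-scale W (1≤cost s (arr a e))) (≤-reflexive (*-comm W _))))
    (≤-trans (≤-reflexive (cong (λ v → bits (arrs s a v)) (eval-⌜⌝ e eq h)))
      (≤-trans (bits≤cost s (arr a e)) (≤-scale _ (≤-trans (s≤s z≤n) bq))))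
    (Reads-mono ⌜ e ⌝ᵉ (*-monoˡ-≤ W (m≤n+m (cost s e) (bits (eval s (arr a e))))) (reads-⌜⌝ e eq h bq))
reads-⌜⌝ {s = s} {W} (bin o l r) eq h bq =
  Reads-mono ⌜ l ⌝ᵉ (*-monoˡ-≤ W (≤-trans (m≤m+n (cost s l) (cost s r)) (m≤n+m _ (bits (eval s (bin o l r))))))
      (reads-⌜⌝ l eq h bq) ,
  Reads-mono ⌜ r ⌝ᵉ (*-monoˡ-≤ W (≤-trans (m≤n+m (cost s r) (cost s l)) (m≤n+m _ (bits (eval s (bin o l r))))))
      (reads-⌜⌝ r eq h bq)

opaque
  weightᵉ : Expr → ℕ
  weightᵉ e = size ⌜ e ⌝ᵉ * size ⌜ e ⌝ᵉ

  cost-⌜⌝ : ∀ {q r s W} e → vars r 4 ≡ q → Represents q (arrs r) s → bits q ≤ W →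
    cost r ⌜ e ⌝ᵉ ≤ weightᵉ e * (cost s e * W)
  cost-⌜⌝ {s = s} e eq h bq = cost-bound ⌜ e ⌝ᵉ (*-mono-≤ (1≤cost s e) (≤-trans (s≤s z≤n) bq)) (reads-⌜⌝ e eq h bq)

-- What compiled code leaves alone: the variables of the solver, its arrays 0 to 2 (array 3 is
-- scratch), and after epoch 0 all base copies. The last clause is what makes rollback sound.
record Frame (q : ℕ) (r r′ : State) : Set where
  field
    vars≡ : ∀ x → vars r′ x ≡ vars r x
    arrs≡ : ∀ a → a < 3 → ∀ i → arrs r′ a i ≡ arrs r a i
    base≡ : 1 ≤ q → ∀ j i → arrs r′ (cellA j) (2 * i + 0) ≡ arrs r (cellA j) (2 * i + 0)

open Frame

Frame-refl : ∀ {q r} → Frame q r r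
Frame-refl .vars≡ x = refl
Frame-refl .arrs≡ a _ i = refl
Frame-refl .base≡ _ j i = refl

Frame-trans : ∀ {q r r′ r″} → Frame q r r′ → Frame q r′ r″ → Frame q r r″
Frame-trans f g .vars≡ x = trans (g .vars≡ x) (f .vars≡ x)
Frame-trans f g .arrs≡ a p i = trans (g .arrs≡ a p i) (f .arrs≡ a p i)
Frame-trans f g .base≡ p j i = trans (g .base≡ p j i) (f .base≡ p j i)

written : State → ℕ → ℕ → ℕ → State
written r j i v = setCell (setCell (setCell r 3 0 i) (cellA j) (2 * i + overlaid (vars r 4) (vars r 4)) v)
    (stampA j) i (vars r 4)

cell≢cell : ∀ {j j′} → j ≢ j′ → cellA j ≢ cellA j′
cell≢cell {j} {j′} ne e = ne (proj₁ (double+-injective j j′ z≤n z≤n (+-cancelˡ-≡ 4 _ _ e)))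

stamp≢stamp : ∀ {j j′} → j ≢ j′ → stampA j ≢ stampA j′
stamp≢stamp {j} {j′} ne e = ne (proj₁ (double+-injective j j′ (s≤s z≤n) (s≤s z≤n) (+-cancelˡ-≡ 4 _ _ e)))

cell≢stamp : ∀ j j′ → cellA j ≢ stampA j′
cell≢stamp j j′ e = case proj₂ (double+-injective j j′ z≤n (s≤s z≤n) (+-cancelˡ-≡ 4 _ _ e)) of λ ()

module Written (r : State) (j i v : ℕ) where
  q : ℕ
  q = vars r 4

  k : ℕ
  k = 2 * i + overlaid q q

  R R₁ R₂ : ℕ → ℕ → ℕ
  R  = arrs r
  R₁ = arrs (setCell r 3 0 i)
  R₂ = arrs (setCell (setCell r 3 0 i) (cellA j) k v)

  written-cells : ∀ j′ k′ → arrs (written r j i v) (cellA j′) k′ ≡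
    update R₁ (cellA j) (update (R (cellA j)) k v) (cellA j′) k′
  written-cells j′ k′ = update₂-other R₂ _ k′ (cell≢stamp j′ j ∘ sym)

  cell-other : ∀ j′ k′ → (j ≢ j′ ⊎ k ≢ k′) → arrs (written r j i v) (cellA j′) k′ ≡ R (cellA j′) k′
  cell-other j′ k′ ne = trans (written-cells j′ k′) (lem ne)
    where
    lem : (j ≢ j′ ⊎ k ≢ k′) → update R₁ (cellA j) (update (R (cellA j)) k v) (cellA j′) k′ ≡ R (cellA j′) k′
    lem ne with j ≟ j′
    ... | no n = update₂-other R₁ _ k′ (cell≢cell n)
    lem (inj₁ ne) | yes refl = ⊥-elim (ne refl)
    lem (inj₂ ne) | yes refl = trans (update₂-same R₁ (cellA j) _ k′) (update-other (R (cellA j)) v ne)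

  cell-same : arrs (written r j i v) (cellA j) k ≡ v
  cell-same = trans (written-cells j k) (trans (update₂-same R₁ (cellA j) _ k) (update-same (R (cellA j)) k v))

  stamp-other : ∀ j′ i′ → (j ≢ j′ ⊎ i ≢ i′) → arrs (written r j i v) (stampA j′) i′ ≡ R (stampA j′) i′
  stamp-other j′ i′ ne with j ≟ j′
  ... | no n = trans (update₂-other R₂ _ i′ (stamp≢stamp n)) (update₂-other R₁ _ i′ (cell≢stamp j j′))
  stamp-other j′ i′ (inj₁ ne) | yes refl = ⊥-elim (ne refl)
  stamp-other j′ i′ (inj₂ ne) | yes refl =
    trans (update₂-same R₂ (stampA j) _ i′) (trans (update-other (R₂ (stampA j)) q ne)
        (update₂-other R₁ _ i′ (cell≢stamp j j)))

  stamp-same : arrs (written r j i v) (stampA j) i ≡ q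
  stamp-same = trans (update₂-same R₂ (stampA j) _ i) (update-same (R₂ (stampA j)) i q)

open Written using (cell-other; cell-same; stamp-other; stamp-same)

written-frame : ∀ r j i v → Frame (vars r 4) r (written r j i v)
written-frame r j i v .vars≡ x = refl
written-frame r j i v .arrs≡ zero p k = refl
written-frame r j i v .arrs≡ (suc zero) p k = refl
written-frame r j i v .arrs≡ (suc (suc zero)) p k = refl
written-frame r j i v .arrs≡ (suc (suc (suc a))) (s≤s (s≤s (s≤s ()))) k
written-frame r j i v .base≡ 1≤q j′ i′ =
  -- After epoch 0 writes go to odd addresses, while base copies sit at even ones.
  cell-other r j i v j′ _ (inj₂ λ e → m<n⇒n≢0 (s≤s z≤n)
    (trans (sym (overlaid-now 1≤q)) (proj₂ (double+-injective i i′ (overlaid≤1 {vars r 4} ≤-refl) z≤n e))))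
  where
  overlaid-now : ∀ {q} → 1 ≤ q → overlaid q q ≡ 1
  overlaid-now {suc q} p = trans (+-∸-assoc 1 {q} ≤-refl) (cong suc (n∸n≡0 q))

-- The written cell now carries the stamp q, so it is read back exactly where `v` was stored. Every
-- other cell keeps its stamp and both of its copies.
written-represents : ∀ {r s} j i v → Represents (vars r 4) (arrs r) s →
  Represents (vars r 4) (arrs (written r j i v)) (setMem s j i v)
written-represents {r} {s} j i v h = λ where
    .cells j′ i′ → trans (mem-setMem s j i v j′ i′) (cells′ j′ i′ (position j′ i′))
    .stamps j′ i′ → stamps′ j′ i′ (position j′ i′)
  where
  Q = vars r 4
  R′ = arrs (written r j i v)
  position : ∀ j′ i′ → (j ≢ j′ ⊎ i ≢ i′) ⊎ (j ≡ j′ × i ≡ i′)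
  position j′ i′ with j ≟ j′ | i ≟ i′
  ... | no n   | _      = inj₁ (inj₁ n)
  ... | yes _  | no n   = inj₁ (inj₂ n)
  ... | yes e  | yes e′ = inj₂ (e , e′)
  other : ∀ j′ i′ → j ≢ j′ ⊎ i ≢ i′ → update (mem s) j (update (mem s j) i v) j′ i′ ≡ mem s j′ i′
  other j′ i′ ne with j ≟ j′
  ... | no n = update₂-other (mem s) _ i′ n
  other j′ i′ (inj₁ ne) | yes refl = ⊥-elim (ne refl)
  other j′ i′ (inj₂ ne) | yes refl = trans (update₂-same (mem s) j _ i′) (update-other (mem s j) v ne)
  cells′ : ∀ j′ i′ → (j ≢ j′ ⊎ i ≢ i′) ⊎ (j ≡ j′ × i ≡ i′) →
    update (mem s) j (update (mem s j) i v) j′ i′ ≡ R′ (cellA j′) (2 * i′ + overlaid Q (R′ (stampA j′) i′))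
  cells′ j′ i′ (inj₁ ne) = trans (other j′ i′ ne) (trans (h .cells j′ i′)
    (trans (sym (cell-other r j i v j′ _ (Sum.map₂ (λ n e →
        n (proj₁ (double+-injective i i′ (overlaid≤1 {Q} ≤-refl) (overlaid≤1 (h .stamps j′ i′)) e))) ne)))
      (cong (λ z → R′ (cellA j′) (2 * i′ + overlaid Q z)) (sym (stamp-other r j i v j′ i′ ne)))))
  cells′ _ _ (inj₂ (refl , refl)) =
    trans (update₂-same (mem s) j _ i) (trans (update-same (mem s j) i v)
      (trans (sym (cell-same r j i v)) (cong (λ z → R′ (cellA j) (2 * i + overlaid Q z)) (sym (stamp-same r j i v)))))
  stamps′ : ∀ j′ i′ → (j ≢ j′ ⊎ i ≢ i′) ⊎ (j ≡ j′ × i ≡ i′) → R′ (stampA j′) i′ ≤ Q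
  stamps′ j′ i′ (inj₁ ne) = ≤-trans (≤-reflexive (stamp-other r j i v j′ i′ ne)) (h .stamps j′ i′)
  stamps′ _ _ (inj₂ (refl , refl)) = ≤-reflexive (stamp-same r j i v)

-- Simulation on the versioned memory

record Runs (p : Program) (s : State) (T : ℕ) (Q : State → Set) : Set where
  constructor runs
  field
    {final}  : State
    {time}   : ℕ
    run      : p ⊢ s ⇓ final within time
    bound    : time ≤ T
    post     : Q final

open Runs

Runs-weaken : ∀ {p s T T′} {Q Q′ : State → Set} → T ≤ T′ → (∀ {s′} → Q s′ → Q′ s′) →
  Runs p s T Q → Runs p s T′ Q′
Runs-weaken le f (runs r b q) = runs r (≤-trans b le) (f q)

temp-represents : ∀ {q r s} i → Represents q (arrs r) s → Represents q (arrs (setCell r 3 0 i)) s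
temp-represents i h .cells  = h .cells
temp-represents i h .stamps = h .stamps

-- 121 and 4 are the squared sizes of the address and of tempE in write.
opaque
  writeWeight : ℕ
  writeWeight = suc (121 + 4 + 2)

  writeWeight-def : ∀ y → y + (121 + 4 + 2) * y ≡ writeWeight * y
  writeWeight-def y = refl

write-run : ∀ {r W} j ie e → bits (vars r 4) ≤ W →
  let r₁ = setCell r 3 0 (eval r ie) in
  Runs (write j ie e) r (writeWeight * (cost r ie + cost r₁ e + W)) (_≡ written r j (eval r ie) (eval r₁ e))
write-run {r} {W} j ie e bq = runs (⇓-seq ⇓-store (⇓-seq ⇓-store ⇓-store)) total refl
  where
  r₁ = setCell r 3 0 (eval r ie)
  addr = bin add (bin mul (lit 2) tempE) (overlaidE epochE)
  r₂ = setCell r₁ (cellA j) (eval r₁ addr) (eval r₁ e)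
  X = cost r ie + cost r₁ e
  Y = X + W
  W≤Y : W ≤ Y
  W≤Y = m≤n+m W X
  i≤Y : bits (eval r ie) ≤ Y
  i≤Y = ≤-trans (bits≤cost r ie) (≤-trans (m≤m+n _ (cost r₁ e)) (m≤m+n X W))
  1≤Y : 1 ≤ Y
  1≤Y = ≤-trans (s≤s z≤n) i≤Y
  addr-cost : cost r₁ addr ≤ 121 * Y
  addr-cost = cost-bound {r₁} addr 1≤Y ((tt , (i≤Y , tt)) , (≤-trans bq W≤Y , (≤-trans bq W≤Y , tt)))
  temp-cost : cost r₂ tempE ≤ 4 * Y
  temp-cost = cost-bound {r₂} tempE 1≤Y (i≤Y , tt)
  total : (1 + cost r ie) + ((cost r₁ addr + cost r₁ e) + (cost r₂ tempE + bits (vars r 4))) ≤ writeWeight * Y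
  total = begin
    (1 + cost r ie) + ((cost r₁ addr + cost r₁ e) + (cost r₂ tempE + bits (vars r 4)))
      ≤⟨ +-mono-≤ (+-monoˡ-≤ (cost r ie) 1≤Y) (+-mono-≤ (+-monoˡ-≤ (cost r₁ e) addr-cost)
          (+-mono-≤ temp-cost (≤-trans bq W≤Y))) ⟩
    (Y + cost r ie) + ((121 * Y + cost r₁ e) + (4 * Y + Y))
      ≡⟨ lem (cost r ie) (cost r₁ e) Y 121 4 ⟩
    (cost r ie + cost r₁ e) + (121 + 4 + 2) * Y
      ≤⟨ +-monoˡ-≤ ((121 + 4 + 2) * Y) (m≤m+n X W) ⟩
    Y + (121 + 4 + 2) * Y
      ≡⟨ writeWeight-def Y ⟩
    writeWeight * Y ∎
    where
    open ≤-Reasoning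
    lem : ∀ a b y m n → (y + a) + ((m * y + b) + (n * y + y)) ≡ (a + b) + (m + n + 2) * y
    lem = solve-∀

Simulates : ℕ → State → State → State → Set
Simulates q r s′ r′ = Represents q (arrs r′) s′ × Frame q r r′

write-simulates : ∀ {r s q i v W} j ie e → vars r 4 ≡ q → bits q ≤ W → Represents q (arrs r) s →
  eval r ie ≡ i → eval (setCell r 3 0 i) e ≡ v →
  Runs (write j ie e) r (writeWeight * (cost r ie + cost (setCell r 3 0 i) e + W)) (Simulates q r (setMem s j i v))
write-simulates {r} j ie e refl bq h refl refl =
  Runs-weaken ≤-refl (λ { refl → written-represents {r} j (eval r ie) _ h , written-frame r j (eval r ie) _ })
      (write-run j ie e bq)

weight : Program → ℕ
weight skip                   = 1
weight (x ≔ e)                = writeWeight * (bits x + weightᵉ e + 1)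
weight (a [ i ]≔ e)           = writeWeight * (weightᵉ i + weightᵉ e + 1)
weight (p ⨾ q)                = weight p + weight q
weight (IF e THEN p ELSE q)   = weightᵉ e + (weight p + weight q)
weight (WHILE e DO p)         = weightᵉ e + weight p

linear-+ : ∀ {a b} x y t u W → a ≤ x * (t * W) → b ≤ y * (u * W) → a + b ≤ (x + y) * ((t + u) * W)
linear-+ {a} {b} x y t u W p q = begin
  a + b ≤⟨ +-mono-≤ p q ⟩
  x * (t * W) + y * (u * W) ≤⟨ m≤m+n _ (x * (u * W) + y * (t * W)) ⟩
  x * (t * W) + y * (u * W) + (x * (u * W) + y * (t * W)) ≡⟨ lem x y t u W ⟩
  (x + y) * ((t + u) * W) ∎
  where
  open ≤-Reasoning
  lem : ∀ x y t u W → x * (t * W) + y * (u * W) + (x * (u * W) + y * (t * W)) ≡ (x + y) * ((t + u) * W)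
  lem = solve-∀

-- Compiled code never writes variable 4, so one `W` serves the whole run. The constants add up over
-- the program text and not over the run: all rounds of a loop share the weight of the loop.
simulation : ∀ {p s s′ t r q W} → p ⊢ s ⇓ s′ within t → vars r 4 ≡ q → bits q ≤ W →
  Represents q (arrs r) s → Runs ⌜ p ⌝ r (weight p * (t * W)) (Simulates q r s′)
simulation {r = r} {W = W} ⇓-skip eq bq h = runs ⇓-skip
    (≤-trans (≤-trans (s≤s z≤n) bq) (≤-reflexive (sym (trans (+-identityʳ _) (+-identityʳ W)))))
    (h , Frame-refl {r = r})
simulation {r = r} {W = W} (⇓-assign {s} {x} {e}) eq bq h =
  Runs-weaken le (λ p → p) (write-simulates {s = s} {i = x} {v = eval s e} 0 (lit x) ⌜ e ⌝ᵉ eq bq h refl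
      (eval-⌜⌝ {r = r₁} e eq (temp-represents {r = r} x h)))
  where
  r₁ = setCell r 3 0 x
  1≤t*W : 1 ≤ cost s e * W
  1≤t*W = *-mono-≤ (1≤cost s e) (≤-trans (s≤s z≤n) bq)
  le : writeWeight * (bits x + cost r₁ ⌜ e ⌝ᵉ + W) ≤ writeWeight * (bits x + weightᵉ e + 1) * (cost s e * W)
  le = begin
    writeWeight * (bits x + cost r₁ ⌜ e ⌝ᵉ + W)
      ≤⟨ *-monoʳ-≤ writeWeight (+-mono-≤ (+-mono-≤ (≤-scale (bits x) 1≤t*W)
          (cost-⌜⌝ {r = r₁} e eq (temp-represents {r = r} x h) bq))
          (≤-trans (≤-scale W (1≤cost s e)) (≤-reflexive (*-comm W _)))) ⟩
    writeWeight * (bits x * (cost s e * W) + weightᵉ e * (cost s e * W) + cost s e * W)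
      ≡⟨ lem writeWeight (bits x) (weightᵉ e) (cost s e * W) ⟩
    writeWeight * (bits x + weightᵉ e + 1) * (cost s e * W) ∎
    where
    open ≤-Reasoning
    lem : ∀ n a b c → n * (a * c + b * c + c) ≡ n * (a + b + 1) * c
    lem = solve-∀
simulation {r = r} {W = W} (⇓-store {s} {a} {i} {e}) eq bq h =
  Runs-weaken le (λ p → p) (write-simulates {s = s} {i = eval s i} {v = eval s e} (suc a) ⌜ i ⌝ᵉ ⌜ e ⌝ᵉ eq bq h
      (eval-⌜⌝ i eq h) (eval-⌜⌝ {r = r₁} e eq (temp-represents {r = r} _ h)))
  where
  r₁ = setCell r 3 0 (eval s i)
  le : writeWeight * (cost r ⌜ i ⌝ᵉ + cost r₁ ⌜ e ⌝ᵉ + W) ≤ writeWeight * (weightᵉ i + weightᵉ e + 1) *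
      ((cost s i + cost s e) * W)
  le = begin
    writeWeight * (cost r ⌜ i ⌝ᵉ + cost r₁ ⌜ e ⌝ᵉ + W)
      ≤⟨ *-monoʳ-≤ writeWeight (+-mono-≤ (linear-+ (weightᵉ i) (weightᵉ e) (cost s i) (cost s e) W
          (cost-⌜⌝ i eq h bq) (cost-⌜⌝ {r = r₁} e eq (temp-represents {r = r} _ h) bq))
           (≤-trans (≤-trans (≤-scale W (≤-trans (1≤cost s i) (m≤m+n (cost s i) (cost s e))))
               (≤-reflexive (*-comm W _))) (≤-reflexive (sym (*-identityˡ _))))) ⟩
    writeWeight * ((weightᵉ i + weightᵉ e) * ((cost s i + cost s e) * W) + 1 * ((cost s i + cost s e) * W))
      ≡⟨ lem writeWeight (weightᵉ i + weightᵉ e) (cost s i + cost s e) W ⟩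
    writeWeight * (weightᵉ i + weightᵉ e + 1) * ((cost s i + cost s e) * W) ∎
    where
    open ≤-Reasoning
    lem : ∀ n a b w → n * (a * (b * w) + 1 * (b * w)) ≡ n * (a + 1) * (b * w)
    lem = solve-∀
simulation {p ⨾ p′} {r = r} {W = W} (⇓-seq {t = t} {u} x y) eq bq h with simulation x eq bq h
... | runs run b (h′ , f) with simulation y (trans (f .vars≡ 4) eq) bq h′
... | runs run′ b′ (h″ , g) = runs (⇓-seq run run′) (linear-+ (weight p) (weight p′) t u W b b′)
    (h″ , Frame-trans {r = r} f g)
simulation {IF e THEN p ELSE p′} {s} {W = W} (⇓-then {t = t} n x) eq bq h with simulation x eq bq h
... | runs run b post = runs (⇓-then (n ∘ trans (sym (eval-⌜⌝ e eq h))) run)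
  (linear-+ (weightᵉ e) (weight p + weight p′) (cost s e) t W (cost-⌜⌝ e eq h bq)
      (≤-trans b (*-monoˡ-≤ (t * W) (m≤m+n (weight p) (weight p′))))) post
simulation {IF e THEN p ELSE p′} {s} {W = W} (⇓-else {t = t} n x) eq bq h with simulation x eq bq h
... | runs run b post = runs (⇓-else (trans (eval-⌜⌝ e eq h) n) run)
  (linear-+ (weightᵉ e) (weight p + weight p′) (cost s e) t W (cost-⌜⌝ e eq h bq)
      (≤-trans b (*-monoˡ-≤ (t * W) (m≤n+m _ (weight p))))) post
simulation {WHILE e DO p} {s} {r = r} {W = W} (⇓-stop n) eq bq h =
  runs (⇓-stop (trans (eval-⌜⌝ e eq h) n)) (≤-trans (cost-⌜⌝ e eq h bq)
      (*-monoˡ-≤ (cost s e * W) (m≤m+n (weightᵉ e) (weight p)))) (h , Frame-refl {r = r})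
simulation {WHILE e DO p} {s} {r = r} {W = W} (⇓-loop {t = t} {u} n x y) eq bq h with simulation x eq bq h
... | runs {time = τ} run b (h′ , f) with simulation y (trans (f .vars≡ 4) eq) bq h′
... | runs {time = τ′} run′ b′ (h″ , g) = runs (⇓-loop (n ∘ trans (sym (eval-⌜⌝ e eq h))) run run′) le
    (h″ , Frame-trans {r = r} f g)
  where
  we = weightᵉ e
  wp = weight p
  le : cost _ ⌜ e ⌝ᵉ + (τ + τ′) ≤ (we + wp) * ((cost s e + (t + u)) * W)
  le = begin
    cost _ ⌜ e ⌝ᵉ + (τ + τ′)
      ≤⟨ +-mono-≤ (≤-trans (cost-⌜⌝ e eq h bq) (*-monoˡ-≤ (cost s e * W) (m≤m+n we wp)))
           (+-mono-≤ (≤-trans b (*-monoˡ-≤ (t * W) (m≤n+m wp we))) b′) ⟩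
    (we + wp) * (cost s e * W) + ((we + wp) * (t * W) + (we + wp) * (u * W))
      ≡⟨ lem (we + wp) (cost s e) t u W ⟩
    (we + wp) * ((cost s e + (t + u)) * W) ∎
    where
    open ≤-Reasoning
    lem : ∀ x a b c w → x * (a * w) + (x * (b * w) + x * (c * w)) ≡ x * ((a + (b + c)) * w)
    lem = solve-∀

-- An assigned value has been charged its length. The solver has to read the oracle's answer, which
-- may be any positive number, and this bounds the cost of doing so.
bits-final-var : ∀ {p s s′ t} → p ⊢ s ⇓ s′ within t → ∀ x → bits (vars s′ x) ≤ bits (vars s x) + t
bits-final-var ⇓-skip x = m≤m+n _ _
bits-final-var {y ≔ e} {s} ⇓-assign x with y ≡ᵇ x
... | true  = ≤-trans (bits≤cost s e) (m≤n+m _ _)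
... | false = m≤m+n _ _
bits-final-var ⇓-store x = m≤m+n _ _
bits-final-var {s = s} (⇓-seq {t = t} {u} a b) x = ≤-trans (bits-final-var b x)
    (≤-trans (+-monoˡ-≤ u (bits-final-var a x)) (≤-reflexive (+-assoc (bits (vars s x)) t u)))
bits-final-var {s = s} (⇓-then {t = t} _ a) x = ≤-trans (bits-final-var a x) (+-monoʳ-≤ (bits (vars s x)) (m≤n+m t _))
bits-final-var {s = s} (⇓-else {t = t} _ a) x = ≤-trans (bits-final-var a x) (+-monoʳ-≤ (bits (vars s x)) (m≤n+m t _))
bits-final-var (⇓-stop _) x = m≤m+n _ _
bits-final-var {WHILE e DO _} {s} (⇓-loop {t = t} {u} _ a b) x =
  ≤-trans (bits-final-var b x) (≤-trans (+-monoˡ-≤ u (bits-final-var a x))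
      (≤-trans (≤-reflexive (+-assoc (bits (vars s x)) t u))
      (+-monoʳ-≤ (bits (vars s x)) (m≤n+m (t + u) (cost s e)))))

-- Graphs of clauses and partial assignments

0<* : ∀ {x y} → 0 < x → 0 < y → 0 < x * y
0<* p q = *-mono-≤ p q

0<*⇒ : ∀ x y → 0 < x * y → 0 < x × 0 < y
0<*⇒ (suc x) (suc y) p = s≤s z≤n , s≤s z≤n
0<*⇒ (suc x) zero    p = ⊥-elim (n≮0 (subst (0 <_) (*-zeroʳ x) p))

0<∸⇒< : ∀ x y → 0 < x ∸ y → y < x
0<∸⇒< x y p = m∸n≢0⇒n<m (λ e → n≮0 (subst (0 <_) e p))

0<1∸⇒≡0 : ∀ x → 0 < 1 ∸ x → x ≡ 0
0<1∸⇒≡0 zero p = refl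
0<1∸⇒≡0 (suc zero) ()
0<1∸⇒≡0 (suc (suc x)) ()

0<+⇒ : ∀ x y → 0 < x + y → 0 < x ⊎ 0 < y
0<+⇒ zero    y p = inj₂ p
0<+⇒ (suc x) y p = inj₁ (s≤s z≤n)

-- Graphs and vertex sets as lists of words

overwrite-≥ : ∀ xs j → length xs ≤ j → overwrite xs (const 0) j ≡ 0
overwrite-≥ [] j p = refl
overwrite-≥ (x ∷ xs) (suc j) (s≤s p) = overwrite-≥ xs j p

overwrite-++ˡ : ∀ xs ys f j → j < length xs → overwrite (xs ++ ys) f j ≡ overwrite xs f j
overwrite-++ˡ (x ∷ xs) ys f zero p = refl
overwrite-++ˡ (x ∷ xs) ys f (suc j) (s≤s p) = overwrite-++ˡ xs ys (f ∘ suc) j p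

overwrite-++ʳ : ∀ xs ys j → overwrite (xs ++ ys) (const 0) (length xs + j) ≡ overwrite ys (const 0) j
overwrite-++ʳ [] ys j = refl
overwrite-++ʳ (x ∷ xs) ys j = overwrite-++ʳ xs ys j

overwrite-∷ʳ : ∀ xs v f j → overwrite (xs ∷ʳ v) f j ≡ update (overwrite xs f) (length xs) v j
overwrite-∷ʳ [] v f zero = refl
overwrite-∷ʳ [] v f (suc j) = refl
overwrite-∷ʳ (x ∷ xs) v f zero = refl
overwrite-∷ʳ (x ∷ xs) v f (suc j) = overwrite-∷ʳ xs v (f ∘ suc) j

overwrite-applyUpTo : ∀ f n j → j < n → overwrite (applyUpTo f n) (const 0) j ≡ f j
overwrite-applyUpTo f (suc n) zero p = refl
overwrite-applyUpTo f (suc n) (suc j) (s≤s p) = overwrite-applyUpTo (f ∘ suc) n j p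

overwrite-concat : ∀ (h : ℕ → List ℕ) n → (∀ u → length (h u) ≡ n) → ∀ m u v → u < m → v < n →
  overwrite (concat (applyUpTo h m)) (const 0) (u * n + v) ≡ overwrite (h u) (const 0) v
overwrite-concat h n len (suc m) zero v p q = overwrite-++ˡ (h 0) _ _ v (subst (v <_) (sym (len 0)) q)
overwrite-concat h n len (suc m) (suc u) v (s≤s p) q = begin
  overwrite (h 0 ++ rest) (const 0) (suc u * n + v)              ≡⟨ cong (overwrite (h 0 ++ rest) (const 0))
      (+-assoc n (u * n) v) ⟩
  overwrite (h 0 ++ rest) (const 0) (n + (u * n + v))            ≡⟨ cong
      (λ l → overwrite (h 0 ++ rest) (const 0) (l + (u * n + v))) (len 0) ⟨
  overwrite (h 0 ++ rest) (const 0) (length (h 0) + (u * n + v)) ≡⟨ overwrite-++ʳ (h 0) rest _ ⟩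
  overwrite rest (const 0) (u * n + v)                           ≡⟨ overwrite-concat (h ∘ suc) n
      (len ∘ suc) m u v p q ⟩
  overwrite (h (suc u)) (const 0) v ∎
  where
  open ≡-Reasoning
  rest = concat (applyUpTo (h ∘ suc) m)

length-concat : ∀ (h : ℕ → List ℕ) n → (∀ u → length (h u) ≡ n) → ∀ m → length (concat (applyUpTo h m)) ≡ m * n
length-concat h n len zero = refl
length-concat h n len (suc m) = trans (length-++ (h 0)) (cong₂ _+_ (len 0) (length-concat (h ∘ suc) n (len ∘ suc) m))

tabulate-∘toℕ : ∀ {A : Set} (f : ℕ → A) n → tabulate {n = n} (f ∘ toℕ) ≡ applyUpTo f n
tabulate-∘toℕ f zero    = refl
tabulate-∘toℕ f (suc n) = cong (f 0 ∷_) (tabulate-∘toℕ (f ∘ suc) n)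

map-∘toℕ-allFin : ∀ {A : Set} (f : ℕ → A) n → map (f ∘ toℕ) (allFin n) ≡ applyUpTo f n
map-∘toℕ-allFin f n = trans (map-tabulate id (f ∘ toℕ)) (tabulate-∘toℕ f n)

encodeGraph-rows : ∀ {n} (G : Graph n) (g : ℕ → ℕ → Bool) → (∀ u v → adj G u v ≡ g (toℕ u) (toℕ v)) →
  encodeGraph G ≡ concat (applyUpTo (λ u → applyUpTo (λ v → bit (g u v)) n) n)
encodeGraph-rows {n} G g e = cong concat
  (trans (map-cong (λ u → trans (map-cong (λ v → cong bit (e u v)) (allFin n))
      (map-∘toℕ-allFin (λ v → bit (g (toℕ u) v)) n)) (allFin n))
     (map-∘toℕ-allFin (λ u → applyUpTo (λ v → bit (g u v)) n) n))

encodeGraph-lookup : ∀ {n} .{{_ : NonZero n}} (G : Graph n) (g : ℕ → ℕ → Bool) →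
    (∀ u v → adj G u v ≡ g (toℕ u) (toℕ v)) →
  ∀ j → j < n * n → overwrite (encodeGraph G) (const 0) j ≡ bit (g (j / n) (j % n))
encodeGraph-lookup {n} G g e j p = begin
  overwrite (encodeGraph G) (const 0) j                       ≡⟨ cong₂ (λ xs i → overwrite xs (const 0) i)
      (encodeGraph-rows G g e) (trans (m≡m%n+[m/n]*n j n) (+-comm (j % n) _)) ⟩
  overwrite (concat (applyUpTo row n)) (const 0) (j / n * n + j % n) ≡⟨ overwrite-concat row n
      (λ u → length-applyUpTo _ n) n (j / n) (j % n) (m<n*o⇒m/o<n p) (m%n<n j n) ⟩
  overwrite (row (j / n)) (const 0) (j % n)                   ≡⟨ overwrite-applyUpTo _ n (j % n) (m%n<n j n) ⟩
  bit (g (j / n) (j % n)) ∎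
  where
  open ≡-Reasoning
  row : ℕ → List ℕ
  row u = applyUpTo (λ v → bit (g u v)) n

encodeGraph-beyond : ∀ {n} (G : Graph n) (g : ℕ → ℕ → Bool) → (∀ u v → adj G u v ≡ g (toℕ u) (toℕ v)) →
  ∀ j → n * n ≤ j → overwrite (encodeGraph G) (const 0) j ≡ 0
encodeGraph-beyond {n} G g e j p = overwrite-≥ (encodeGraph G) j
  (≤-trans (≤-reflexive (trans (cong length (encodeGraph-rows G g e))
      (length-concat _ n (λ u → length-applyUpTo _ n) n))) p)

toSubset : ∀ n → (ℕ → Bool) → Subset n
toSubset n δ = Vec.tabulate (δ ∘ toℕ)

∈-toSubset : ∀ {n} δ (v : Fin n) → v ∈ toSubset n δ → δ (toℕ v) ≡ true
∈-toSubset δ v p = trans (sym (lookup∘tabulate (δ ∘ toℕ) v)) ([]=⇒lookup p)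

toSubset-∈ : ∀ {n} δ (v : Fin n) → δ (toℕ v) ≡ true → v ∈ toSubset n δ
toSubset-∈ δ v p = lookup⇒[]= v _ (trans (lookup∘tabulate (δ ∘ toℕ) v) p)

∉-toSubset : ∀ {n} δ (v : Fin n) → v ∉ toSubset n δ → δ (toℕ v) ≡ false
∉-toSubset δ v p with δ (toℕ v) in eq
... | false = refl
... | true  = ⊥-elim (p (toSubset-∈ δ v eq))

toSubset-∉ : ∀ {n} δ (v : Fin n) → δ (toℕ v) ≡ false → v ∉ toSubset n δ
toSubset-∉ δ v p q with trans (sym p) (∈-toSubset δ v q)
... | ()

selected : (ℕ → Bool) → ℕ → List ℕ
selected δ m = filterᵇ δ (upTo m)

vertices-toSubset : ∀ n δ → vertices (toSubset n δ) ≡ selected δ n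
vertices-toSubset n δ = trans (go (allFin n)) (cong (filterᵇ δ) (map-∘toℕ-allFin id n))
  where
  D = toSubset n δ
  go : ∀ (vs : List (Fin n)) → map toℕ (filter (_∈? D) vs) ≡ filterᵇ δ (map toℕ vs)
  go [] = refl
  go (v ∷ vs) with v ∈? D
  ... | yes p rewrite ∈-toSubset δ v p = cong (toℕ v ∷_) (go vs)
  ... | no ¬p rewrite ∉-toSubset δ v ¬p = go vs

∣toSubset∣ : ∀ n δ → ∣ toSubset n δ ∣ ≡ length (selected δ n)
∣toSubset∣ n δ = go n δ id
  where
  go : ∀ m (δ : ℕ → Bool) (f : ℕ → ℕ) → ∣ Vec.tabulate {n = m} (δ ∘ f ∘ toℕ) ∣ ≡ length (filterᵇ δ (applyUpTo f m))
  go zero    δ f = refl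
  go (suc m) δ f with δ (f 0)
  ... | true  = cong suc (go m δ (f ∘ suc))
  ... | false = go m δ (f ∘ suc)

selected-suc : ∀ δ m → selected δ (suc m) ≡ (if δ m then selected δ m ∷ʳ m else selected δ m)
selected-suc δ m = trans (cong (filterᵇ δ) (sym (upTo-∷ʳ m)))
  (trans (filter-++ (T? ∘ δ) (upTo m) (m ∷ [])) (last (selected δ m)))
  where
  last : ∀ xs → xs ++ filterᵇ δ (m ∷ []) ≡ (if δ m then xs ∷ʳ m else xs)
  last xs with δ m
  ... | true  = refl
  ... | false = ++-identityʳ xs

selected-+ : ∀ δ m l → (∀ x → m ≤ x → δ x ≡ false) → selected δ (m + l) ≡ selected δ m
selected-+ δ m zero    h = cong (selected δ) (+-identityʳ m)
selected-+ δ m (suc l) h = begin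
  selected δ (m + suc l) ≡⟨ cong (selected δ) (+-suc m l) ⟩
  selected δ (suc (m + l)) ≡⟨ selected-suc δ (m + l) ⟩
  (if δ (m + l) then selected δ (m + l) ∷ʳ (m + l) else selected δ (m + l)) ≡⟨ cong
      (λ b → if b then selected δ (m + l) ∷ʳ (m + l) else selected δ (m + l)) (h (m + l) (m≤m+n m l)) ⟩
  selected δ (m + l) ≡⟨ selected-+ δ m l h ⟩
  selected δ m ∎
  where open ≡-Reasoning

length-selected : ∀ δ m → length (selected δ m) ≤ m
length-selected δ m = ≤-trans (length-filter (T? ∘ δ) (upTo m)) (≤-reflexive (length-upTo m))

-- Connectivity of the clause graph after deletions

T-<ᵇ : ∀ {x} → 0 < x → T (0 <ᵇ x)
T-<ᵇ = <⇒<ᵇ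

-- The clause codes below K come first and form a clique; the vertex K + α
-- is joined to the clauses x that the partial assignment α does not
-- satisfy, those with S x α ≡ 0.
edgeVal : (ℕ → ℕ → ℕ) → ℕ → ℕ → ℕ → ℕ
edgeVal S K u v = (v ∸ u) * ((K ∸ u) * ((K ∸ v) + (1 ∸ S u (v ∸ K))))

-- `edgeVal` vanishes unless u < v, so it has an orientation and no loops; adding both orders makes
-- the relation symmetric.
joined : (ℕ → ℕ → ℕ) → ℕ → ℕ → ℕ → Bool
joined S K u v = 0 <ᵇ (edgeVal S K u v + edgeVal S K v u)

clauseGraph : (ℕ → ℕ → ℕ) → ∀ K n → Graph n
clauseGraph S K n .adj u v = joined S K (toℕ u) (toℕ v)
clauseGraph S K n .adj-sym u v = cong (0 <ᵇ_) (+-comm (edgeVal S K (toℕ u) (toℕ v)) _)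
clauseGraph S K n .adj-irr v rewrite n∸n≡0 (toℕ v) = refl

module _ (S : ℕ → ℕ → ℕ) (K L : ℕ) (δ : ℕ → Bool) (δ-clauses : ∀ x → K ≤ x → δ x ≡ false)
         (hub : ℕ) (hub<K : hub < K) (hub-kept : δ hub ≡ false) (hub-satisfied : ∀ α → 0 < S hub α) where

  private
    n : ℕ
    n = K + L
    G : Graph n
    G = clauseGraph S K n
    D : Subset n
    D = toSubset n δ

  hubV : Fin n
  hubV = fromℕ< (≤-trans hub<K (m≤m+n K L))

  toℕ-hub : toℕ hubV ≡ hub
  toℕ-hub = toℕ-fromℕ< _

  hub∉D : hubV ∉ D
  hub∉D = toSubset-∉ δ hubV (trans (cong δ toℕ-hub) hub-kept)

  D⊂⊤ : D ⊂ Subset.⊤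
  D⊂⊤ = (λ _ → ∈⊤) , hubV , ∈⊤ , hub∉D

  clause-edge : ∀ u v → u < v → v < K → 0 < edgeVal S K u v
  clause-edge u v p q = 0<* (m<n⇒0<n∸m p) (0<* (m<n⇒0<n∸m (<-trans p q)) (≤-trans (m<n⇒0<n∸m q) (m≤m+n _ _)))

  assignment-edge : ∀ u α → u < K → S u α ≡ 0 → 0 < edgeVal S K u (K + α)
  assignment-edge u α p e = 0<* (m<n⇒0<n∸m (≤-trans p (m≤m+n K α))) (0<* (m<n⇒0<n∸m p)
    (≤-trans (≤-reflexive (sym (trans (cong (λ y → 1 ∸ S u y) (m+n∸m≡n K α)) (cong (1 ∸_) e))))
        (m≤n+m _ (K ∸ (K + α)))))

  edge-symmetric : ∀ {u v} → Edge∖ G D u v → Edge∖ G D v u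
  edge-symmetric {u} {v} (p , q , e) = q , p , subst T (adj-sym G u v) e

  neighbours-of-assignment : ∀ w α → T (joined S K (K + α) w) → w < K × S w α ≡ 0
  neighbours-of-assignment w α t with 0<+⇒ (edgeVal S K (K + α) w) (edgeVal S K w (K + α)) (<ᵇ⇒< 0 _ t)
  ... | inj₁ p = ⊥-elim (m+n≮m K α (0<∸⇒< K (K + α) (proj₁ (0<*⇒ (K ∸ (K + α)) _ (proj₂ (0<*⇒ (w ∸ (K + α)) _ p))))))
  ... | inj₂ p with 0<*⇒ (K ∸ w) _ (proj₂ (0<*⇒ ((K + α) ∸ w) _ p))
  ... | q , r with 0<+⇒ (K ∸ (K + α)) _ r
  ... | inj₁ z = ⊥-elim (m+n≮m K α (0<∸⇒< K (K + α) z))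
  ... | inj₂ z = 0<∸⇒< K w q , trans (cong (S w) (sym (m+n∸m≡n K α))) (0<1∸⇒≡0 _ z)

  -- The hub survives and is not the vertex of α, so a path between them has a first edge. It would
  -- lead to a kept clause that α does not satisfy.
  satisfied⇒disconnected : ∀ α → α < L → (∀ x → x < K → δ x ≡ false → 0 < S x α) → ¬ Connected∖ G D
  satisfied⇒disconnected α α<L sat conn = no-path (conn a hubV a∉D hub∉D) refl
    where
    a : Fin n
    a = fromℕ< (+-monoʳ-< K α<L)
    toℕ-a : toℕ a ≡ K + α
    toℕ-a = toℕ-fromℕ< _
    a∉D : a ∉ D
    a∉D = toSubset-∉ δ a (trans (cong δ toℕ-a) (δ-clauses _ (m≤m+n K α)))
    no-path : ∀ {w} → Star (Edge∖ G D) a w → w ≡ hubV → ⊥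
    no-path Star.ε e = m+n≮m K α (subst (_< K) (trans (sym toℕ-hub) (trans (cong toℕ (sym e)) toℕ-a)) hub<K)
    no-path (_◅_ {j = w} (_ , w∉D , t) _) _
      with neighbours-of-assignment (toℕ w) α (subst (λ z → T (joined S K z (toℕ w))) toℕ-a t)
    ... | w<K , e = n≮0 (subst (0 <_) e (sat (toℕ w) w<K (∉-toSubset δ w w∉D)))

  -- Two edges always suffice to reach the hub: kept clauses are adjacent to it in the clique, and
  -- an assignment goes through a kept clause that it does not satisfy.
  unsatisfied⇒connected : (∀ α → α < L → ∃[ x ] x < K × δ x ≡ false × S x α ≡ 0) → Connected∖ G D
  unsatisfied⇒connected unsat u v u∉D v∉D = to-hub u u∉D ◅◅ reverse edge-symmetric (to-hub v v∉D)
    where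
    clause-to-hub : ∀ w → w ∉ D → toℕ w < K → Star (Edge∖ G D) w hubV
    clause-to-hub w w∉D w<K with <-cmp (toℕ w) hub
    ... | tri≈ _ e _ = subst (Star (Edge∖ G D) w) (toℕ-injective (trans e (sym toℕ-hub))) Star.ε
    ... | tri< p _ _ = (w∉D , hub∉D , subst (λ z → T (joined S K (toℕ w) z)) (sym toℕ-hub)
                          (T-<ᵇ (≤-trans (clause-edge _ _ p hub<K) (m≤m+n _ _)))) ◅ Star.ε
    ... | tri> _ _ p = (w∉D , hub∉D , subst (λ z → T (joined S K (toℕ w) z)) (sym toℕ-hub)
                          (T-<ᵇ (≤-trans (clause-edge _ _ p w<K) (m≤n+m _ (edgeVal S K (toℕ w) hub))))) ◅ Star.ε
    to-hub : ∀ w → w ∉ D → Star (Edge∖ G D) w hubV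
    to-hub w w∉D with toℕ w <? K
    ... | yes w<K = clause-to-hub w w∉D w<K
    ... | no w≮K with unsat (toℕ w ∸ K) (+-cancelˡ-< K _ _ (subst (_< n) (sym (m+[n∸m]≡n (≮⇒≥ w≮K))) (toℕ<n w)))
    ... | x , x<K , kept , e = (w∉D , x∉D , edge) ◅ clause-to-hub xV x∉D (subst (_< K) (sym toℕ-x) x<K)
      where
      xV : Fin n
      xV = fromℕ< (≤-trans x<K (m≤m+n K L))
      toℕ-x : toℕ xV ≡ x
      toℕ-x = toℕ-fromℕ< _
      x∉D : xV ∉ D
      x∉D = toSubset-∉ δ xV (trans (cong δ toℕ-x) kept)
      edge : T (joined S K (toℕ w) (toℕ xV))
      edge = subst₂ (λ y z → T (joined S K y z)) (m+[n∸m]≡n (≮⇒≥ w≮K)) (sym toℕ-x)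
        (T-<ᵇ (≤-trans (assignment-edge x (toℕ w ∸ K) x<K e) (m≤n+m _ (edgeVal S K (K + (toℕ w ∸ K)) x))))

-- Clause codes

mod : ℕ → ℕ → ℕ
mod x y = x ∸ ⟦ div ⟧ x y * y

div≡/ : ∀ x y .{{_ : NonZero y}} → ⟦ div ⟧ x y ≡ x / y
div≡/ x (suc y) = refl

mod≡% : ∀ x y .{{_ : NonZero y}} → mod x y ≡ x % y
mod≡% x (suc y) = sym (m%n≡m∸m/n*n x (suc y))

div-*+ : ∀ x {B l} → l < B → ⟦ div ⟧ (x * B + l) B ≡ x
div-*+ x {suc B} {l} p = begin
  (x * suc B + l) / suc B       ≡⟨ +-distrib-/ (x * suc B) l
      (subst (λ z → z + l % suc B < suc B) (sym (m*n%n≡0 x (suc B))) (m%n<n l (suc B))) ⟩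
  x * suc B / suc B + l / suc B ≡⟨ cong₂ _+_ (m*n/n≡m x (suc B)) (m<n⇒m/n≡0 p) ⟩
  x + 0                         ≡⟨ +-identityʳ x ⟩
  x ∎
  where open ≡-Reasoning

mod-*+ : ∀ x {B l} → l < B → mod (x * B + l) B ≡ l
mod-*+ x {B} {l} p = trans (cong (λ z → x * B + l ∸ z * B) (div-*+ x p)) (m+n∸m≡n (x * B) l)

mod-< : ∀ {x y} → x < y → mod x y ≡ x
mod-< {x} {suc y} p = cong (λ z → x ∸ z * suc y) (m<n⇒m/n≡0 p)

mod<y : ∀ x {y} → 0 < y → mod x y < y
mod<y x {suc y} p = subst (_< suc y) (sym (mod≡% x (suc y))) (m%n<n x (suc y))

testBit : ℕ → ℕ → ℕ
testBit zero    m = m % 2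
testBit (suc j) m = testBit j (m / 2)

-- The left side is what the solver computes, with a single division by a tabulated power of two.
testBit≡ : ∀ j m → mod (⟦ div ⟧ m (2 ^ j)) 2 ≡ testBit j m
testBit≡ zero m = trans (cong (λ z → mod z 2) (n/1≡n m)) (mod≡% m 2)
testBit≡ (suc j) m = trans (cong (λ z → mod z 2) lem) (testBit≡ j (m / 2))
  where
  instance
    nz : NonZero (2 ^ j)
    nz = m^n≢0 2 j
    nz′ : NonZero (2 * 2 ^ j)
    nz′ = m^n≢0 2 (suc j)
  lem : ⟦ div ⟧ m (2 ^ suc j) ≡ ⟦ div ⟧ (m / 2) (2 ^ j)
  lem = trans (div≡/ m (2 * 2 ^ j)) (trans (sym (m/n/o≡m/[n*o] m 2 (2 ^ j))) (sym (div≡/ (m / 2) (2 ^ j))))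

testBit<2 : ∀ j m → testBit j m < 2
testBit<2 zero    m = m%n<n m 2
testBit<2 (suc j) m = testBit<2 j (m / 2)

bit<2 : ∀ b → bit b < 2
bit<2 true  = s≤s (s≤s z≤n)
bit<2 false = s≤s z≤n

bit-0<ᵇ : ∀ {x} → x < 2 → bit (0 <ᵇ x) ≡ x
bit-0<ᵇ {zero} p = refl
bit-0<ᵇ {suc zero} p = refl
bit-0<ᵇ {suc (suc x)} (s≤s (s≤s ()))

bit-injective : ∀ {b c} → bit b ≡ bit c → b ≡ c
bit-injective {true} {true} e = refl
bit-injective {false} {false} e = refl

numeral : (ℕ → Bool) → ℕ → ℕ
numeral g zero    = 0
numeral g (suc w) = numeral (g ∘ suc) w * 2 + bit (g 0)

numeral<2^ : ∀ g w → numeral g w < 2 ^ w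
numeral<2^ g zero    = s≤s z≤n
numeral<2^ g (suc w) = begin-strict
  numeral (g ∘ suc) w * 2 + bit (g 0) <⟨ +-monoʳ-< _ (bit<2 (g 0)) ⟩
  numeral (g ∘ suc) w * 2 + 2         ≡⟨ +-comm _ 2 ⟩
  suc (numeral (g ∘ suc) w) * 2       ≤⟨ *-monoˡ-≤ 2 (numeral<2^ (g ∘ suc) w) ⟩
  2 ^ w * 2                           ≡⟨ *-comm (2 ^ w) 2 ⟩
  2 ^ suc w ∎
  where open ≤-Reasoning

testBit-numeral : ∀ g w j → j < w → testBit j (numeral g w) ≡ bit (g j)
testBit-numeral g (suc w) zero p = trans (sym (mod≡% (numeral g (suc w)) 2))
    (mod-*+ (numeral (g ∘ suc) w) (bit<2 (g 0)))
testBit-numeral g (suc w) (suc j) (s≤s p) =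
  trans (cong (testBit j) (div-*+ (numeral (g ∘ suc) w) (bit<2 (g 0)))) (testBit-numeral (g ∘ suc) w j p)

eqVal : ℕ → ℕ → ℕ
eqVal x y = 1 ∸ ((x ∸ y) + (y ∸ x))

eqVal-refl : ∀ x → eqVal x x ≡ 1
eqVal-refl x rewrite n∸n≡0 x = refl

0<eqVal⇒≡ : ∀ x y → 0 < eqVal x y → x ≡ y
0<eqVal⇒≡ x y p with 0<1∸⇒≡0 _ p
... | e = ≤-antisym (m∸n≡0⇒m≤n (m+n≡0⇒m≡0 (x ∸ y) e)) (m∸n≡0⇒m≤n (m+n≡0⇒n≡0 (x ∸ y) e))

-- Positive iff l codes a literal of one of the variables lo, …, hi - 1
-- that is true when variable lo + j gets bit j of m; P tabulates powers
-- of two.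
literalVal : (ℕ → ℕ) → ℕ → ℕ → ℕ → ℕ → ℕ
literalVal P lo hi m l =
  l * (((i + 1) ∸ lo) * ((hi ∸ i) * eqVal (mod (l ∸ 1) 2) (mod (⟦ div ⟧ m (P (i ∸ lo))) 2)))
  where
  i : ℕ
  i = ⟦ div ⟧ (l ∸ 1) 2

-- The number x is read as k digits in base B, each of them a literal code. Clauses shorter than k
-- have leading zeros, which contribute nothing because `literalVal` has the factor l.
clauseVal : (ℕ → ℕ) → ℕ → ℕ → ℕ → ℕ → ℕ → ℕ → ℕ
clauseVal P B lo hi m zero    x = 0
clauseVal P B lo hi m (suc k) x = literalVal P lo hi m (mod x B) + clauseVal P B lo hi m k (⟦ div ⟧ x B)

horner : ℕ → ℕ → List ℕ → ℕ
horner B = foldl λ x l → x * B + l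

horner-< : ∀ B j x ls → x < B ^ j → All (_< B) ls → horner B x ls < B ^ (j + length ls)
horner-< B j x [] p [] = subst (λ z → x < B ^ z) (sym (+-identityʳ j)) p
horner-< B j x (l ∷ ls) p (q ∷ qs) = subst (λ z → horner B (x * B + l) ls < B ^ z) (sym (+-suc j (length ls)))
  (horner-< B (suc j) (x * B + l) ls (begin-strict
    x * B + l <⟨ +-monoʳ-< (x * B) q ⟩
    x * B + B ≡⟨ +-comm (x * B) B ⟩
    suc x * B ≤⟨ *-monoˡ-≤ B p ⟩
    B ^ j * B ≡⟨ *-comm (B ^ j) B ⟩
    B ^ suc j ∎) qs)
  where open ≤-Reasoning

literalCode : ℕ → Bool → ℕ
literalCode i b = suc (2 * i + bit b)

module _ (P : ℕ → ℕ) (B lo hi m : ℕ) where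

  literalsVal : List ℕ → ℕ
  literalsVal []       = 0
  literalsVal (l ∷ ls) = literalVal P lo hi m l + literalsVal ls

  -- `horner` appends digits at the low end and `clauseVal` strips them from there, so the literals
  -- come off in reverse order, which their sum does not notice.
  clauseVal-horner : ∀ j x ls → All (_< B) ls →
    clauseVal P B lo hi m (length ls + j) (horner B x ls) ≡ clauseVal P B lo hi m j x + literalsVal ls
  clauseVal-horner j x [] [] = sym (+-identityʳ _)
  clauseVal-horner j x (l ∷ ls) (p ∷ ps) = begin
    clauseVal P B lo hi m (suc (length ls + j)) (horner B (x * B + l) ls)
      ≡⟨ cong (λ z → clauseVal P B lo hi m z (horner B (x * B + l) ls)) (+-suc (length ls) j) ⟨
    clauseVal P B lo hi m (length ls + suc j) (horner B (x * B + l) ls)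
      ≡⟨ clauseVal-horner (suc j) (x * B + l) ls ps ⟩
    literalVal P lo hi m (mod (x * B + l) B) + clauseVal P B lo hi m j (⟦ div ⟧ (x * B + l) B) + literalsVal ls
      ≡⟨ cong₂ (λ y z → literalVal P lo hi m y + clauseVal P B lo hi m j z + literalsVal ls) (mod-*+ x p)
          (div-*+ x p) ⟩
    literalVal P lo hi m l + clauseVal P B lo hi m j x + literalsVal ls
      ≡⟨ lem (literalVal P lo hi m l) _ (literalsVal ls) ⟩
    clauseVal P B lo hi m j x + (literalVal P lo hi m l + literalsVal ls) ∎
    where
    open ≡-Reasoning
    lem : ∀ a b c → a + b + c ≡ b + (a + c)
    lem = solve-∀

  clauseVal-0 : 0 < B → ∀ j → clauseVal P B lo hi m j 0 ≡ 0
  clauseVal-0 p zero    = refl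
  clauseVal-0 p (suc j) = trans (cong₂ _+_ (cong (literalVal P lo hi m) (mod-< p))
      (trans (cong (clauseVal P B lo hi m j) (div-0 p)) (clauseVal-0 p j))) refl
    where
    div-0 : ∀ {B} → 0 < B → ⟦ div ⟧ 0 B ≡ 0
    div-0 {suc B} _ = 0/n≡0 (suc B)

  clauseVal-code : ∀ {k} ls → length ls ≤ k → All (_< B) ls → 0 < B →
    clauseVal P B lo hi m k (horner B 0 ls) ≡ literalsVal ls
  clauseVal-code {k} ls p ps q = begin
    clauseVal P B lo hi m k (horner B 0 ls)
      ≡⟨ cong (λ z → clauseVal P B lo hi m z (horner B 0 ls)) (m+[n∸m]≡n p) ⟨
    clauseVal P B lo hi m (length ls + (k ∸ length ls)) (horner B 0 ls)
      ≡⟨ clauseVal-horner (k ∸ length ls) 0 ls ps ⟩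
    clauseVal P B lo hi m (k ∸ length ls) 0 + literalsVal ls
      ≡⟨ cong (_+ literalsVal ls) (clauseVal-0 q (k ∸ length ls)) ⟩
    literalsVal ls ∎
    where open ≡-Reasoning

  literalVal-code : ∀ i b → literalVal P lo hi m (literalCode i b) ≡
    literalCode i b * (((i + 1) ∸ lo) * ((hi ∸ i) * eqVal (bit b) (mod (⟦ div ⟧ m (P (i ∸ lo))) 2)))
  literalVal-code i b = cong₂ (λ j r → literalCode i b *
      (((j + 1) ∸ lo) * ((hi ∸ j) * eqVal r (mod (⟦ div ⟧ m (P (j ∸ lo))) 2))))
    (trans (cong (λ z → ⟦ div ⟧ (z + bit b) 2) (*-comm 2 i)) (div-*+ i (bit<2 b)))
    (trans (cong (λ z → mod (z + bit b) 2) (*-comm 2 i)) (mod-*+ i (bit<2 b)))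

  literalVal-intro : ∀ i b → P (i ∸ lo) ≡ 2 ^ (i ∸ lo) → lo ≤ i → i < hi → testBit (i ∸ lo) m ≡ bit b →
    0 < literalVal P lo hi m (literalCode i b)
  literalVal-intro i b Pi lo≤i i<hi t = subst (0 <_) (sym (literalVal-code i b))
    (0<* {literalCode i b} (s≤s z≤n) (0<* (m<n⇒0<n∸m (≤-trans (s≤s lo≤i) (≤-reflexive (+-comm 1 i))))
        (0<* (m<n⇒0<n∸m i<hi)
      (≤-reflexive (sym (trans (cong (eqVal (bit b))
          (trans (cong (λ z → mod (⟦ div ⟧ m z) 2) Pi) (trans (testBit≡ (i ∸ lo) m) t))) (eqVal-refl (bit b))))))))

  literalVal-elim : ∀ i b → P (i ∸ lo) ≡ 2 ^ (i ∸ lo) → 0 < literalVal P lo hi m (literalCode i b) →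
    lo ≤ i × i < hi × testBit (i ∸ lo) m ≡ bit b
  literalVal-elim i b Pi p
    with 0<*⇒ (literalCode i b) _ (subst (0 <_) (literalVal-code i b) p)
  ... | _ , p₁ with 0<*⇒ ((i + 1) ∸ lo) _ p₁
  ... | p₂ , p₃ with 0<*⇒ (hi ∸ i) _ p₃
  ... | p₄ , p₅ =
    ≤-pred (≤-trans (0<∸⇒< (i + 1) lo p₂) (≤-reflexive (+-comm i 1))) , 0<∸⇒< hi i p₄ ,
    trans (sym (trans (cong (λ z → mod (⟦ div ⟧ m z) 2) Pi) (testBit≡ (i ∸ lo) m))) (sym (0<eqVal⇒≡ _ _ p₅))

codes : ∀ {N} → Clause N → List ℕ
codes = map λ l → suc (2 * toℕ (proj₂ l) + bit (proj₁ l))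

-- Literal codes go up to 2 N. The summand 3 leaves room for the codes 1 and 2 of the two literals
-- of variable 0 even if N = 0, since the hub is built from them.
base : ℕ → ℕ
base N = 3 + 2 * N

codes<base : ∀ {N} (c : Clause N) → All (_< base N) (codes c)
codes<base [] = []
codes<base {N} ((b , i) ∷ c) = s≤s (s≤s (begin
    2 * toℕ i + bit b ≤⟨ +-monoʳ-≤ (2 * toℕ i) (<⇒≤ (bit<2 b)) ⟩
    2 * toℕ i + 2     ≡⟨ lem (toℕ i) ⟩
    2 * suc (toℕ i)   ≤⟨ *-monoʳ-≤ 2 (toℕ<n i) ⟩
    2 * N             ≤⟨ n≤1+n _ ⟩
    suc (2 * N) ∎)) ∷ codes<base c
  where
  open ≤-Reasoning
  lem : ∀ i → 2 * i + 2 ≡ 2 * suc i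
  lem = solve-∀

clauseCode : ∀ {N} → Clause N → ℕ
clauseCode {N} c = horner (base N) 0 (codes c)

-- The parsing loop of the solver as a function. On clauses of width at most k the reduction modulo
-- K changes nothing; it bounds the partial code by K without any record of how much of the clause
-- has been read.
marks : ℕ → ℕ → ℕ → (ℕ → ℕ) → List ℕ → ℕ → ℕ
marks B K x M []           = M
marks B K x M (zero ∷ ws)  = marks B K 0 (update M x 1) ws
marks B K x M (suc w ∷ ws) = marks B K (mod (x * B + suc w) K) M ws

marks-clause : ∀ {N k} j x M (c : Clause N) ws → x < base N ^ j → j + length c ≤ k →
  marks (base N) (base N ^ k) x M (codes c ++ 0 ∷ ws) ≡
  marks (base N) (base N ^ k) 0 (update M (horner (base N) x (codes c)) 1) ws
marks-clause j x M [] ws p q = refl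
marks-clause {N} {k} j x M (l ∷ c) ws p q with codes<base (l ∷ c)
... | l<B ∷ c<B =
  trans (cong (λ z → marks (base N) (base N ^ k) z M (codes c ++ 0 ∷ ws))
      (mod-< (≤-trans next (^-monoʳ-≤ (base N) j<k))))
    (marks-clause (suc j) _ M c ws next (subst (_≤ k) (+-suc j (length c)) q))
  where
  next : x * base N + suc (2 * toℕ (proj₂ l) + bit (proj₁ l)) < base N ^ suc j
  next = subst (λ z → x * base N + suc (2 * toℕ (proj₂ l) + bit (proj₁ l)) < base N ^ z) (+-comm j 1)
      (horner-< (base N) j x (_ ∷ []) p (l<B ∷ []))
  j<k : suc j ≤ k
  j<k = ≤-trans (m≤m+n (suc j) (length c)) (subst (_≤ k) (+-suc j (length c)) q)

module _ {N k : ℕ} where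

  private
    K = base N ^ k

  marks-CNF-∷ : ∀ M c (φ : CNF N) → length c ≤ k →
    marks (base N) K 0 M (encodeCNF (c ∷ φ)) ≡ marks (base N) K 0 (update M (clauseCode c) 1) (encodeCNF φ)
  marks-CNF-∷ M c φ p = trans (cong (marks (base N) K 0 M) (++-assoc (codes c) (0 ∷ []) (encodeCNF φ)))
    (marks-clause 0 0 M c (encodeCNF φ) (s≤s z≤n) p)

  marks-sound : ∀ M (φ : CNF N) → IsKCNF k φ → ∀ y → 0 < marks (base N) K 0 M (encodeCNF φ) y →
    0 < M y ⊎ Any (λ c → clauseCode c ≡ y) φ
  marks-sound M [] [] y p = inj₁ p
  marks-sound M (c ∷ φ) (q ∷ qs) y p
    with marks-sound _ φ qs y (subst (λ f → 0 < f y) (marks-CNF-∷ M c φ q) p)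
  ... | inj₂ r = inj₂ (there r)
  ... | inj₁ r with clauseCode c ≟ y
  ...   | yes e = inj₂ (here e)
  ...   | no ne = inj₁ (subst (0 <_) (update-other M 1 ne) r)

  marks-complete : ∀ M (φ : CNF N) → IsKCNF k φ → ∀ y → 0 < M y ⊎ Any (λ c → clauseCode c ≡ y) φ →
    0 < marks (base N) K 0 M (encodeCNF φ) y
  marks-complete M [] [] y (inj₁ p) = p
  marks-complete M (c ∷ φ) (q ∷ qs) y h =
    subst (λ f → 0 < f y) (sym (marks-CNF-∷ M c φ q)) (marks-complete _ φ qs y (next h))
    where
    next : 0 < M y ⊎ Any (λ c → clauseCode c ≡ y) (c ∷ φ) → 0 < update M (clauseCode c) 1 y ⊎ Any
        (λ c → clauseCode c ≡ y) φ
    next (inj₂ (there r)) = inj₂ r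
    next (inj₂ (here refl)) = inj₁ (subst (0 <_) (sym (update-same M (clauseCode c) 1)) (s≤s z≤n))
    next (inj₁ p) with clauseCode c ≟ y
    ... | yes refl = inj₁ (subst (0 <_) (sym (update-same M (clauseCode c) 1)) (s≤s z≤n))
    ... | no ne = inj₁ (subst (0 <_) (sym (update-other M 1 ne)) p)

-- Satisfiability through the two blocks of variables

module _ {N a b : ℕ} (P : ℕ → ℕ) (P-power : ∀ j → j ≤ a + b → P j ≡ 2 ^ j) (N≤a+b : N ≤ a + b) where

  Agrees : (Fin N → Bool) → ℕ → ℕ → Set
  Agrees σ α τ = ∀ i → (toℕ i < a → testBit (toℕ i) α ≡ bit (σ i)) × (a ≤ toℕ i → testBit (toℕ i ∸ a) τ ≡ bit (σ i))

  private
    P-index : ∀ (i : Fin N) lo → P (toℕ i ∸ lo) ≡ 2 ^ (toℕ i ∸ lo)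
    P-index i lo = P-power _ (≤-trans (m∸n≤m (toℕ i) lo) (≤-trans (<⇒≤ (toℕ<n i)) N≤a+b))

  literals-intro : ∀ {σ α τ} → Agrees σ α τ → ∀ c → Any (λ l → σ (proj₂ l) ≡ proj₁ l) c →
    0 < literalsVal P (base N) 0 a α (codes c) ⊎ 0 < literalsVal P (base N) a (a + b) τ (codes c)
  literals-intro {σ} {α} {τ} agree ((s , i) ∷ c) (here refl) with toℕ i <? a
  ... | yes p = inj₁ (≤-trans (literalVal-intro P (base N) 0 a α (toℕ i) s (P-index i 0) z≤n p (proj₁ (agree i) p))
      (m≤m+n (literalVal P 0 a α (literalCode (toℕ i) s)) _))
  ... | no ¬p = inj₂ (≤-trans (literalVal-intro P (base N) a (a + b) τ (toℕ i) s (P-index i a) (≮⇒≥ ¬p)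
                    (≤-trans (toℕ<n i) N≤a+b) (proj₂ (agree i) (≮⇒≥ ¬p)))
                        (m≤m+n (literalVal P a (a + b) τ (literalCode (toℕ i) s)) _))
  literals-intro {σ} {α} {τ} agree ((s , i) ∷ c) (there h) with literals-intro agree c h
  ... | inj₁ p = inj₁ (≤-trans p (m≤n+m _ (literalVal P 0 a α (literalCode (toℕ i) s))))
  ... | inj₂ p = inj₂ (≤-trans p (m≤n+m _ (literalVal P a (a + b) τ (literalCode (toℕ i) s))))

  literals-elim : ∀ {σ α τ} → Agrees σ α τ → ∀ c →
    0 < literalsVal P (base N) 0 a α (codes c) ⊎ 0 < literalsVal P (base N) a (a + b) τ (codes c) →
    Any (λ l → σ (proj₂ l) ≡ proj₁ l) c
  literals-elim agree [] (inj₁ ())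
  literals-elim agree [] (inj₂ ())
  literals-elim {σ} {α} {τ} agree ((s , i) ∷ c) (inj₁ p) with 0<+⇒ (literalVal P 0 a α (literalCode (toℕ i) s)) _ p
  ... | inj₂ q = there (literals-elim agree c (inj₁ q))
  ... | inj₁ q with literalVal-elim P (base N) 0 a α (toℕ i) s (P-index i 0) q
  ...   | _ , i<a , t = here (bit-injective (trans (sym (proj₁ (agree i) i<a)) t))
  literals-elim {σ} {α} {τ} agree ((s , i) ∷ c) (inj₂ p) with 0<+⇒
      (literalVal P a (a + b) τ (literalCode (toℕ i) s)) _ p
  ... | inj₂ q = there (literals-elim agree c (inj₂ q))
  ... | inj₁ q with literalVal-elim P (base N) a (a + b) τ (toℕ i) s (P-index i a) q
  ...   | a≤i , _ , t = here (bit-injective (trans (sym (proj₂ (agree i) a≤i)) t))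

  decode : ℕ → ℕ → Fin N → Bool
  decode α τ i = 0 <ᵇ (if toℕ i <ᵇ a then testBit (toℕ i) α else testBit (toℕ i ∸ a) τ)

  decode-agrees : ∀ α τ → Agrees (decode α τ) α τ
  decode-agrees α τ i with toℕ i <ᵇ a in eq
  ... | true  = (λ _ → sym (bit-0<ᵇ (testBit<2 (toℕ i) α))) ,
                (λ p → ⊥-elim (<⇒≱ (<ᵇ⇒< (toℕ i) a (subst T (sym eq) tt)) p))
  ... | false = (λ p → ⊥-elim (subst T eq (<⇒<ᵇ p))) , (λ _ → sym (bit-0<ᵇ (testBit<2 (toℕ i ∸ a) τ)))

  -- The blocks together have a + b ≥ N positions. Those from N on are dummies, and any value would
  -- do.
  extend : (Fin N → Bool) → ℕ → Bool
  extend σ j with j <? N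
  ... | yes p = σ (fromℕ< p)
  ... | no _  = false

  extend-toℕ : ∀ σ i → extend σ (toℕ i) ≡ σ i
  extend-toℕ σ i with toℕ i <? N
  ... | yes p = cong σ (toℕ-injective (toℕ-fromℕ< p))
  ... | no ¬p = ⊥-elim (¬p (toℕ<n i))

  numeral-agrees : ∀ σ → Agrees σ (numeral (extend σ) a) (numeral (λ j → extend σ (a + j)) b)
  numeral-agrees σ i .proj₁ p = trans (testBit-numeral _ a (toℕ i) p) (cong bit (extend-toℕ σ i))
  numeral-agrees σ i .proj₂ p = trans (testBit-numeral _ b (toℕ i ∸ a)
      (+-cancelˡ-< a _ _ (subst (_< a + b) (sym (m+[n∸m]≡n p)) (≤-trans (toℕ<n i) N≤a+b))))
    (cong bit (trans (cong (extend σ) (m+[n∸m]≡n p)) (extend-toℕ σ i)))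

  module Deletion {k : ℕ} (φ : CNF N) (φ-k : IsKCNF k φ) (2≤k : 2 ≤ k) (1≤a : 1 ≤ a) (M : ℕ → ℕ) where

    K : ℕ
    K = base N ^ k

    -- The code of the tautology consisting of the two literals of variable
    -- 0, which belongs to the first block: this clause is never deleted and
    -- has no edge to an assignment, so an isolated assignment disconnects
    -- the graph.
    hub : ℕ
    hub = 1 * base N + 2

    deleted : ℕ → ℕ → Bool
    deleted τ x = (x <ᵇ K) ∧ (0 <ᵇ ((1 ∸ M x) + clauseVal P (base N) a (a + b) τ k x))

    satisfies : ℕ → ℕ → ℕ
    satisfies x α = clauseVal P (base N) 0 a α k x

    clauseVal≡ : ∀ lo hi m (c : Clause N) → length c ≤ k → clauseVal P (base N) lo hi m k
        (clauseCode c) ≡ literalsVal P (base N) lo hi m (codes c)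
    clauseVal≡ lo hi m c p = clauseVal-code P (base N) lo hi m (codes c) (≤-trans (≤-reflexive (length-map _ c)) p)
        (codes<base c) (s≤s z≤n)

    hub-literals : ∀ lo hi m → clauseVal P (base N) lo hi m k hub ≡ literalsVal P (base N) lo hi m (1 ∷ 2 ∷ [])
    hub-literals lo hi m = clauseVal-code P (base N) lo hi m (1 ∷ 2 ∷ []) 2≤k
        (s≤s (s≤s z≤n) ∷ s≤s (s≤s (s≤s z≤n)) ∷ []) (s≤s z≤n)

    hub<K : hub < K
    hub<K = ≤-trans (horner-< (base N) 0 0 (1 ∷ 2 ∷ []) (s≤s z≤n) (s≤s (s≤s z≤n) ∷ s≤s (s≤s (s≤s z≤n)) ∷ []))
        (^-monoʳ-≤ (base N) 2≤k)

    hub-satisfied : ∀ α → 0 < satisfies hub α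
    hub-satisfied α = subst (0 <_) (sym (hub-literals 0 a α)) (lem (0 <ᵇ testBit 0 α) (sym (bit-0<ᵇ (testBit<2 0 α))))
      where
      lem : ∀ s → testBit 0 α ≡ bit s → 0 < literalsVal P (base N) 0 a α (1 ∷ 2 ∷ [])
      lem false e = ≤-trans (literalVal-intro P (base N) 0 a α 0 false (P-power 0 z≤n) z≤n 1≤a e) (m≤m+n _ _)
      lem true  e = ≤-trans (literalVal-intro P (base N) 0 a α 0 true (P-power 0 z≤n) z≤n 1≤a e)
        (≤-trans (m≤m+n _ 0) (m≤n+m _ (literalVal P 0 a α 1)))

    kept : ∀ τ x → 0 < M x → clauseVal P (base N) a (a + b) τ k x ≡ 0 → deleted τ x ≡ false
    kept τ x p e with M x | x <ᵇ K
    ... | suc y | true  rewrite 0∸n≡0 y | e = refl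
    ... | suc y | false = refl

    kept-elim : ∀ τ x → x < K → deleted τ x ≡ false → 0 < M x × clauseVal P (base N) a (a + b) τ k x ≡ 0
    kept-elim τ x x<K e with x <ᵇ K | <⇒<ᵇ x<K
    ... | true | _ with M x | clauseVal P (base N) a (a + b) τ k x
    kept-elim τ x x<K () | true | _ | zero | z
    kept-elim τ x x<K e  | true | _ | suc y | zero = s≤s z≤n , refl
    kept-elim τ x x<K e  | true | _ | suc y | suc z with () ← trans (sym e) (cong (0 <ᵇ_) (+-suc (0 ∸ y) z))

    deleted-clauses : ∀ τ x → K ≤ x → deleted τ x ≡ false
    deleted-clauses τ x p with x <ᵇ K in eq
    ... | false = refl
    ... | true  = ⊥-elim (<⇒≱ (<ᵇ⇒< x K (subst T (sym eq) tt)) p)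

    module _ (M≡ : ∀ y → M y ≡ marks (base N) K 0 (update (const 0) hub 1) (encodeCNF φ) y) where

      marked-sound : ∀ y → 0 < M y → y ≡ hub ⊎ Any (λ c → clauseCode c ≡ y) φ
      marked-sound y p with marks-sound {k = k} _ φ φ-k y (subst (0 <_) (M≡ y) p)
      ... | inj₂ r = inj₂ r
      ... | inj₁ r with hub ≟ y
      ...   | yes e = inj₁ (sym e)
      ...   | no ne = ⊥-elim (n≮0 (subst (0 <_) (update-other (const 0) 1 ne) r))

      -- The hub is marked before parsing starts, and no τ satisfies it: both of its literals are on
      -- variable 0, which lies outside the second block because 1 ≤ a.
      hub-kept : ∀ τ → deleted τ hub ≡ false
      hub-kept τ = kept τ hub
        (subst (0 <_) (sym (M≡ hub)) (marks-complete {k = k} _ φ φ-k hub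
            (inj₁ (subst (0 <_) (sym (update-same (const 0) hub 1)) (s≤s z≤n)))))
        (trans (hub-literals a (a + b) τ) (cong₂ _+_ (outside-block false)
            (trans (+-identityʳ _) (outside-block true))))
        where
        outside-block : ∀ s → literalVal P a (a + b) τ (suc (bit s)) ≡ 0
        outside-block s with literalVal P a (a + b) τ (suc (bit s)) in eq
        ... | zero = refl
        ... | suc _ = ⊥-elim (<⇒≱ 1≤a (proj₁ (literalVal-elim P (base N) a (a + b) τ 0 s
                        (subst (λ z → P z ≡ 2 ^ z) (sym (0∸n≡0 a)) (P-power 0 z≤n))
                            (subst (0 <_) (sym eq) (s≤s z≤n)))))

      satisfiable⇒ : Satisfiable φ →
        ∃[ α ] ∃[ τ ] α < 2 ^ a × τ < 2 ^ b × (∀ x → x < K → deleted τ x ≡ false → 0 < satisfies x α)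
      satisfiable⇒ (σ , sat) = numeral (extend σ) a , numeral (λ j → extend σ (a + j)) b , numeral<2^ _ a ,
          numeral<2^ _ b , go
        where
        τ = numeral (λ j → extend σ (a + j)) b
        go : ∀ x → x < K → deleted τ x ≡ false → 0 < satisfies x (numeral (extend σ) a)
        go x x<K e with kept-elim τ x x<K e
        ... | p , z with marked-sound x p
        ... | inj₁ refl = hub-satisfied _
        ... | inj₂ q = clauses φ φ-k sat q
          where
          clauses : ∀ ψ → IsKCNF k ψ → All (Any λ l → σ (proj₂ l) ≡ proj₁ l) ψ → Any (λ c → clauseCode c ≡ x) ψ →
            0 < satisfies x (numeral (extend σ) a)
          clauses (c ∷ ψ) (_ ∷ lens) (_ ∷ h) (there r) = clauses ψ lens h r
          clauses (c ∷ ψ) (len ∷ _) (h ∷ _) (here refl) with literals-intro (numeral-agrees σ) c h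
          ... | inj₁ r = subst (0 <_) (sym (clauseVal≡ 0 a _ c len)) r
          ... | inj₂ r = ⊥-elim (n≮0 (subst (0 <_) (trans (sym (clauseVal≡ a (a + b) τ c len)) z) r))

      ⇒satisfiable : ∀ α τ → (∀ x → x < K → deleted τ x ≡ false → 0 < satisfies x α) → Satisfiable φ
      ⇒satisfiable α τ h = decode α τ , clauses φ φ-k (λ y → marks-complete _ φ φ-k y ∘ inj₂)
        where
        clauses : ∀ ψ → IsKCNF k ψ → (∀ y → Any (λ c → clauseCode c ≡ y) ψ → 0 < marks (base N) K 0
            (update (const 0) hub 1) (encodeCNF φ) y) →
          All (Any λ l → decode α τ (proj₂ l) ≡ proj₁ l) ψ
        clauses [] [] _ = []
        clauses (c ∷ ψ) (len ∷ lens) marked = literals-elim (decode-agrees α τ) c case-τ ∷ clauses ψ lens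
            (λ y → marked y ∘ there)
          where
          x = clauseCode c
          x<K : x < K
          x<K = ≤-trans (horner-< (base N) 0 0 (codes c) (s≤s z≤n) (codes<base c))
            (^-monoʳ-≤ (base N) (≤-trans (≤-reflexive (length-map _ c)) len))
          case-τ : 0 < literalsVal P (base N) 0 a α (codes c) ⊎ 0 < literalsVal P (base N) a (a + b) τ (codes c)
          -- A clause that τ does not satisfy is marked and hence kept, so the hypothesis on α
          -- supplies a true literal of the first block.
          case-τ with clauseVal P (base N) a (a + b) τ k x in eq
          ... | suc _ = inj₂ (subst (0 <_) (clauseVal≡ a (a + b) τ c len) (subst (0 <_) (sym eq) (s≤s z≤n)))
          ... | zero  = inj₁ (subst (0 <_) (clauseVal≡ 0 a α c len)
            (h x x<K (kept τ x (subst (0 <_) (sym (M≡ x)) (marked x (here refl))) eq)))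

      deleted⊂⊤ : ∀ τ → toSubset (K + 2 ^ a) (deleted τ) ⊂ Subset.⊤
      deleted⊂⊤ τ = D⊂⊤ satisfies K (2 ^ a) (deleted τ) (deleted-clauses τ) hub hub<K (hub-kept τ) hub-satisfied

      -- The second half has to extract an assignment from a mere negation. Both searches, for α
      -- below 2^a and for a kept unsatisfied clause below K, are bounded; if the first one finds
      -- nothing, every α has such a clause and the graph is connected.
      connected⇔ : ∀ τ →
        (Connected∖ (clauseGraph satisfies K (K + 2 ^ a)) (toSubset (K + 2 ^ a) (deleted τ)) →
           ∀ α → α < 2 ^ a → ¬ (∀ x → x < K → deleted τ x ≡ false → 0 < satisfies x α)) ×
        (¬ Connected∖ (clauseGraph satisfies K (K + 2 ^ a)) (toSubset (K + 2 ^ a) (deleted τ)) → Satisfiable φ)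
      connected⇔ τ = (λ conn α p sat → satisfied⇒disconnected satisfies K (2 ^ a) (deleted τ)
          (deleted-clauses τ) hub hub<K (hub-kept τ) hub-satisfied α p sat conn) ,
        backward
        where
        Unsat : ℕ → ℕ → Set
        Unsat α x = deleted τ x ≡ false × satisfies x α ≡ 0
        unsat? : ∀ α → Dec (∃ λ x → x < K × Unsat α x)
        unsat? α = anyUpTo? (λ x → (deleted τ x Bool.≟ false) ×-dec (satisfies x α ≟ 0)) K
        backward : ¬ Connected∖ (clauseGraph satisfies K (K + 2 ^ a)) (toSubset (K + 2 ^ a) (deleted τ)) →
            Satisfiable φ
        backward ¬conn with anyUpTo? (¬? ∘ unsat?) (2 ^ a)
        ... | yes (α , _ , none) = ⇒satisfiable α τ λ x p e → n≢0⇒n>0 λ z → none (x , p , e , z)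
        ... | no all = ⊥-elim (¬conn (unsatisfied⇒connected satisfies K (2 ^ a) (deleted τ)
            (deleted-clauses τ) hub hub<K (hub-kept τ) hub-satisfied
                (λ α p → decidable-stable (unsat? α) λ n → all (α , p , n))))

-- Reasoning about programs

Runs-seq : ∀ {p q s T T′} {Q Q′ : State → Set} → Runs p s T Q →
  (∀ {s′} → Q s′ → Runs q s′ T′ Q′) → Runs (p ⨾ q) s (T + T′) Q′
Runs-seq (runs r b x) f with f x
... | runs r′ b′ x′ = runs (⇓-seq r r′) (+-mono-≤ b b′) x′

Runs-if : ∀ {e p q s G T} {Q : State → Set} → cost s e ≤ G →
  (eval s e ≢ 0 → Runs p s T Q) → (eval s e ≡ 0 → Runs q s T Q) → Runs (IF e THEN p ELSE q) s (G + T) Q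
Runs-if {e} {s = s} g f h with eval s e ≟ 0
... | yes z with h z
...   | runs r b x = runs (⇓-else z r) (+-mono-≤ g b) x
Runs-if {e} {s = s} g f h | no n with f n
...   | runs r b x = runs (⇓-then n r) (+-mono-≤ g b) x

-- The value of the guard is the number of rounds still to come, so it serves both as loop test and
-- as termination measure.
Runs-for : ∀ {e p G T} M (Inv : ℕ → State → Set) →
  (∀ i {s} → i ≤ M → Inv i s → eval s e ≡ M ∸ i × cost s e ≤ G) →
  (∀ i {s} → i < M → Inv i s → Runs p s T (Inv (suc i))) →
  ∀ {s} → Inv 0 s → Runs (WHILE e DO p) s (G + M * (G + T)) (Inv M)
Runs-for {e} {p} {G} {T} M Inv guard body = go M 0 (+-identityʳ M)
  where
  go : ∀ j i → j + i ≡ M → ∀ {s} → Inv i s → Runs (WHILE e DO p) s (G + j * (G + T)) (Inv M)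
  go zero i refl {s} inv = runs (⇓-stop (trans (proj₁ (guard i ≤-refl inv)) (n∸n≡0 i)))
    (≤-trans (proj₂ (guard i ≤-refl inv)) (m≤m+n G 0)) inv
  go (suc j) i eq {s} inv with body i i<M inv
    where
    i<M : i < M
    i<M = subst (i <_) eq (s≤s (m≤n+m i j))
  ... | runs r b inv′ with go j (suc i) (trans (+-suc j i) eq) inv′
  ... | runs r′ b′ x = runs (⇓-loop nz r r′) (+-mono-≤ (proj₂ (guard i i≤M inv))
      (≤-trans (+-mono-≤ b b′) (≤-reflexive (lem G T (j * (G + T)))))) x
    where
    i≤M : i ≤ M
    i≤M = subst (i ≤_) eq (m≤n+m i (suc j))
    nz : eval s e ≢ 0
    nz z = m>n⇒m∸n≢0 (subst (i <_) eq (s≤s (m≤n+m i j))) (trans (sym (proj₁ (guard i i≤M inv))) z)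
    lem : ∀ g t x → t + (g + x) ≡ g + t + x
    lem = solve-∀

-- The solver's own memory, next to that of the oracle

record Memory : Set where
  constructor memory
  field
    regs : List ℕ
    formula marked powers : ℕ → ℕ

open Memory

ref : Memory → State
ref m = ⟨ overwrite (regs m) (const 0) , arrays ⟩
  where
  arrays : ℕ → ℕ → ℕ
  arrays 0 = formula m
  arrays 1 = marked m
  arrays 2 = powers m
  arrays _ = const 0

-- Arrays from 3 on are left free. They hold the scratch cell and the oracle's memory, so the same
-- description remains valid while compiled code runs. Expressions that avoid them, the `Plain`
-- ones, can be evaluated in `ref m`.
record _⊨_ (s : State) (m : Memory) : Set where
  field
    regs≡  : ∀ x → vars s x ≡ vars (ref m) x
    owned≡ : ∀ a → T (a <ᵇ 3) → ∀ i → arrs s a i ≡ arrs (ref m) a i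

open _⊨_

record Bounded (W : ℕ) (m : Memory) : Set where
  field
    regs≤  : All (λ v → bits v ≤ W) (regs m)
    owned≤ : ∀ a i → T (a <ᵇ 3) → bits (arrs (ref m) a i) ≤ W

open Bounded

bounded : ∀ {W rs A M P} → All (λ v → bits v ≤ W) rs → (∀ i → bits (A i) ≤ W) → (∀ i → bits (M i) ≤ W) →
  (∀ i → bits (P i) ≤ W) → Bounded W (memory rs A M P)
bounded r a m p .regs≤ = r
bounded r a m p .owned≤ 0 i _ = a i
bounded r a m p .owned≤ 1 i _ = m i
bounded r a m p .owned≤ 2 i _ = p i

Plain : Expr → Set
Plain (lit _)     = ⊤
Plain (var _)     = ⊤
Plain (arr a e)   = T (a <ᵇ 3) × Plain e
Plain (bin _ l r) = Plain l × Plain r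

eval-plain : ∀ {s m} e → s ⊨ m → Plain e → eval s e ≡ eval (ref m) e
eval-plain (lit c) h p = refl
eval-plain (var x) h p = h .regs≡ x
eval-plain {s} {m} (arr a e) h (p , q) = trans (h .owned≡ a p (eval s e)) (cong (arrs (ref m) a) (eval-plain e h q))
eval-plain (bin o l r) h (p , q) = cong₂ ⟦ o ⟧ (eval-plain l h p) (eval-plain r h q)

overwrite-All : ∀ {Q : ℕ → Set} xs x → Q 0 → All Q xs → Q (overwrite xs (const 0) x)
overwrite-All [] x q [] = q
overwrite-All (y ∷ ys) zero q (p ∷ ps) = p
overwrite-All (y ∷ ys) (suc x) q (p ∷ ps) = overwrite-All ys x q ps

reads-plain : ∀ {s m W} e → 1 ≤ W → s ⊨ m → Bounded W m → Plain e → Reads s W e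
reads-plain (lit c) 1≤W h b p = tt
reads-plain {m = m} {W} (var x) 1≤W h b p = subst (λ v → bits v ≤ W) (sym (h .regs≡ x))
    (overwrite-All (regs m) x 1≤W (b .regs≤))
reads-plain {s} {W = W} (arr a e) 1≤W h b (p , q) = subst (λ v → bits v ≤ W) (sym (h .owned≡ a p (eval s e)))
    (b .owned≤ a _ p) , reads-plain e 1≤W h b q
reads-plain (bin o l r) 1≤W h b (p , q) = reads-plain l 1≤W h b p , reads-plain r 1≤W h b q

opaque
  plainWeight : Expr → ℕ
  plainWeight e = size e * size e

  cost-plain : ∀ {s m W} e → 1 ≤ W → s ⊨ m → Bounded W m → Plain e → cost s e ≤ plainWeight e * W
  cost-plain e 1≤W h b p = cost-bound e 1≤W (reads-plain e 1≤W h b p)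

-- On an explicit list of registers this reduces to the updated list, so the contents of registers
-- can be compared by computation.
put : List ℕ → ℕ → ℕ → List ℕ
put []       zero    v = v ∷ []
put []       (suc x) v = 0 ∷ put [] x v
put (y ∷ ys) zero    v = v ∷ ys
put (y ∷ ys) (suc x) v = y ∷ put ys x v

overwrite-put : ∀ xs x v y → overwrite (put xs x v) (const 0) y ≡ update (overwrite xs (const 0)) x v y
overwrite-put [] zero v zero = refl
overwrite-put [] zero v (suc y) = refl
overwrite-put [] (suc x) v zero = refl
overwrite-put [] (suc x) v (suc y) = overwrite-put [] x v y
overwrite-put (z ∷ xs) zero v zero = refl
overwrite-put (z ∷ xs) zero v (suc y) = refl
overwrite-put (z ∷ xs) (suc x) v zero = refl
overwrite-put (z ∷ xs) (suc x) v (suc y) = overwrite-put xs x v y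

setReg : Memory → ℕ → ℕ → Memory
setReg m x v = memory (put (regs m) x v) (formula m) (marked m) (powers m)

assign-run : ∀ {s m W v} x e → 1 ≤ W → s ⊨ m → Bounded W m → Plain e → eval (ref m) e ≡ v →
  Runs (x ≔ e) s (plainWeight e * W) (λ s′ → s′ ⊨ setReg m x v × arrs s′ ≡ arrs s)
assign-run {s} {m} x e 1≤W h b p refl = runs ⇓-assign (cost-plain e 1≤W h b p) (new , refl)
  where
  new : setVar s x (eval s e) ⊨ setReg m x (eval (ref m) e)
  new .regs≡ y = trans (cong (λ v → update (vars s) x v y) (eval-plain e h p))
    (trans (update-cong {f = vars s} {g = vars (ref m)} x (eval (ref m) e) (h .regs≡ y))
        (sym (overwrite-put (regs m) x _ y)))
  new .owned≡ 0 _ i = h .owned≡ 0 _ i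
  new .owned≡ 1 _ i = h .owned≡ 1 _ i
  new .owned≡ 2 _ i = h .owned≡ 2 _ i

Untouched : State → State → Set
Untouched s s′ = ∀ a i → arrs s′ (3 + a) i ≡ arrs s (3 + a) i

update₂-at : ∀ (f g : ℕ → ℕ → ℕ) a {i i′ v v′} j → (∀ k → f a k ≡ g a k) → i ≡ i′ → v ≡ v′ →
  update (f a) i v j ≡ update (g a) i′ v′ j
update₂-at f g a {i} {v = v} j h refl refl = update-cong {f = f a} {g = g a} i v (h j)

store-marked : ∀ {s m W i v} ie e → 1 ≤ W → s ⊨ m → Bounded W m → Plain ie → Plain e →
  eval (ref m) ie ≡ i → eval (ref m) e ≡ v →
  Runs (1 [ ie ]≔ e) s ((plainWeight ie + plainWeight e) * W)
    (λ s′ → s′ ⊨ memory (regs m) (formula m) (update (marked m) i v) (powers m) × Untouched s s′)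
store-marked {s} {m} {W} ie e 1≤W h b pi p refl refl = runs ⇓-store
  (≤-trans (+-mono-≤ (cost-plain ie 1≤W h b pi) (cost-plain e 1≤W h b p))
      (≤-reflexive (sym (*-distribʳ-+ W (plainWeight ie) _))))
  (new , λ a i → refl)
  where
  new : setCell s 1 (eval s ie) (eval s e) ⊨ memory (regs m) (formula m)
      (update (marked m) (eval (ref m) ie) (eval (ref m) e)) (powers m)
  new .regs≡ = h .regs≡
  new .owned≡ 0 _ i = h .owned≡ 0 _ i
  new .owned≡ 1 _ i = update₂-at (arrs s) (arrs (ref m)) 1 i (h .owned≡ 1 _) (eval-plain ie h pi) (eval-plain e h p)
  new .owned≡ 2 _ i = h .owned≡ 2 _ i

store-powers : ∀ {s m W i v} ie e → 1 ≤ W → s ⊨ m → Bounded W m → Plain ie → Plain e →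
  eval (ref m) ie ≡ i → eval (ref m) e ≡ v →
  Runs (2 [ ie ]≔ e) s ((plainWeight ie + plainWeight e) * W)
    (λ s′ → s′ ⊨ memory (regs m) (formula m) (marked m) (update (powers m) i v) × Untouched s s′)
store-powers {s} {m} {W} ie e 1≤W h b pi p refl refl = runs ⇓-store
  (≤-trans (+-mono-≤ (cost-plain ie 1≤W h b pi) (cost-plain e 1≤W h b p))
      (≤-reflexive (sym (*-distribʳ-+ W (plainWeight ie) _))))
  (new , λ a i → refl)
  where
  new : setCell s 2 (eval s ie) (eval s e) ⊨ memory (regs m) (formula m) (marked m)
      (update (powers m) (eval (ref m) ie) (eval (ref m) e))
  new .regs≡ = h .regs≡
  new .owned≡ 0 _ i = h .owned≡ 0 _ i
  new .owned≡ 1 _ i = h .owned≡ 1 _ i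
  new .owned≡ 2 _ i = update₂-at (arrs s) (arrs (ref m)) 2 i (h .owned≡ 2 _) (eval-plain ie h pi) (eval-plain e h p)

-- The simulated memory is z, and it was z₀ at the end of epoch 0.
record Simulating (q : ℕ) (z₀ : State) (R : ℕ → ℕ → ℕ) (z : State) : Set where
  constructor simulating
  field
    represents : Represents q R z
    restorable : 1 ≤ q → ∀ j i → R (cellA j) (2 * i + 0) ≡ mem z₀ j i

open Simulating

Simulating-cong : ∀ {q z₀ R z z′} → (∀ j i → mem z′ j i ≡ mem z j i) → Simulating q z₀ R z → Simulating q z₀ R z′
Simulating-cong e h .represents = Represents-cong e (h .represents)
Simulating-cong e h .restorable = h .restorable

frame-⊨ : ∀ {q s s′ m} → Frame q s s′ → s ⊨ m → s′ ⊨ m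
frame-⊨ f h .regs≡ x = trans (f .vars≡ x) (h .regs≡ x)
frame-⊨ f h .owned≡ a p i = trans (f .arrs≡ a (<ᵇ⇒< a 3 p) i) (h .owned≡ a p i)

frame-simulating : ∀ {q z₀ s s′ z z′} → Simulating q z₀ (arrs s) z → Simulates q s z′ s′ → Simulating q z₀
    (arrs s′) z′
frame-simulating h (r , f) .represents = r
frame-simulating h (r , f) .restorable p j i = trans (f .base≡ p j i) (h .restorable p j i)

temp-⊨ : ∀ {s m} i → s ⊨ m → setCell s 3 0 i ⊨ m
temp-⊨ i h .regs≡ = h .regs≡
temp-⊨ i h .owned≡ 0 _ = h .owned≡ 0 _
temp-⊨ i h .owned≡ 1 _ = h .owned≡ 1 _
temp-⊨ i h .owned≡ 2 _ = h .owned≡ 2 _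

write-plain : ∀ {s m W q z₀ z i v} j ie e → 1 ≤ W → s ⊨ m → Bounded W m → Plain ie → Plain e →
  vars (ref m) 4 ≡ q → eval (ref m) ie ≡ i → eval (ref m) e ≡ v → Simulating q z₀ (arrs s) z →
  Runs (write j ie e) s (writeWeight * (plainWeight ie + plainWeight e + 1) * W)
    (λ s′ → s′ ⊨ m × Simulating q z₀ (arrs s′) (setMem z j i v))
write-plain {s} {m} {W} {q} {z₀} {z} {i} {v} j ie e 1≤W h b pi p eq refl refl sim =
  Runs-weaken le (λ {s′} x → frame-⊨ (proj₂ x) h , frame-simulating sim x)
    (write-simulates {s} {z} {q} {i} {v} {W} j ie e eq4 bq (sim .represents) (eval-plain ie h pi)
        (eval-plain e (temp-⊨ i h) p))
  where
  eq4 : vars s 4 ≡ q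
  eq4 = trans (h .regs≡ 4) eq
  bq : bits q ≤ W
  bq = subst (λ v → bits v ≤ W) eq (overwrite-All (regs m) 4 1≤W (b .regs≤))
  le : writeWeight * (cost s ie + cost (setCell s 3 0 i) e + W) ≤ writeWeight *
      (plainWeight ie + plainWeight e + 1) * W
  le = begin
    writeWeight * (cost s ie + cost (setCell s 3 0 i) e + W)
      ≤⟨ *-monoʳ-≤ writeWeight (+-monoˡ-≤ W (+-mono-≤ (cost-plain ie 1≤W h b pi)
          (cost-plain e 1≤W (temp-⊨ i h) b p))) ⟩
    writeWeight * (plainWeight ie * W + plainWeight e * W + W)
      ≡⟨ lem writeWeight (plainWeight ie) (plainWeight e) W ⟩
    writeWeight * (plainWeight ie + plainWeight e + 1) * W ∎
    where
    open ≤-Reasoning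
    lem : ∀ n a b w → n * (a * w + b * w + w) ≡ n * (a + b + 1) * w
    lem = solve-∀

simulate-run : ∀ {p s m W q z₀ z z′ t} → 1 ≤ W → s ⊨ m → Bounded W m → vars (ref m) 4 ≡ q →
  p ⊢ z ⇓ z′ within t → Simulating q z₀ (arrs s) z →
  Runs ⌜ p ⌝ s (weight p * (t * W)) (λ s′ → s′ ⊨ m × Simulating q z₀ (arrs s′) z′)
simulate-run {m = m} {W} 1≤W h b refl run sim =
  Runs-weaken ≤-refl (λ {s′} x → frame-⊨ (proj₂ x) h , frame-simulating sim x)
    (simulation run (h .regs≡ 4) (overwrite-All (regs m) 4 1≤W (b .regs≤)) (sim .represents))

-- The satisfiability algorithm

NE lenE iE xE foundE : Expr
NE     = var 0
lenE   = var 1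
iE     = var 2
xE     = var 3
foundE = var 5

modE : Expr → Expr → Expr
modE x y = bin monus x (bin mul (bin div x y) y)

literalE : Expr → Expr → Expr → Expr → Expr
literalE lo hi m l =
  bin mul l (bin mul (bin monus (bin add i (lit 1)) lo)
      (bin mul (bin monus hi i) (bin monus (lit 1) (bin add (bin monus s β) (bin monus β s)))))
  where
  i s β : Expr
  i = bin div (bin monus l (lit 1)) (lit 2)
  s = modE (bin monus l (lit 1)) (lit 2)
  β = modE (bin div m (arr 2 (bin monus i lo))) (lit 2)

baseE : Expr
baseE = bin add (lit 3) (bin mul (lit 2) NE)

clauseE : Expr → Expr → Expr → ℕ → Expr → Expr
clauseE lo hi m zero    x = lit 0
clauseE lo hi m (suc k) x = bin add (literalE lo hi m (modE x baseE)) (clauseE lo hi m k (bin div x baseE))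

powerE : Expr → ℕ → Expr
powerE e zero    = lit 1
powerE e (suc k) = bin mul e (powerE e k)

eval-powerE : ∀ s e k → eval s (powerE e k) ≡ eval s e ^ k
eval-powerE s e zero    = refl
eval-powerE s e (suc k) = cong (eval s e *_) (eval-powerE s e k)

plain-powerE : ∀ e k → Plain e → Plain (powerE e k)
plain-powerE e zero    p = tt
plain-powerE e (suc k) p = p , plain-powerE e k p

eval-clauseE : ∀ s lo hi m k x → eval s (clauseE lo hi m k x) ≡
  clauseVal (arrs s 2) (eval s baseE) (eval s lo) (eval s hi) (eval s m) k (eval s x)
eval-clauseE s lo hi m zero    x = refl
eval-clauseE s lo hi m (suc k) x = cong (eval s (literalE lo hi m (modE x baseE)) +_)
    (eval-clauseE s lo hi m k (bin div x baseE))

plain-literalE : ∀ lo hi m l → Plain lo → Plain hi → Plain m → Plain l → Plain (literalE lo hi m l)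
plain-literalE lo hi m l p q r t = t , ((i , _) , p) , (q , i) , _ , (s , β) , (β , s)
  where
  i = (t , _) , _
  s = (t , _) , (((t , _) , _) , _)
  v = r , (_ , (i , p))
  β = v , ((v , _) , _)

plain-clauseE : ∀ lo hi m k x → Plain lo → Plain hi → Plain m → Plain x → Plain (clauseE lo hi m k x)
plain-clauseE lo hi m zero    x p q r t = tt
plain-clauseE lo hi m (suc k) x p q r t =
  plain-literalE lo hi m (modE x baseE) p q r (t , (t , _) , _) , plain-clauseE lo hi m k (bin div x baseE) p q r
      (t , _)

-- The oracle expects 0 or 1 in the adjacency matrix, while `edgeVal` yields arbitrary positive
-- numbers for edges.
bit-0<ᵇ≡ : ∀ x → bit (0 <ᵇ x) ≡ 1 ∸ (1 ∸ x)
bit-0<ᵇ≡ zero    = refl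
bit-0<ᵇ≡ (suc x) rewrite 0∸n≡0 x = refl

for-bound : ∀ g t W M → g * W + M * (g * W + t * W) ≤ (g + t) * (W * suc M)
for-bound g t W M = ≤-trans (m≤m+n _ (t * W)) (≤-reflexive (lem g t W M))
  where
  lem : ∀ g t W M → g * W + M * (g * W + t * W) + t * W ≡ (g + t) * (W * suc M)
  lem = solve-∀

startup-bound : ∀ c g t u W M → c * W + (g * W + M * (g * W + (t * W + u * W))) ≤ (c + (g + (t + u))) * (W * suc M)
startup-bound c g t u W M = begin
  c * W + (g * W + M * (g * W + (t * W + u * W))) ≡⟨ cong (λ z → c * W + (g * W + M * (g * W + z)))
      (*-distribʳ-+ W t u) ⟨
  c * W + (g * W + M * (g * W + (t + u) * W))     ≤⟨ +-mono-≤ (*-monoʳ-≤ c (≤-scale W (s≤s z≤n)))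
      (for-bound g (t + u) W M) ⟩
  c * (W * suc M) + (g + (t + u)) * (W * suc M)   ≡⟨ *-distribʳ-+ (W * suc M) c (g + (t + u)) ⟨
  (c + (g + (t + u))) * (W * suc M) ∎
  where open ≤-Reasoning

five-bound : ∀ a b c d e w v x y z u →
  a * (w * v) + (b * (w * x) + (c * (w * y) + (d * (z * w) + e * (w * u)))) ≤ (a + b + c + d + e) *
      (w * (v + x + y + z + u))
five-bound a b c d e w v x y z u = begin
  a * (w * v) + (b * (w * x) + (c * (w * y) + (d * (z * w) + e * (w * u))))
    ≤⟨ +-mono-≤ (*-monoʳ-≤ a (*-monoʳ-≤ w (part v v≤)))
         (+-mono-≤ (*-monoʳ-≤ b (*-monoʳ-≤ w (part x x≤)))
         (+-mono-≤ (*-monoʳ-≤ c (*-monoʳ-≤ w (part y y≤)))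
         (+-mono-≤ (*-monoʳ-≤ d (≤-trans (≤-reflexive (*-comm z w)) (*-monoʳ-≤ w (part z z≤))))
             (*-monoʳ-≤ e (*-monoʳ-≤ w (m≤n+m u (v + x + y + z))))))) ⟩
  a * (w * s) + (b * (w * s) + (c * (w * s) + (d * (w * s) + e * (w * s))))
    ≡⟨ lem a b c d e (w * s) ⟩
  (a + b + c + d + e) * (w * s) ∎
  where
  open ≤-Reasoning
  s : ℕ
  s = v + x + y + z + u
  part : ∀ m → m ≤ v + x + y + z → m ≤ s
  part m p = ≤-trans p (m≤m+n _ u)
  z≤ : z ≤ v + x + y + z
  z≤ = m≤n+m z (v + x + y)
  y≤ : y ≤ v + x + y + z
  y≤ = ≤-trans (m≤n+m y (v + x)) (m≤m+n _ z)
  x≤ : x ≤ v + x + y + z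
  x≤ = ≤-trans (≤-trans (m≤n+m x v) (m≤m+n _ y)) (m≤m+n _ z)
  v≤ : v ≤ v + x + y + z
  v≤ = ≤-trans (≤-trans (m≤m+n v x) (m≤m+n _ y)) (m≤m+n _ z)
  lem : ∀ a b c d e m → a * m + (b * m + (c * m + (d * m + e * m))) ≡ (a + b + c + d + e) * m
  lem = solve-∀

-- The first block has a variables, the second one b.
module Solver (A : Oracle) (k d Q′ pad : ℕ) where

  hE aE bE KE nE : Expr
  hE = bin div NE (lit (suc Q′))
  aE = bin mul (lit d) (bin add hE (lit pad))
  bE = bin monus NE (bin mul (lit d) hE)
  KE = powerE baseE k
  nE = bin add KE (arr 2 aE)

  edgeE : Expr → Expr → Expr
  edgeE u v = bin mul (bin monus v u) (bin mul (bin monus KE u)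
    (bin add (bin monus KE v) (bin monus (lit 1) (clauseE (lit 0) aE (bin monus v KE) k u))))

  adjacencyE : Expr
  adjacencyE = bin monus (lit 1) (bin monus (lit 1) (bin add (edgeE u v) (edgeE v u)))
    where
    u v : Expr
    u = bin div iE nE
    v = modE iE nE

  deletedE : Expr
  deletedE = bin add (bin monus (lit 1) (arr 1 iE)) (clauseE aE (bin add aE bE) (bin monus epochE (lit 1)) k iE)

  nextE : Expr
  nextE = bin add iE (lit 1)

  hubE : Expr
  hubE = bin add (bin mul (lit 1) baseE) (lit 2)

  hornerE : Expr
  hornerE = modE (bin add (bin mul xE baseE) (arr 0 iE)) KE

  -- Variables: 0 is N, 1 the length of the encoding, 2 a loop counter, 3 the
  -- clause code being read or the number of deleted vertices, 4 the epoch
  -- and 5 the answer.  Arrays: 0 is the formula, 1 marks the codes of its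
  -- clauses, 2 holds powers of two, 3 is scratch; the oracle gets the rest.
  -- In epoch τ + 1 the query is the assignment τ of the second block.
  tabulatePowers parse writeGraph loadDeleted query solver : Program
  tabulatePowers =
    2 [ lit 0 ]≔ lit 1 ⨾
    WHILE bin monus (bin add aE bE) iE DO
      (2 [ nextE ]≔ bin mul (lit 2) (arr 2 iE) ⨾ 2 ≔ nextE)
  parse =
    1 [ hubE ]≔ lit 1 ⨾
    2 ≔ lit 0 ⨾
    WHILE bin monus lenE iE DO
      ((IF arr 0 iE THEN 3 ≔ hornerE ELSE (1 [ xE ]≔ lit 1 ⨾ 3 ≔ lit 0)) ⨾ 2 ≔ nextE)
  writeGraph =
    write 0 (lit 0) nE ⨾
    write 0 (lit 1) KE ⨾
    2 ≔ lit 0 ⨾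
    WHILE bin monus (bin mul nE nE) iE DO
      (write 1 iE adjacencyE ⨾ 2 ≔ nextE)
  loadDeleted =
    2 ≔ lit 0 ⨾
    3 ≔ lit 0 ⨾
    WHILE bin monus KE iE DO
      ((IF deletedE THEN (write 2 xE iE ⨾ 3 ≔ bin add xE (lit 1)) ELSE skip) ⨾ 2 ≔ nextE) ⨾
    write 0 (lit 0) xE
  query =
    4 ≔ bin add epochE (lit 1) ⨾
    loadDeleted ⨾
    ⌜ updating A ⌝ ⨾
    IF ⌜ var 0 ⌝ᵉ THEN skip ELSE (5 ≔ lit 1)
  solver =
    tabulatePowers ⨾ parse ⨾ writeGraph ⨾ ⌜ preprocessing A ⌝ ⨾
    (WHILE bin monus (arr 2 bE) epochE DO query) ⨾
    0 ≔ foundE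

  plain-KE : Plain KE
  plain-KE = plain-powerE baseE k _

  plain-nE : Plain nE
  plain-nE = plain-KE , _

  plain-edgeE : ∀ u v → Plain u → Plain v → Plain (edgeE u v)
  plain-edgeE u v p q = (q , p) , (plain-KE , p) , (plain-KE , q) , _ , plain-clauseE _ _ _ k u _ _ (q , plain-KE) p

  plain-adjacencyE : Plain adjacencyE
  plain-adjacencyE = _ , _ , plain-edgeE _ _ u v , plain-edgeE _ _ v u
    where
    u = _ , plain-nE
    v = _ , ((_ , plain-nE) , plain-nE)

  plain-deletedE : Plain deletedE
  plain-deletedE = _ , plain-clauseE _ _ _ k _ _ _ _ _

  eval-edgeE : ∀ s u v → eval s (edgeE u v) ≡
    edgeVal (λ x α → clauseVal (arrs s 2) (eval s baseE) 0 (eval s aE) α k x) (eval s KE) (eval s u) (eval s v)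
  eval-edgeE s u v = cong (λ z → (eval s v ∸ eval s u) *
      ((eval s KE ∸ eval s u) * ((eval s KE ∸ eval s v) + (1 ∸ z))))
    (eval-clauseE s (lit 0) aE (bin monus v KE) k u)

  -- This weight and the following ones involve only the parameters of the module and not the
  -- formula, so they are constants in the running time.
  powersWeight : ℕ
  powersWeight = plainWeight (lit 0) + plainWeight (lit 1) + (plainWeight (bin monus (bin add aE bE) iE) +
    ((plainWeight nextE + plainWeight (bin mul (lit 2) (arr 2 iE))) + plainWeight nextE))

  parseWeight : ℕ
  parseWeight = (plainWeight hubE + plainWeight (lit 1)) + plainWeight (lit 0) +
    (plainWeight (bin monus lenE iE) + ((plainWeight (arr 0 iE) +
        (plainWeight hornerE + (plainWeight xE + plainWeight (lit 1) + plainWeight (lit 0)))) + plainWeight nextE))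

  graphWeight : ℕ
  graphWeight = (writeWeight * (plainWeight (lit 0) + plainWeight nE + 1) + writeWeight *
      (plainWeight (lit 1) + plainWeight KE + 1) + plainWeight (lit 0)) +
    (plainWeight (bin monus (bin mul nE nE) iE) + (writeWeight *
        (plainWeight iE + plainWeight adjacencyE + 1) + plainWeight nextE))

  loadWeight : ℕ
  loadWeight = ((plainWeight (lit 0) + plainWeight (lit 0)) +
    (plainWeight (bin monus KE iE) + ((plainWeight deletedE +
        (writeWeight * (plainWeight xE + plainWeight iE + 1) + plainWeight
        (bin add xE (lit 1)) + 1)) + plainWeight nextE))) +
    writeWeight * (plainWeight (lit 0) + plainWeight xE + 1)

  queryWeight : ℕ
  queryWeight = (plainWeight (bin add epochE (lit 1)) + loadWeight) +
      ((weight (updating A) + weightᵉ (var 0)) + plainWeight (lit 1) + 1)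

  solverWeight : ℕ
  solverWeight = powersWeight + parseWeight + graphWeight + weight (preprocessing A) +
    (plainWeight (bin monus (arr 2 bE) epochE) + queryWeight + plainWeight foundE)

  -- The run of the solver on one formula

  module Instance (2≤k : 2 ≤ k) (1≤d : 1 ≤ d) (1≤pad : 1 ≤ pad) {N : ℕ} (φ : CNF N) (φ-k : IsKCNF k φ) where

    h a b K n len top W : ℕ
    h   = N / suc Q′
    a   = d * (h + pad)
    b   = N ∸ d * h
    K   = base N ^ k
    n   = K + 2 ^ a
    len = length (encodeCNF φ)
    -- An upper bound for every number in the solver's own variables and arrays: loop counters,
    -- clause and literal codes, epochs, powers of two.
    top = n * n + (len + 2 ^ (a + b))
    W   = bits top

    words : ℕ → ℕ
    words = overwrite (encodeCNF φ) (const 0)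

    1≤W : 1 ≤ W
    1≤W = s≤s z≤n

    small : ∀ {v} → v ≤ top → bits v ≤ W
    small = bits-mono

    1≤n : 1 ≤ n
    1≤n = ≤-trans (m^n>0 2 a) (m≤n+m (2 ^ a) K)

    n²≤top : n * n ≤ top
    n²≤top = m≤m+n (n * n) _

    n≤top : n ≤ top
    n≤top = ≤-trans (≤-scale n 1≤n) n²≤top

    K≤top : K ≤ top
    K≤top = ≤-trans (m≤m+n K (2 ^ a)) n≤top

    base≤K : base N ≤ K
    base≤K = ≤-trans (≤-reflexive (sym (^-identityʳ (base N)))) (^-monoʳ-≤ (base N) (≤-trans (s≤s z≤n) 2≤k))

    N≤top : N ≤ top
    N≤top = ≤-trans (≤-trans (m≤m+n N (N + 0)) (m≤n+m (2 * N) 3)) (≤-trans base≤K K≤top)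

    1≤top : 1 ≤ top
    1≤top = ≤-trans 1≤n n≤top

    len≤top : len ≤ top
    len≤top = ≤-trans (m≤m+n len _) (m≤n+m _ (n * n))

    2^≤top : ∀ {j} → j ≤ a + b → 2 ^ j ≤ top
    2^≤top p = ≤-trans (^-monoʳ-≤ 2 p) (≤-trans (m≤n+m _ len) (m≤n+m _ (n * n)))

    a+b≤top : a + b ≤ top
    a+b≤top = ≤-trans (<⇒≤ (n<2^n (a + b))) (2^≤top ≤-refl)

    N≤a+b : N ≤ a + b
    N≤a+b = ≤-trans (m≤n+m∸n N (d * h)) (+-monoˡ-≤ b (*-monoʳ-≤ d (m≤m+n h pad)))

    1≤a : 1 ≤ a
    1≤a = *-mono-≤ 1≤d (≤-trans 1≤pad (m≤n+m pad h))

    encode-small : ∀ {k} (ψ : CNF N) → IsKCNF k ψ → All (λ v → bits v ≤ W) (encodeCNF ψ)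
    encode-small [] [] = []
    encode-small (c ∷ ψ) (_ ∷ p) = ++⁺ (++⁺ (All.map (λ q → small (≤-trans (<⇒≤ q) (≤-trans base≤K K≤top)))
        (codes<base c)) (small z≤n ∷ [])) (encode-small ψ p)

    words-small : ∀ i → bits (words i) ≤ W
    words-small i = overwrite-All (encodeCNF φ) i (small z≤n) (encode-small φ φ-k)

    at : ℕ → ℕ → ℕ → ℕ → (ℕ → ℕ) → (ℕ → ℕ) → Memory
    at i x q f M P = memory (N ∷ len ∷ i ∷ x ∷ q ∷ f ∷ []) words M P

    at-bounded : ∀ {i x q f M P} → i ≤ top → x ≤ top → q ≤ top → f ≤ top → (∀ y → bits (M y) ≤ W) →
        (∀ y → bits (P y) ≤ W) →
      Bounded W (at i x q f M P)
    at-bounded i x q f = bounded (small N≤top ∷ small len≤top ∷ small i ∷ small x ∷ small q ∷ small f ∷ []) words-small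

    Blank : State → Set
    Blank s = ∀ c i → arrs s (3 + c) i ≡ 0

    input⊨ : inputCNF φ ⊨ at 0 0 0 0 (const 0) (const 0)
    input⊨ .regs≡ 0 = refl
    input⊨ .regs≡ 1 = refl
    input⊨ .regs≡ 2 = refl
    input⊨ .regs≡ 3 = refl
    input⊨ .regs≡ 4 = refl
    input⊨ .regs≡ 5 = refl
    input⊨ .regs≡ (suc (suc (suc (suc (suc (suc x)))))) = refl
    input⊨ .owned≡ 0 _ i = refl
    input⊨ .owned≡ 1 _ i = refl
    input⊨ .owned≡ 2 _ i = refl

    Powers : (ℕ → ℕ) → Set
    Powers P = (∀ j → j ≤ a + b → P j ≡ 2 ^ j) × (∀ j → bits (P j) ≤ W)

    tabulatePowers-run : Runs tabulatePowers (inputCNF φ) (powersWeight * (W * suc (a + b)))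
      (λ s → ∃[ P ] s ⊨ at (a + b) 0 0 0 (const 0) P × Powers P × Blank s)
    tabulatePowers-run = Runs-weaken le (λ { (P , m , eqs , sm , bl) → P , m , (eqs , sm) , bl })
      (Runs-seq (store-powers (lit 0) (lit 1) 1≤W input⊨
          (at-bounded z≤n z≤n z≤n z≤n (λ _ → small z≤n) (λ _ → small z≤n)) _ _ refl refl)
        λ { (m , unt) → Runs-for (a + b) Inv guard body
            (update (const 0) 0 1 , m , init , init-small , λ c i → unt c i) })
      where
      Inv : ℕ → State → Set
      Inv i s = ∃[ P ] s ⊨ at i 0 0 0 (const 0) P × (∀ j → j ≤ i → P j ≡ 2 ^ j) × (∀ j → bits (P j) ≤ W) × Blank s
      init : ∀ j → j ≤ 0 → update (const 0) 0 1 j ≡ 2 ^ j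
      init zero z≤n = refl
      init-small : ∀ j → bits (update (const 0) 0 1 j) ≤ W
      init-small zero    = small 1≤top
      init-small (suc j) = small z≤n
      bnd : ∀ {i P} → i ≤ a + b → (∀ j → bits (P j) ≤ W) → Bounded W (at i 0 0 0 (const 0) P)
      bnd p sm = at-bounded (≤-trans p a+b≤top) z≤n z≤n z≤n (λ _ → small z≤n) sm
      guard : ∀ i {s} → i ≤ a + b → Inv i s → eval s (bin monus (bin add aE bE) iE) ≡ (a + b) ∸ i × cost s
          (bin monus (bin add aE bE) iE) ≤ plainWeight (bin monus (bin add aE bE) iE) * W
      guard i p (P , m , _ , sm , _) = eval-plain (bin monus (bin add aE bE) iE) m _ , cost-plain
          (bin monus (bin add aE bE) iE) 1≤W m (bnd p sm) _
      body : ∀ i {s} → i < a + b → Inv i s → Runs (2 [ nextE ]≔ bin mul (lit 2) (arr 2 iE) ⨾ 2 ≔ nextE) s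
        ((plainWeight nextE + plainWeight (bin mul (lit 2) (arr 2 iE))) * W + plainWeight nextE * W) (Inv (suc i))
      body i i<M (P , m , eqs , sm , bl) =
        Runs-seq (store-powers nextE (bin mul (lit 2) (arr 2 iE)) 1≤W m (bnd (<⇒≤ i<M) sm) _ _ (+-comm i 1)
            (cong (2 *_) (eqs i ≤-refl)))
          λ { (m′ , unt) → Runs-weaken ≤-refl
                (λ { (m″ , refl) → update P (suc i) (2 ^ suc i) , m″ , new , new-small , λ c j → trans (unt c j)
                    (bl c j) })
                (assign-run 2 nextE 1≤W m′ (bnd (<⇒≤ i<M) new-small) _ (+-comm i 1)) }
        where
        new : ∀ j → j ≤ suc i → update P (suc i) (2 ^ suc i) j ≡ 2 ^ j
        new j p with suc i ≟ j
        ... | yes refl = update-same P (suc i) _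
        ... | no ne = trans (update-other P _ ne) (eqs j (≤-pred (≤∧≢⇒< p (ne ∘ sym))))
        new-small : ∀ j → bits (update P (suc i) (2 ^ suc i) j) ≤ W
        new-small j with suc i ≟ j
        ... | yes refl = subst (λ v → bits v ≤ W) (sym (update-same P (suc i) _)) (small (2^≤top i<M))
        ... | no ne = subst (λ v → bits v ≤ W) (sym (update-other P _ ne)) (sm j)
      g t₁ t₂ : ℕ
      g  = plainWeight (bin monus (bin add aE bE) iE)
      t₁ = plainWeight nextE + plainWeight (bin mul (lit 2) (arr 2 iE))
      t₂ = plainWeight nextE
      le : (plainWeight (lit 0) + plainWeight (lit 1)) * W +
          (g * W + (a + b) * (g * W + (t₁ * W + t₂ * W))) ≤ powersWeight * (W * suc (a + b))
      le = startup-bound (plainWeight (lit 0) + plainWeight (lit 1)) g t₁ t₂ W (a + b)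

    hub : ℕ
    hub = 1 * base N + 2

    marksOf : ℕ → ℕ
    marksOf = marks (base N) K 0 (update (const 0) hub 1) (encodeCNF φ)

    0<K : 0 < K
    0<K = ≤-trans (s≤s z≤n) base≤K

    module Parse (P : ℕ → ℕ) (P-ok : Powers P) where

      Parsing : (i x : ℕ) (M : ℕ → ℕ) → State → Set
      Parsing i x M s = s ⊨ at i x 0 0 M P × x ≤ top × (∀ y → M y ≤ 1) × Blank s

      -- The unread words `ws`, processed from the current partial code and marks, would give the
      -- final table. Stated this way, the invariant need not locate the end of any clause.
      Inv : ℕ → State → Set
      Inv i s = ∃[ x ] ∃[ M ] ∃[ ws ] Parsing i x M s × (∀ j → words (i + j) ≡ overwrite ws (const 0) j) ×
        marks (base N) K x M ws ≡ marksOf × i + length ws ≡ len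

      parsing-bounded : ∀ {i x M s} → i ≤ len → Parsing i x M s → Bounded W (at i x 0 0 M P)
      parsing-bounded p (_ , x≤ , M≤ , _) = at-bounded (≤-trans p len≤top) x≤ z≤n z≤n
          (λ y → small (≤-trans (M≤ y) 1≤top)) (proj₂ P-ok)

      update≤1 : ∀ M x → (∀ y → M y ≤ 1) → ∀ y → update M x 1 y ≤ 1
      update≤1 M x M≤ y with x ≟ y
      ... | yes refl = ≤-reflexive (update-same M x 1)
      ... | no ne = ≤-trans (≤-reflexive (update-other M 1 ne)) (M≤ y)

      g₀ g₁ g₂ g₃ : ℕ
      g₀ = plainWeight (bin monus lenE iE)
      g₁ = plainWeight (arr 0 iE)
      g₂ = plainWeight hornerE + (plainWeight xE + plainWeight (lit 1) + plainWeight (lit 0))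
      g₃ = plainWeight nextE

      eval-hornerE : ∀ {i x M} → eval (ref (at i x 0 0 M P)) hornerE ≡ mod (x * base N + words i) K
      eval-hornerE {i} {x} {M} = cong (mod (x * base N + words i)) (eval-powerE (ref (at i x 0 0 M P)) baseE k)

      step : ∀ {i x M s w ws} → i < len → Parsing i x M s → words i ≡ w → marks (base N) K x M (w ∷ ws) ≡ marksOf →
        Runs (IF arr 0 iE THEN 3 ≔ hornerE ELSE (1 [ xE ]≔ lit 1 ⨾ 3 ≔ lit 0)) s (g₁ * W + g₂ * W)
          (λ s′ → ∃[ x′ ] ∃[ M′ ] Parsing i x′ M′ s′ × marks (base N) K x′ M′ ws ≡ marksOf)
      step {i} {x} {M} {s} {w} {ws} p h@(m , x≤ , M≤ , bl) eq fin =
        Runs-if (cost-plain (arr 0 iE) 1≤W m bnd _)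
          (λ nz → letter w (trans (sym word) eq) nz fin)
          (λ z → separator w (trans (sym word) eq) z fin)
        where
        bnd : Bounded W (at i x 0 0 M P)
        bnd = parsing-bounded (<⇒≤ p) h
        word : words i ≡ eval s (arr 0 iE)
        word = sym (eval-plain (arr 0 iE) m _)
        Goal : List ℕ → State → Set
        Goal ws s′ = ∃[ x′ ] ∃[ M′ ] Parsing i x′ M′ s′ × marks (base N) K x′ M′ ws ≡ marksOf
        letter : ∀ w → eval s (arr 0 iE) ≡ w → eval s (arr 0 iE) ≢ 0 → marks (base N) K x M (w ∷ ws) ≡ marksOf →
          Runs (3 ≔ hornerE) s (g₂ * W) (Goal ws)
        letter zero e nz fin = ⊥-elim (nz e)
        letter (suc w) e nz fin = Runs-weaken (*-monoˡ-≤ W (m≤m+n (plainWeight hornerE) _))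
          (λ { (m′ , refl) → mod (x * base N + suc w) K , M ,
              (m′ , ≤-trans (<⇒≤ (mod<y (x * base N + suc w) 0<K)) K≤top , M≤ , bl) , fin })
          (assign-run 3 hornerE 1≤W m bnd (_ , (_ , plain-KE) , plain-KE)
            (trans (eval-hornerE {i} {x} {M}) (cong (λ z → mod (x * base N + z) K) (trans word e))))
        separator : ∀ w → eval s (arr 0 iE) ≡ w → eval s (arr 0 iE) ≡ 0 → marks (base N) K x M (w ∷ ws) ≡ marksOf →
          Runs (1 [ xE ]≔ lit 1 ⨾ 3 ≔ lit 0) s (g₂ * W) (Goal ws)
        separator (suc w) e z fin with trans (sym e) z
        ... | ()
        separator zero e z fin = Runs-weaken
          (≤-trans (≤-reflexive (sym (*-distribʳ-+ W (plainWeight xE + plainWeight (lit 1)) (plainWeight (lit 0)))))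
              (*-monoˡ-≤ W (m≤n+m _ (plainWeight hornerE))))
          (λ p → p)
          (Runs-seq (store-marked xE (lit 1) 1≤W m bnd _ _ refl refl) λ { (m′ , unt) →
            Runs-weaken ≤-refl (λ { (m″ , refl) → 0 , update M x 1 ,
                (m″ , z≤n , update≤1 M x M≤ , λ c j → trans (unt c j) (bl c j)) , fin })
              (assign-run 3 (lit 0) 1≤W m′ (at-bounded (≤-trans (<⇒≤ p) len≤top) x≤ z≤n z≤n
                  (λ y → small (≤-trans (update≤1 M x M≤ y) 1≤top)) (proj₂ P-ok)) _ refl) })

      body : ∀ i {s} → i < len → Inv i s →
        Runs ((IF arr 0 iE THEN 3 ≔ hornerE ELSE (1 [ xE ]≔ lit 1 ⨾ 3 ≔ lit 0)) ⨾ 2 ≔ nextE) s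
            ((g₁ * W + g₂ * W) + g₃ * W) (Inv (suc i))
      body i p (x , M , [] , h , ws≡ , fin , l) = ⊥-elim (<⇒≢ p (trans (sym (+-identityʳ i)) l))
      body i p (x , M , w ∷ ws , h , ws≡ , fin , l) =
        Runs-seq (step p h (trans (cong words (sym (+-identityʳ i))) (ws≡ 0)) fin)
            λ { (x′ , M′ , h′@(m′ , x≤ , M≤ , bl) , fin′) →
          Runs-weaken ≤-refl (λ { (m″ , refl) → x′ , M′ , ws , (m″ , x≤ , M≤ , bl) ,
              (λ j → trans (cong words (sym (+-suc i j))) (ws≡ (suc j))) , fin′ , trans
                  (sym (+-suc i (length ws))) l })
            (assign-run 2 nextE 1≤W m′ (parsing-bounded (<⇒≤ p) h′) _ (+-comm i 1)) }

      parse-run : ∀ {s} → s ⊨ at (a + b) 0 0 0 (const 0) P → Blank s → Runs parse s (parseWeight * (W * suc len))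
        (λ s′ → ∃[ x ] ∃[ M ] s′ ⊨ at len x 0 0 M P × x ≤ top × (∀ y → M y ≡ marksOf y) × (∀ y → bits (M y) ≤ W) ×
            Blank s′)
      parse-run {s} m bl = Runs-weaken le finish
        (Runs-seq (store-marked hubE (lit 1) 1≤W m (at-bounded a+b≤top z≤n z≤n z≤n (λ _ → small z≤n)
            (proj₂ P-ok)) _ _ refl refl) λ { (m₁ , unt) →
          Runs-seq (assign-run 2 (lit 0) 1≤W m₁ (at-bounded a+b≤top z≤n z≤n z≤n
              (λ y → small (≤-trans (update≤1 (const 0) hub (λ _ → z≤n) y) 1≤top)) (proj₂ P-ok)) _ refl)
            λ { (m₂ , refl) → Runs-for len Inv
                  (λ { i p (x , M , ws , h@(m , _) , _) → eval-plain (bin monus lenE iE) m _ , cost-plain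
                      (bin monus lenE iE) 1≤W m (parsing-bounded p h) _ })
                  body
                  (0 , update (const 0) hub 1 , encodeCNF φ ,
                      (m₂ , z≤n , update≤1 (const 0) hub (λ _ → z≤n) , λ c j → trans (unt c j) (bl c j)) ,
                    (λ j → refl) , refl , refl) } })
        where
        finish : ∀ {s′} → Inv len s′ → ∃[ x ] ∃[ M ] s′ ⊨ at len x 0 0 M P × x ≤ top × (∀ y → M y ≡ marksOf y) ×
            (∀ y → bits (M y) ≤ W) × Blank s′
        finish (x , M , [] , (m , x≤ , M≤ , bl) , _ , fin , _) = x , M , m , x≤ , (λ y → cong (λ f → f y) fin) ,
            (λ y → small (≤-trans (M≤ y) 1≤top)) , bl
        finish (x , M , w ∷ ws , _ , _ , _ , l) = ⊥-elim (m+1+n≢m len l)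
        c₀ c₁ : ℕ
        c₀ = plainWeight hubE + plainWeight (lit 1)
        c₁ = plainWeight (lit 0)
        le : c₀ * W + (c₁ * W + (g₀ * W + len * (g₀ * W + ((g₁ * W + g₂ * W) + g₃ * W)))) ≤ parseWeight *
            (W * suc len)
        le = begin
          c₀ * W + (c₁ * W + (g₀ * W + len * (g₀ * W + ((g₁ * W + g₂ * W) + g₃ * W))))
            ≡⟨ +-assoc (c₀ * W) (c₁ * W) _ ⟨
          (c₀ * W + c₁ * W) + (g₀ * W + len * (g₀ * W + ((g₁ * W + g₂ * W) + g₃ * W)))
            ≡⟨ cong₂ (λ y z → y + (g₀ * W + len * (g₀ * W + (z + g₃ * W)))) (sym (*-distribʳ-+ W c₀ c₁))
                (sym (*-distribʳ-+ W g₁ g₂)) ⟩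
          (c₀ + c₁) * W + (g₀ * W + len * (g₀ * W + ((g₁ + g₂) * W + g₃ * W)))
            ≤⟨ startup-bound (c₀ + c₁) g₀ (g₁ + g₂) g₃ W len ⟩
          parseWeight * (W * suc len) ∎
          where open ≤-Reasoning

    -- The failure bound handed to the oracle is K: only clauses are ever deleted, and there are K
    -- clause codes.
    record Fits (V U : ℕ) : Set where
      field
        timely : ∀ (G : Graph n) s t → preprocessing A ⊢ inputGraph G K ⇓ s within t →
          t ≤ V × (∀ (D : Subset n) → D ⊂ Subset.⊤ → ∣ D ∣ ≤ K → ∀ s′ t′ →
              updating A ⊢ loadQuery D s ⇓ s′ within t′ → t′ ≤ U)

    open Fits

    module Queries (P : ℕ → ℕ) (P-ok : Powers P) (M : ℕ → ℕ) (M≡ : ∀ y → M y ≡ marksOf y)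
        (M-small : ∀ y → bits (M y) ≤ W) where

      open Deletion P (proj₁ P-ok) N≤a+b φ φ-k 2≤k 1≤a M using
          (deleted; satisfies; deleted-clauses; satisfiable⇒; connected⇔; deleted⊂⊤)

      G : Graph n
      G = clauseGraph satisfies K n

      eval-nE : ∀ {i x q f} → eval (ref (at i x q f M P)) nE ≡ n
      eval-nE {i} {x} {q} {f} = cong₂ _+_ (eval-powerE (ref (at i x q f M P)) baseE k) (proj₁ P-ok a (m≤m+n a b))

      instance
        n-nonZero : NonZero n
        n-nonZero = >-nonZero 1≤n

      word : ℕ → ℕ
      word j = bit (joined satisfies K (j / n) (j % n))

      eval-adjacencyE : ∀ {i x q f} → eval (ref (at i x q f M P)) adjacencyE ≡ word i
      eval-adjacencyE {i} {x} {q} {f} = trans (cong (λ z → 1 ∸ (1 ∸ z)) (cong₂ _+_ (edge u v) (edge v u)))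
        (trans (sym (bit-0<ᵇ≡ (edgeVal satisfies K (eval s u) (eval s v) + edgeVal satisfies K (eval s v)
            (eval s u)))) (cong bit (cong₂ (joined satisfies K) u≡ v≡)))
        where
        s = ref (at i x q f M P)
        u v : Expr
        u = bin div iE nE
        v = modE iE nE
        edge : ∀ u v → eval s (edgeE u v) ≡ edgeVal satisfies K (eval s u) (eval s v)
        edge u v = trans (eval-edgeE s u v) (cong (λ z → edgeVal satisfies z (eval s u) (eval s v))
            (eval-powerE s baseE k))
        u≡ : eval s u ≡ i / n
        u≡ = trans (cong (⟦ div ⟧ i) (eval-nE {i} {x} {q} {f})) (div≡/ i n)
        v≡ : eval s v ≡ i % n
        v≡ = trans (cong (mod i) (eval-nE {i} {x} {q} {f})) (mod≡% i n)

      record GraphPrefix (i : ℕ) (z : State) : Set where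
        field
          header : ∀ x → vars z x ≡ overwrite (n ∷ K ∷ []) (const 0) x
          prefix : ∀ j → j < i → arrs z 0 j ≡ word j
          blank  : ∀ j → i ≤ j → arrs z 0 j ≡ 0
          other  : ∀ c j → arrs z (suc c) j ≡ 0

      open GraphPrefix

      extend-prefix : ∀ {i z} → GraphPrefix i z → GraphPrefix (suc i) (setMem z 1 i (word i))
      extend-prefix h .header = h .header
      extend-prefix {i} {z} h .prefix j p with i ≟ j
      ... | yes refl = update-same (arrs z 0) i (word i)
      ... | no ne = trans (update-other (arrs z 0) (word i) ne) (h .prefix j (≤∧≢⇒< (≤-pred p) (ne ∘ sym)))
      extend-prefix {i} {z} h .blank j p = trans (update-other (arrs z 0) (word i) (<⇒≢ p))
          (h .blank j (≤-trans (n≤1+n i) p))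
      extend-prefix h .other = h .other

      whole-graph : ∀ {z} → GraphPrefix (n * n) z → ∀ j i → mem (inputGraph G K) j i ≡ mem z j i
      whole-graph h zero i = sym (h .header i)
      whole-graph h (suc (suc c)) i = sym (h .other c i)
      whole-graph h (suc zero) i with i <? n * n
      ... | yes p = trans (encodeGraph-lookup G (joined satisfies K) (λ _ _ → refl) i p) (sym (h .prefix i p))
      ... | no ¬p = trans (encodeGraph-beyond G (joined satisfies K) (λ _ _ → refl) i (≮⇒≥ ¬p))
          (sym (h .blank i (≮⇒≥ ¬p)))

      empty : State
      empty = ⟨ const 0 , const (const 0) ⟩

      -- Untouched arrays already are a valid versioned memory in epoch 0, so setting it up takes no
      -- time.
      blank-simulating : ∀ {s} → Blank s → Simulating 0 empty (arrs s) empty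
      blank-simulating bl .represents .cells zero i    = sym (bl _ _)
      blank-simulating bl .represents .cells (suc j) i = sym (bl _ _)
      blank-simulating bl .represents .stamps j i = ≤-reflexive (bl _ _)
      blank-simulating bl .restorable ()

      query-bounded : ∀ {i x q f} → i ≤ top → x ≤ top → q ≤ top → f ≤ top → Bounded W (at i x q f M P)
      query-bounded i x q f = at-bounded i x q f M-small (proj₂ P-ok)

      writeGraph-run : ∀ {s x} → s ⊨ at len x 0 0 M P → x ≤ top → Blank s → Runs writeGraph s
          (graphWeight * (W * suc (n * n)))
        (λ s′ → s′ ⊨ at (n * n) x 0 0 M P × Represents 0 (arrs s′) (inputGraph G K))
      writeGraph-run {s} {x} m x≤ bl = Runs-weaken le finish
        (Runs-seq (write-plain 0 (lit 0) nE 1≤W m (query-bounded len≤top x≤ z≤n z≤n) _ plain-nE refl refl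
            (eval-nE {len} {x} {0} {0}) (blank-simulating {s} bl)) λ { (m₁ , sim₁) →
          Runs-seq (write-plain 0 (lit 1) KE 1≤W m₁ (query-bounded len≤top x≤ z≤n z≤n) _ plain-KE refl refl
              (eval-powerE (ref (at len x 0 0 M P)) baseE k) sim₁) λ { (m₂ , sim₂) →
          Runs-seq (assign-run 2 (lit 0) 1≤W m₂ (query-bounded len≤top x≤ z≤n z≤n) _ refl) λ { (m₃ , e) →
          Runs-for (n * n) Inv guard body (m₃ , _ , subst (λ R → Simulating 0 empty R _) (sym e) sim₂ , start) } } })
        where
        Inv : ℕ → State → Set
        Inv i s = s ⊨ at i x 0 0 M P × (∃[ z ] Simulating 0 empty (arrs s) z × GraphPrefix i z)
        start : GraphPrefix 0 (setMem (setMem empty 0 0 n) 0 1 K)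
        start .header 0 = refl
        start .header 1 = refl
        start .header (suc (suc x)) = refl
        start .prefix j ()
        start .blank j _ = refl
        start .other c j = refl
        guardE : Expr
        guardE = bin monus (bin mul nE nE) iE
        g t₁ t₂ c₀ c₁ c₂ : ℕ
        g  = plainWeight guardE
        t₁ = writeWeight * (plainWeight iE + plainWeight adjacencyE + 1)
        t₂ = plainWeight nextE
        c₀ = writeWeight * (plainWeight (lit 0) + plainWeight nE + 1)
        c₁ = writeWeight * (plainWeight (lit 1) + plainWeight KE + 1)
        c₂ = plainWeight (lit 0)
        guard : ∀ i {s} → i ≤ n * n → Inv i s → eval s guardE ≡ n * n ∸ i × cost s guardE ≤ g * W
        guard i p (m , _) =
          trans (eval-plain guardE m ((plain-nE , plain-nE) , _)) (cong (λ z → z * z ∸ i) (eval-nE {i} {x} {0} {0})) ,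
          cost-plain guardE 1≤W m (query-bounded (≤-trans p n²≤top) x≤ z≤n z≤n) ((plain-nE , plain-nE) , _)
        body : ∀ i {s} → i < n * n → Inv i s → Runs (write 1 iE adjacencyE ⨾ 2 ≔ nextE) s (t₁ * W + t₂ * W)
            (Inv (suc i))
        body i p (m , z , sim , pre) =
          Runs-seq (write-plain 1 iE adjacencyE 1≤W m bnd _ plain-adjacencyE refl refl
              (eval-adjacencyE {i} {x} {0} {0}) sim) λ { (m′ , sim′) →
          Runs-weaken ≤-refl (λ { (m″ , e) → m″ , _ , subst (λ R → Simulating 0 empty R _) (sym e) sim′ ,
              extend-prefix pre })
            (assign-run 2 nextE 1≤W m′ bnd _ (+-comm i 1)) }
          where
          bnd : Bounded W (at i x 0 0 M P)
          bnd = query-bounded (≤-trans (<⇒≤ p) n²≤top) x≤ z≤n z≤n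
        finish : ∀ {s′} → Inv (n * n) s′ → s′ ⊨ at (n * n) x 0 0 M P × Represents 0 (arrs s′) (inputGraph G K)
        finish (m , z , sim , pre) = m , Represents-cong (whole-graph pre) (sim .represents)
        le : c₀ * W + (c₁ * W + (c₂ * W + (g * W + n * n * (g * W + (t₁ * W + t₂ * W))))) ≤ graphWeight *
            (W * suc (n * n))
        le = begin
          c₀ * W + (c₁ * W + (c₂ * W + (g * W + n * n * (g * W + (t₁ * W + t₂ * W)))))
            ≡⟨ lem c₀ c₁ c₂ W _ ⟩
          (c₀ + c₁ + c₂) * W + (g * W + n * n * (g * W + (t₁ * W + t₂ * W)))
            ≤⟨ startup-bound (c₀ + c₁ + c₂) g t₁ t₂ W (n * n) ⟩
          graphWeight * (W * suc (n * n)) ∎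
          where
          open ≤-Reasoning
          lem : ∀ a b c w x → a * w + (b * w + (c * w + x)) ≡ (a + b + c) * w + x
          lem = solve-∀

      -- What one query hands to the next: the base copies hold the memory `z₀` left by
      -- preprocessing, whatever the overlay copies contain.
      Stored : ℕ → State → (ℕ → ℕ → ℕ) → Set
      Stored q z₀ R = (∀ j i → R (cellA j) (2 * i + 0) ≡ mem z₀ j i) × (∀ j i → R (stampA j) i ≤ q)

      stored₀ : ∀ {R z₀} → Represents 0 R z₀ → Stored 0 z₀ R
      stored₀ {R} h .proj₁ j i = trans (cong (λ v → R (cellA j) (2 * i + v)) (sym (n≤0⇒n≡0 (h .stamps j i))))
          (sym (h .cells j i))
      stored₀ h .proj₂ = h .stamps

      -- This is the rollback. No stamp exceeds q, so in epoch q + 1 none is current and each cell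
      -- falls back to its base copy.
      new-epoch : ∀ {q R z₀} → Stored q z₀ R → Simulating (suc q) z₀ R z₀
      new-epoch {q} {R} (base≡ , stamps≤) .represents .cells j i =
        trans (sym (base≡ j i)) (cong (λ v → R (cellA j) (2 * i + v)) (sym (m≤n⇒m∸n≡0 (stamps≤ j i))))
      new-epoch (base≡ , stamps≤) .represents .stamps j i = m≤n⇒m≤1+n (stamps≤ j i)
      new-epoch (base≡ , stamps≤) .restorable _ = base≡

      end-epoch : ∀ {q R z₀ z} → Simulating (suc q) z₀ R z → Stored (suc q) z₀ R
      end-epoch h = h .restorable (s≤s z≤n) , h .represents .stamps

      deletedSet : ℕ → Subset n
      deletedSet τ = toSubset n (deleted τ)

      selected-all : ∀ τ → selected (deleted τ) n ≡ selected (deleted τ) K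
      selected-all τ = selected-+ (deleted τ) K (2 ^ a) (deleted-clauses τ)

      ∣deletedSet∣ : ∀ τ → ∣ deletedSet τ ∣ ≡ length (selected (deleted τ) K)
      ∣deletedSet∣ τ = trans (∣toSubset∣ n (deleted τ)) (cong length (selected-all τ))

      module Load (z₀ : State) (τ : ℕ) (τ< : τ < 2 ^ b) (f : ℕ) (f≤ : f ≤ top) where

        δ : ℕ → Bool
        δ = deleted τ

        q≤top : suc τ ≤ top
        q≤top = ≤-trans τ< (2^≤top (m≤n+m b a))

        partial : ℕ → State
        partial j = ⟨ vars z₀ , update (arrs z₀) 1 (overwrite (selected δ j) (arrs z₀ 1)) ⟩

        count : ℕ → ℕ
        count j = length (selected δ j)

        Inv : ℕ → State → Set
        Inv j s = s ⊨ at j (count j) (suc τ) f M P × Simulating (suc τ) z₀ (arrs s) (partial j)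

        partial₀ : ∀ l i → mem (partial 0) l i ≡ mem z₀ l i
        partial₀ zero i = refl
        partial₀ (suc zero) i = refl
        partial₀ (suc (suc zero)) i = refl
        partial₀ (suc (suc (suc l))) i = refl

        partial-suc : ∀ j → δ j ≡ true → ∀ l i → mem (partial (suc j)) l i ≡ mem
            (setMem (partial j) 2 (count j) j) l i
        partial-suc j e zero i = refl
        partial-suc j e (suc zero) i = refl
        partial-suc j e (suc (suc zero)) i =
          trans (cong (λ xs → overwrite xs (arrs z₀ 1) i)
              (trans (selected-suc δ j) (cong (λ c → if c then selected δ j ∷ʳ j else selected δ j) e)))
            (overwrite-∷ʳ (selected δ j) j (arrs z₀ 1) i)
        partial-suc j e (suc (suc (suc l))) i = refl

        selected-skip : ∀ j → δ j ≡ false → selected δ (suc j) ≡ selected δ j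
        selected-skip j e = trans (selected-suc δ j) (cong (λ c → if c then selected δ j ∷ʳ j else selected δ j) e)

        count-suc : ∀ j → δ j ≡ true → count (suc j) ≡ count j + 1
        count-suc j e = trans (cong length (trans (selected-suc δ j)
            (cong (λ c → if c then selected δ j ∷ʳ j else selected δ j) e)))
          (length-++ (selected δ j))

        bnd : ∀ {j x} → j ≤ K → x ≤ K → Bounded W (at j x (suc τ) f M P)
        bnd p r = query-bounded (≤-trans p K≤top) (≤-trans r K≤top) q≤top f≤

        count≤ : ∀ {j} → j ≤ K → count j ≤ K
        count≤ {j} p = ≤-trans (length-selected δ j) p

        eval-deletedE : ∀ {j x} → eval (ref (at j x (suc τ) f M P)) deletedE ≡ (1 ∸ M j) + clauseVal P (base N) a
            (a + b) τ k j
        eval-deletedE {j} {x} = cong ((1 ∸ M j) +_)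
            (eval-clauseE (ref (at j x (suc τ) f M P)) aE (bin add aE bE) (bin monus epochE (lit 1)) k iE)

        deleted≡ : ∀ {j} → j < K → δ j ≡ (0 <ᵇ ((1 ∸ M j) + clauseVal P (base N) a (a + b) τ k j))
        deleted≡ {j} p with j <ᵇ K | <⇒<ᵇ p
        ... | true | _ = refl

        g t₀ t₁ t₂ : ℕ
        g  = plainWeight (bin monus KE iE)
        t₀ = plainWeight deletedE
        t₁ = writeWeight * (plainWeight xE + plainWeight iE + 1) + plainWeight (bin add xE (lit 1)) + 1
        t₂ = plainWeight nextE

        guard : ∀ j {s} → j ≤ K → Inv j s → eval s (bin monus KE iE) ≡ K ∸ j × cost s (bin monus KE iE) ≤ g * W
        guard j p (m , _) = trans (eval-plain (bin monus KE iE) m (plain-KE , _))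
            (cong (_∸ j) (eval-powerE (ref (at j (count j) (suc τ) f M P)) baseE k)) ,
          cost-plain (bin monus KE iE) 1≤W m (bnd p (count≤ p)) (plain-KE , _)

        body : ∀ j {s} → j < K → Inv j s → Runs ((IF deletedE THEN
            (write 2 xE iE ⨾ 3 ≔ bin add xE (lit 1)) ELSE skip) ⨾ 2 ≔ nextE) s
          ((t₀ * W + t₁ * W) + t₂ * W) (Inv (suc j))
        body j {s} p (m , sim) = Runs-seq (Runs-if (cost-plain deletedE 1≤W m bj plain-deletedE) append leave)
            λ { (m′ , sim′) →
          Runs-weaken ≤-refl (λ { (m″ , e) → m″ , subst (λ R → Simulating (suc τ) z₀ R _) (sym e) sim′ })
            (assign-run 2 nextE 1≤W m′ (bnd (<⇒≤ p) (count≤ p)) _ (+-comm j 1)) }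
          where
          bj : Bounded W (at j (count j) (suc τ) f M P)
          bj = bnd (<⇒≤ p) (count≤ (<⇒≤ p))
          Mid : State → Set
          Mid s′ = s′ ⊨ at j (count (suc j)) (suc τ) f M P × Simulating (suc τ) z₀ (arrs s′) (partial (suc j))
          value : eval s deletedE ≡ (1 ∸ M j) + clauseVal P (base N) a (a + b) τ k j
          value = trans (eval-plain deletedE m plain-deletedE) (eval-deletedE {j} {count j})
          append : eval s deletedE ≢ 0 → Runs (write 2 xE iE ⨾ 3 ≔ bin add xE (lit 1)) s (t₁ * W) Mid
          append nz = Runs-weaken
              (≤-trans (≤-reflexive (sym (*-distribʳ-+ W (writeWeight * (plainWeight xE + plainWeight iE + 1))
                  (plainWeight (bin add xE (lit 1))))))
                  (*-monoˡ-≤ W (m≤m+n (writeWeight * (plainWeight xE + plainWeight iE + 1) + plainWeight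
                  (bin add xE (lit 1))) 1)))
              (λ p → p)
            (Runs-seq (write-plain 2 xE iE 1≤W m bj _ _ refl refl refl sim) λ { (m′ , sim′) →
              Runs-weaken ≤-refl (λ { (m″ , e) → m″ , subst (λ R → Simulating (suc τ) z₀ R _) (sym e)
                  (Simulating-cong (partial-suc j yes-j) sim′) })
                (assign-run 3 (bin add xE (lit 1)) 1≤W m′ bj _ (sym (count-suc j yes-j))) })
            where
            positive : ∀ v → v ≢ 0 → (0 <ᵇ v) ≡ true
            positive zero    h = ⊥-elim (h refl)
            positive (suc v) h = refl
            yes-j : δ j ≡ true
            yes-j = trans (deleted≡ p) (positive _ (λ z → nz (trans value z)))
          leave : eval s deletedE ≡ 0 → Runs skip s (t₁ * W) Mid
          leave z = runs ⇓-skip (*-mono-≤ (m≤n+m 1 (writeWeight *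
              (plainWeight xE + plainWeight iE + 1) + plainWeight (bin add xE (lit 1)))) 1≤W)
            (subst (λ c → s ⊨ at j c (suc τ) f M P) (cong length (sym same)) m ,
             subst (λ xs → Simulating (suc τ) z₀ (arrs s) ⟨ vars z₀ , update (arrs z₀) 1
                 (overwrite xs (arrs z₀ 1)) ⟩) (sym same) sim)
            where
            same : selected δ (suc j) ≡ selected δ j
            same = selected-skip j (trans (deleted≡ p) (cong (0 <ᵇ_) (trans (sym value) z)))

        loadDeleted-run : ∀ {s j x} → j ≤ top → x ≤ top → s ⊨ at j x (suc τ) f M P → Simulating (suc τ) z₀
            (arrs s) z₀ →
          Runs loadDeleted s (loadWeight * (W * suc K))
            (λ s′ → s′ ⊨ at K (count K) (suc τ) f M P × Simulating (suc τ) z₀ (arrs s′) (loadQuery (deletedSet τ) z₀))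
        loadDeleted-run {s} {j} {x} j≤ x≤ m sim = Runs-weaken le
            (λ { (m , sim) → m , subst (Simulating (suc τ) z₀ _) loaded sim })
          (Runs-seq (assign-run 2 (lit 0) 1≤W m (query-bounded j≤ x≤ q≤top f≤) _ refl) λ { (m₁ , e₁) →
           Runs-seq (assign-run 3 (lit 0) 1≤W m₁ (query-bounded z≤n x≤ q≤top f≤) _ refl) λ { (m₂ , e₂) →
           Runs-seq (Runs-for K Inv guard body
             (m₂ , Simulating-cong partial₀ (subst (λ R → Simulating (suc τ) z₀ R z₀) (sym (trans e₂ e₁)) sim)))
                 λ { (m₃ , sim₃) →
           write-plain 0 (lit 0) xE 1≤W m₃ (bnd ≤-refl (count≤ ≤-refl)) _ _ refl refl refl sim₃ } } })
          where
          loaded : setMem (partial K) 0 0 (count K) ≡ loadQuery (deletedSet τ) z₀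
          loaded = cong₂ (λ c xs → ⟨ update (vars z₀) 0 c , update (arrs z₀) 1 (overwrite xs (arrs z₀ 1)) ⟩)
            (sym (∣deletedSet∣ τ)) (sym (trans (vertices-toSubset n δ) (selected-all τ)))
          c₀ c₁ : ℕ
          c₀ = plainWeight (lit 0)
          c₁ = writeWeight * (plainWeight (lit 0) + plainWeight xE + 1)
          le : c₀ * W + (c₀ * W + ((g * W + K * (g * W + ((t₀ * W + t₁ * W) + t₂ * W))) + c₁ * W)) ≤ loadWeight *
              (W * suc K)
          le = begin
            c₀ * W + (c₀ * W + ((g * W + K * (g * W + ((t₀ * W + t₁ * W) + t₂ * W))) + c₁ * W))
              ≡⟨ lem c₀ c₁ W _ ⟩
            ((c₀ + c₀) * W + (g * W + K * (g * W + ((t₀ * W + t₁ * W) + t₂ * W)))) + c₁ * W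
              ≡⟨ cong (λ y → ((c₀ + c₀) * W + (g * W + K * (g * W + (y + t₂ * W)))) + c₁ * W) (*-distribʳ-+ W t₀ t₁) ⟨
            ((c₀ + c₀) * W + (g * W + K * (g * W + ((t₀ + t₁) * W + t₂ * W)))) + c₁ * W
              ≤⟨ +-mono-≤ (startup-bound (c₀ + c₀) g (t₀ + t₁) t₂ W K) (*-monoʳ-≤ c₁ (≤-scale W (s≤s z≤n))) ⟩
            ((c₀ + c₀) + (g + ((t₀ + t₁) + t₂))) * (W * suc K) + c₁ * (W * suc K)
              ≡⟨ *-distribʳ-+ (W * suc K) ((c₀ + c₀) + (g + ((t₀ + t₁) + t₂))) c₁ ⟨
            loadWeight * (W * suc K) ∎
            where
            open ≤-Reasoning
            lem : ∀ a b w x → a * w + (a * w + (x + b * w)) ≡ ((a + a) * w + x) + b * w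
            lem = solve-∀

      Good : ℕ → ℕ → Set
      Good τ α = ∀ x → x < K → deleted τ x ≡ false → 0 < satisfies x α

      -- The variable 5 records whether one of the queries so far found
      -- the graph disconnected.
      Status : ℕ → ℕ → Set
      Status i f = (f ≡ 0 × (∀ τ → τ < i → ∀ α → α < 2 ^ a → ¬ Good τ α)) ⊎ (f ≡ 1 × Satisfiable φ)

      status≤ : ∀ {i f} → Status i f → f ≤ top
      status≤ (inj₁ (refl , _)) = z≤n
      status≤ (inj₂ (refl , _)) = 1≤top

      status-connected : ∀ {i f} → Connected∖ G (deletedSet i) → Status i f → Status (suc i) f
      status-connected {i} conn (inj₂ s) = inj₂ s
      status-connected {i} conn (inj₁ (refl , none)) = inj₁ (refl , new)
        where
        new : ∀ τ → τ < suc i → ∀ α → α < 2 ^ a → ¬ Good τ α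
        new τ p with τ ≟ i
        ... | yes refl = proj₁ (connected⇔ M≡ i) conn
        ... | no ne = none τ (≤∧≢⇒< (≤-pred p) ne)

      deletedSet⊂⊤ : ∀ τ → deletedSet τ ⊂ Subset.⊤
      deletedSet⊂⊤ τ = deleted⊂⊤ M≡ τ

      module Answer (z₀ : State) {V U : ℕ} (fits : Fits V U) {t₀ : ℕ}
          (preprocessed : preprocessing A ⊢ inputGraph G K ⇓ z₀ within t₀)
        (answers : ∀ (D : Subset n) → D ⊂ Subset.⊤ → ∣ D ∣ ≤ K →
           ∃[ z ] ∃[ t ] updating A ⊢ loadQuery D z₀ ⇓ z within t × Reflects (Connected∖ G D) (accepts z)) where

        Loop : ℕ → State → Set
        Loop i s = ∃[ j ] ∃[ x ] ∃[ f ] s ⊨ at j x i f M P × j ≤ top × x ≤ top × Status i f × Stored i z₀ (arrs s)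

        readout : Program
        readout = IF ⌜ var 0 ⌝ᵉ THEN skip ELSE (5 ≔ lit 1)

        query-run : ∀ i {s} → i < 2 ^ b → Loop i s → Runs query s (queryWeight * (W * suc (K + U))) (Loop (suc i))
        query-run i {s} i< (j , x , f , m , j≤ , x≤ , st , stored) = conclude (answers D (deletedSet⊂⊤ i) ∣D∣≤K)
          where
          open Load z₀ i i< f (status≤ st) using (loadDeleted-run; count; count≤; q≤top)
          D : Subset n
          D = deletedSet i
          ∣D∣≤K : ∣ D ∣ ≤ K
          ∣D∣≤K = ≤-trans (≤-reflexive (∣deletedSet∣ i)) (length-selected (deleted i) K)
          bnd : Bounded W (at K (count K) (suc i) f M P)
          bnd = query-bounded K≤top (≤-trans (count≤ ≤-refl) K≤top) q≤top (status≤ st)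
          w₀ w₁ w₂ w₃ S : ℕ
          w₀ = plainWeight (bin add epochE (lit 1))
          w₁ = weight (updating A)
          w₂ = weightᵉ (var 0)
          w₃ = plainWeight (lit 1)
          S = suc (K + U)

          conclude : ∃[ z ] ∃[ t ] updating A ⊢ loadQuery D z₀ ⇓ z within t × Reflects (Connected∖ G D) (accepts z) →
            Runs query s (queryWeight * (W * suc (K + U))) (Loop (suc i))
          conclude (z , t , run , reflects) = Runs-weaken le (λ p → p)
           (Runs-seq (assign-run 4 (bin add epochE (lit 1)) 1≤W m
               (query-bounded j≤ x≤ (≤-trans (<⇒≤ i<) (2^≤top (m≤n+m b a))) (status≤ st)) _ (+-comm i 1))
               λ { (m₁ , e₁) →
           Runs-seq (loadDeleted-run j≤ x≤ m₁ (subst (λ R → Simulating (suc i) z₀ R z₀) (sym e₁)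
               (new-epoch stored))) λ { (m₂ , sim₂) →
           Runs-seq (simulate-run 1≤W m₂ bnd refl run sim₂) λ { (m₃ , sim₃) →
           answered m₃ sim₃ } } })
            where
            t≤U : t ≤ U
            t≤U = proj₂ (fits .timely G z₀ t₀ preprocessed) D (deletedSet⊂⊤ i) ∣D∣≤K z t run
            result-bits : bits (vars z 0) ≤ S
            result-bits = ≤-trans (bits-final-var run 0)
              (+-mono-≤ (≤2^⇒bits≤ (≤-trans (<⇒≤ (n<2^n ∣ D ∣)) (^-monoʳ-≤ 2 ∣D∣≤K))) t≤U)

            answered : ∀ {s′} → s′ ⊨ at K (count K) (suc i) f M P → Simulating (suc i) z₀ (arrs s′) z →
              Runs readout s′ (w₂ * (S * W) + (w₃ + 1) * W) (Loop (suc i))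
            answered {s′} m sim = Runs-if
                (≤-trans (cost-⌜⌝ {r = s′} {s = z} (var 0) (m .regs≡ 4) (sim .represents) (small q≤top))
                    (*-monoʳ-≤ w₂ (*-monoˡ-≤ W result-bits)))
                (positive _ value reflects) (null _ value reflects)
              where
              value : eval s′ ⌜ var 0 ⌝ᵉ ≡ vars z 0
              value = eval-⌜⌝ {r = s′} {s = z} (var 0) (m .regs≡ 4) (sim .represents)
              positive : ∀ v → eval s′ ⌜ var 0 ⌝ᵉ ≡ v → Reflects (Connected∖ G D) (0 <ᵇ v) →
                  eval s′ ⌜ var 0 ⌝ᵉ ≢ 0 → Runs skip s′ ((w₃ + 1) * W) (Loop (suc i))
              positive zero    e r          nz = ⊥-elim (nz e)
              positive (suc _) e (ofʸ conn) nz = runs ⇓-skip (*-mono-≤ (m≤n+m 1 w₃) 1≤W)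
                (K , count K , f , m , K≤top , ≤-trans (count≤ ≤-refl) K≤top , status-connected conn st ,
                    end-epoch sim)
              null : ∀ v → eval s′ ⌜ var 0 ⌝ᵉ ≡ v → Reflects (Connected∖ G D) (0 <ᵇ v) → eval s′ ⌜ var 0 ⌝ᵉ ≡ 0 →
                  Runs (5 ≔ lit 1) s′ ((w₃ + 1) * W) (Loop (suc i))
              null (suc _) e r z = ⊥-elim (0≢1+n (trans (sym z) e))
              null zero e (ofⁿ ¬conn) _ = Runs-weaken (*-monoˡ-≤ W (m≤m+n w₃ 1))
                (λ { (m′ , e′) → K , count K , 1 , m′ , K≤top , ≤-trans (count≤ ≤-refl) K≤top , inj₂
                    (refl , proj₂ (connected⇔ M≡ i) ¬conn) ,
                    subst (Stored (suc i) z₀) (sym e′) (end-epoch sim) })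
                (assign-run 5 (lit 1) 1≤W m bnd _ refl)

            le : w₀ * W + (loadWeight * (W * suc K) +
                (w₁ * (t * W) + (w₂ * (S * W) + (w₃ + 1) * W))) ≤ queryWeight * (W * S)
            le = begin
              w₀ * W + (loadWeight * (W * suc K) + (w₁ * (t * W) + (w₂ * (S * W) + (w₃ + 1) * W)))
                ≤⟨ +-mono-≤ (*-monoʳ-≤ w₀ (≤-scale W (s≤s z≤n)))
                     (+-mono-≤ (*-monoʳ-≤ loadWeight (*-monoʳ-≤ W (s≤s (m≤m+n K U))))
                       (+-mono-≤ (*-monoʳ-≤ w₁ (*-monoˡ-≤ W (≤-trans t≤U (≤-trans (m≤n+m U K) (n≤1+n _)))))
                         (+-monoʳ-≤ (w₂ * (S * W)) (*-monoʳ-≤ (w₃ + 1) (≤-scale W {S} (s≤s z≤n)))))) ⟩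
              w₀ * (W * S) + (loadWeight * (W * S) + (w₁ * (S * W) + (w₂ * (S * W) + (w₃ + 1) * (W * S))))
                ≡⟨ lem w₀ loadWeight w₁ w₂ w₃ W S ⟩
              queryWeight * (W * S) ∎
              where
              open ≤-Reasoning
              lem : ∀ a b c d e w s → a * (w * s) +
                  (b * (w * s) + (c * (s * w) + (d * (s * w) + (e + 1) * (w * s)))) ≡
                  ((a + b) + ((c + d) + e + 1)) * (w * s)
              lem = solve-∀

        guardE : Expr
        guardE = bin monus (arr 2 bE) epochE

        queries-run : ∀ {s} → Loop 0 s → Runs ((WHILE guardE DO query) ⨾ 0 ≔ foundE) s
          ((plainWeight guardE + queryWeight + plainWeight foundE) * (W * (suc (2 ^ b) * suc (K + U))))
          (λ s′ → Reflects (Satisfiable φ) (accepts s′))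
        queries-run start = Runs-weaken le (λ r → r)
          (Runs-seq (Runs-for (2 ^ b) Loop guard query-run start) λ { (j , x , f , m , j≤ , x≤ , st , stored) →
           Runs-weaken ≤-refl (λ { (m′ , _) → subst (λ v → Reflects (Satisfiable φ) (0 <ᵇ v)) (sym (m′ .regs≡ 0))
               (verdict st) })
             (assign-run 0 foundE 1≤W m (query-bounded j≤ x≤ (2^≤top (m≤n+m b a)) (status≤ st)) _ refl) })
          where
          guard : ∀ i {s} → i ≤ 2 ^ b → Loop i s → eval s guardE ≡ 2 ^ b ∸ i × cost s guardE ≤ plainWeight guardE * W
          guard i p (j , x , f , m , j≤ , x≤ , st , _) =
            trans (eval-plain guardE m _) (cong (_∸ i) (proj₁ P-ok b (m≤n+m b a))) ,
            cost-plain guardE 1≤W m (query-bounded j≤ x≤ (≤-trans p (2^≤top (m≤n+m b a))) (status≤ st)) _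
          verdict : ∀ {f} → Status (2 ^ b) f → Reflects (Satisfiable φ) (0 <ᵇ f)
          verdict (inj₂ (refl , sat)) = ofʸ sat
          verdict (inj₁ (refl , none)) = ofⁿ λ sat → refute (satisfiable⇒ M≡ sat)
            where
            refute : ∃[ α ] ∃[ τ ] α < 2 ^ a × τ < 2 ^ b × Good τ α → ⊥
            refute (α , τ , p , q , good) = none τ q α p good
          g c S B : ℕ
          g = plainWeight guardE
          c = plainWeight foundE
          S = suc (K + U)
          B = 2 ^ b
          le : (g * W + B * (g * W + queryWeight * (W * S))) + c * W ≤ (g + queryWeight + c) * (W * (suc B * S))
          le = begin
            (g * W + B * (g * W + queryWeight * (W * S))) + c * W
              ≤⟨ +-mono-≤ (+-mono-≤ W≤ (*-monoʳ-≤ B (+-monoˡ-≤ (queryWeight * (W * S)) W≤)))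
                  (*-monoʳ-≤ c (≤-scale W {suc B * S} (s≤s z≤n))) ⟩
            (g * (W * S) + B * (g * (W * S) + queryWeight * (W * S))) + c * (W * (suc B * S))
              ≤⟨ m≤m+n _ (queryWeight * (W * S)) ⟩
            (g * (W * S) + B * (g * (W * S) + queryWeight * (W * S))) + c * (W * (suc B * S)) + queryWeight * (W * S)
              ≡⟨ lem g queryWeight c W S B ⟩
            (g + queryWeight + c) * (W * (suc B * S)) ∎
            where
            open ≤-Reasoning
            W≤ : g * W ≤ g * (W * S)
            W≤ = *-monoʳ-≤ g (≤-scale W {S} (s≤s z≤n))
            lem : ∀ g q c w s b → (g * (w * s) + b * (g * (w * s) + q * (w * s))) + c * (w * (suc b * s)) + q *
                (w * s) ≡ (g + q + c) * (w * (suc b * s))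
            lem = solve-∀

    duration : ℕ → ℕ → ℕ
    duration V U = suc (a + b) + suc len + suc (n * n) + V + suc (2 ^ b) * suc (K + U)

    solver-run : ∀ {V U} → Fits V U → Runs solver (inputCNF φ) (solverWeight * (W * duration V U))
      (λ s → Reflects (Satisfiable φ) (accepts s))
    solver-run {V} {U} fits = Runs-weaken le (λ r → r)
      (Runs-seq tabulatePowers-run λ { (P , m₁ , P-ok , bl₁) →
       Runs-seq (Parse.parse-run P P-ok m₁ bl₁) λ { (x , M , m₂ , x≤ , M≡ , M-small , bl₂) →
       answer P P-ok M M≡ M-small m₂ x≤ bl₂ } })
      where
      c₁ c₂ : ℕ
      c₁ = weight (preprocessing A)
      c₂ = plainWeight (bin monus (arr 2 bE) epochE) + queryWeight + plainWeight foundE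
      B : ℕ
      B = suc (2 ^ b) * suc (K + U)
      answer : ∀ P (P-ok : Powers P) M (M≡ : ∀ y → M y ≡ marksOf y) (M-small : ∀ y → bits (M y) ≤ W) {s x} →
        s ⊨ at len x 0 0 M P → x ≤ top → Blank s →
        Runs (writeGraph ⨾ ⌜ preprocessing A ⌝ ⨾ (WHILE bin monus (arr 2 bE) epochE DO query) ⨾ 0 ≔ foundE) s
          (graphWeight * (W * suc (n * n)) + (c₁ * (V * W) + c₂ * (W * B)))
          (λ s → Reflects (Satisfiable φ) (accepts s))
      answer P P-ok M M≡ M-small {s} {x} m₂ x≤ bl₂ = Runs-seq (writeGraph-run m₂ x≤ bl₂)
          λ { (m₃ , rep) → preprocess m₃ rep (correct A n G K) }
        where
        open Queries P P-ok M M≡ M-small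
        preprocess : ∀ {s} → s ⊨ at (n * n) x 0 0 M P → Represents 0 (arrs s) (inputGraph G K) →
          (∃[ z ] ∃[ t ] preprocessing A ⊢ inputGraph G K ⇓ z within t
            × (∀ (D : Subset n) → D ⊂ Subset.⊤ → ∣ D ∣ ≤ K →
               ∃[ z′ ] ∃[ t′ ] updating A ⊢ loadQuery D z ⇓ z′ within t′ × Reflects (Connected∖ G D) (accepts z′))) →
          Runs (⌜ preprocessing A ⌝ ⨾ (WHILE bin monus (arr 2 bE) epochE DO query) ⨾ 0 ≔ foundE) s
              (c₁ * (V * W) + c₂ * (W * B))
            (λ s → Reflects (Satisfiable φ) (accepts s))
        preprocess {s} m rep (z , t , run , answers) = Runs-seq
          (Runs-weaken (*-monoʳ-≤ c₁ (*-monoˡ-≤ W (proj₁ (fits .timely G z t run)))) (λ r → r)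
            -- In epoch 0 there is nothing to restore, so `empty` is a placeholder; the state to
            -- return to is the one that this run produces.
            (simulate-run 1≤W m (query-bounded n²≤top x≤ z≤n z≤n) refl run (simulating {0} {empty} rep λ ())))
          λ { (m′ , sim) → Answer.queries-run z fits run answers
                (n * n , x , 0 , m′ , n²≤top , x≤ , inj₁ (refl , λ τ ()) , stored₀ (sim .represents)) }
      le : powersWeight * (W * suc (a + b)) + (parseWeight * (W * suc len) +
          (graphWeight * (W * suc (n * n)) + (c₁ * (V * W) + c₂ * (W * B))))
         ≤ solverWeight * (W * duration V U)
      le = five-bound powersWeight parseWeight graphWeight c₁ c₂ W (suc (a + b)) (suc len) (suc (n * n)) V B

-- Growth rates

^-distribʳ-* : ∀ x y e → (x * y) ^ e ≡ x ^ e * y ^ e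
^-distribʳ-* x y zero    = refl
^-distribʳ-* x y (suc e) = trans (cong (x * y *_) (^-distribʳ-* x y e)) (lem x y (x ^ e) (y ^ e))
  where
  lem : ∀ a b c d → a * b * (c * d) ≡ a * c * (b * d)
  lem = solve-∀

^-cancel-≤ : ∀ x y e → 1 ≤ e → x ^ e ≤ y ^ e → x ≤ y
^-cancel-≤ x y e 1≤e p with x ≤? y
... | yes q = q
... | no ¬q = contradiction p (<⇒≱ (^-monoˡ-< e {{>-nonZero 1≤e}} (≰⇒> ¬q)))

m≤m^n : ∀ m n → 1 ≤ n → m ≤ m ^ n
m≤m^n zero    n       p = z≤n
m≤m^n (suc m) (suc n) p = ≤-scale (suc m) (m^n>0 (suc m) n)

m≤n*suc[m/n] : ∀ m n .{{_ : NonZero n}} → m ≤ n * suc (m / n)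
m≤n*suc[m/n] m n = begin
  m                   ≡⟨ m≡m%n+[m/n]*n m n ⟩
  m % n + m / n * n   ≤⟨ +-monoˡ-≤ (m / n * n) (m%n≤n m n) ⟩
  suc (m / n) * n     ≡⟨ *-comm (suc (m / n)) n ⟩
  n * suc (m / n)     ∎
  where open ≤-Reasoning

-- With j = 2 (e + 1) and y = ⌊L / j⌋ ≥ B j, the base B L is at most B j (y + 1) ≤ 2^y 2^y, and its
-- e-th power is at most 2^(2 y e) ≤ 2^(y j) ≤ 2^L.
polynomial≤exponential : ∀ B e → ∃[ L₀ ] (∀ L → L₀ ≤ L → (B * L) ^ e ≤ 2 ^ L)
polynomial≤exponential B e = j * (B * j) , dominates
  where
  j : ℕ
  j = 2 * suc e
  dominates : ∀ L → j * (B * j) ≤ L → (B * L) ^ e ≤ 2 ^ L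
  dominates L p = begin
    (B * L) ^ e                 ≤⟨ ^-monoˡ-≤ e (*-monoʳ-≤ B L≤) ⟩
    (B * (j * suc y)) ^ e       ≡⟨ cong (_^ e) (*-assoc B j (suc y)) ⟨
    (B * j * suc y) ^ e         ≤⟨ ^-monoˡ-≤ e (*-mono-≤ (≤-trans Bj≤y (<⇒≤ (n<2^n y))) (n<2^n y)) ⟩
    (2 ^ y * 2 ^ y) ^ e         ≡⟨ cong (_^ e) (^-distribˡ-+-* 2 y y) ⟨
    (2 ^ (y + y)) ^ e           ≡⟨ ^-*-assoc 2 (y + y) e ⟩
    2 ^ ((y + y) * e)           ≤⟨ ^-monoʳ-≤ 2 (≤-trans (m≤m+n ((y + y) * e) (2 * y))
        (≤-trans (≤-reflexive (lem y e)) (m/n*n≤m L j))) ⟩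
    2 ^ L ∎
    where
    open ≤-Reasoning
    y : ℕ
    y = L / j
    Bj≤y : B * j ≤ y
    Bj≤y = ≤-trans (≤-reflexive (sym (m*n/n≡m (B * j) j))) (/-monoˡ-≤ j (≤-trans (≤-reflexive (*-comm (B * j) j)) p))
    L≤ : L ≤ j * suc y
    L≤ = m≤n*suc[m/n] L j
    lem : ∀ y e → (y + y) * e + 2 * y ≡ y * (2 * suc e)
    lem = solve-∀

polylog-subpolynomial : ∀ B e → Subpolynomial (λ n → (3 + B * ⌊log₂ n ⌋) ^ e)
polylog-subpolynomial B e k with polynomial≤exponential (3 + B) (e * k)
-- The successor makes the logarithm positive, so that the summand 3 is at most 3 L and joins the
-- linear term.
... | L₀ , dominates = 2 ^ suc L₀ , λ n p → go n p
  where
  go : ∀ n → 2 ^ suc L₀ ≤ n → ((3 + B * ⌊log₂ n ⌋) ^ e) ^ k ≤ n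
  go n p = begin
    ((3 + B * L) ^ e) ^ k ≡⟨ ^-*-assoc (3 + B * L) e k ⟩
    (3 + B * L) ^ (e * k) ≤⟨ ^-monoˡ-≤ (e * k) (+-monoˡ-≤ (B * L) (≤-scale 3 (≤-trans (s≤s z≤n) L₀<L))) ⟩
    (3 * L + B * L) ^ (e * k) ≡⟨ cong (_^ (e * k)) (*-distribʳ-+ L 3 B) ⟨
    ((3 + B) * L) ^ (e * k) ≤⟨ dominates L (<⇒≤ L₀<L) ⟩
    2 ^ L ≤⟨ 2^⌊log₂⌋≤ n (≤-trans (m^n>0 2 (suc L₀)) p) ⟩
    n ∎
    where
    open ≤-Reasoning
    L : ℕ
    L = ⌊log₂ n ⌋
    L₀<L : suc L₀ ≤ L
    L₀<L = ≤-trans (≤-reflexive (sym (⌊log₂[2^n]⌋≡n (suc L₀)))) (⌊log₂⌋-mono-≤ p)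

-- Functions bounded by a polynomial in the size

module _ {I : Set} (S : I → ℕ) (1≤S : ∀ i → 1 ≤ S i) where

  PolynomiallyBounded : (I → ℕ) → Set
  PolynomiallyBounded g = ∃[ C ] ∃[ e ] (∀ i → g i ≤ C * S i ^ e)

  poly-≤ : ∀ {g h} → (∀ i → g i ≤ h i) → PolynomiallyBounded h → PolynomiallyBounded g
  poly-≤ le (C , e , p) = C , e , λ i → ≤-trans (le i) (p i)

  poly-const : ∀ c → PolynomiallyBounded (const c)
  poly-const c = c , 0 , λ i → ≤-reflexive (sym (*-identityʳ c))

  poly-size : PolynomiallyBounded S
  poly-size = 1 , 1 , λ i → ≤-reflexive (sym (trans (*-identityˡ _) (^-identityʳ (S i))))

  poly-+ : ∀ {g h} → PolynomiallyBounded g → PolynomiallyBounded h → PolynomiallyBounded (λ i → g i + h i)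
  poly-+ {g} {h} (C , e , p) (C′ , e′ , p′) = C + C′ , e + e′ , λ i → begin
    g i + h i ≤⟨ +-mono-≤ (p i) (p′ i) ⟩
    C * S i ^ e + C′ * S i ^ e′ ≤⟨ +-mono-≤ (*-monoʳ-≤ C (^-monoʳ-≤ (S i) {{>-nonZero (1≤S i)}} (m≤m+n e e′)))
        (*-monoʳ-≤ C′ (^-monoʳ-≤ (S i) {{>-nonZero (1≤S i)}} (m≤n+m e′ e))) ⟩
    C * S i ^ (e + e′) + C′ * S i ^ (e + e′) ≡⟨ *-distribʳ-+ _ C C′ ⟨
    (C + C′) * S i ^ (e + e′) ∎
    where open ≤-Reasoning

  poly-* : ∀ {g h} → PolynomiallyBounded g → PolynomiallyBounded h → PolynomiallyBounded (λ i → g i * h i)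
  poly-* {g} {h} (C , e , p) (C′ , e′ , p′) = C * C′ , e + e′ , λ i → begin
    g i * h i ≤⟨ *-mono-≤ (p i) (p′ i) ⟩
    C * S i ^ e * (C′ * S i ^ e′) ≡⟨ lem C (S i ^ e) C′ (S i ^ e′) ⟩
    C * C′ * (S i ^ e * S i ^ e′) ≡⟨ cong (C * C′ *_) (^-distribˡ-+-* (S i) e e′) ⟨
    C * C′ * S i ^ (e + e′) ∎
    where
    open ≤-Reasoning
    lem : ∀ a b c d → a * b * (c * d) ≡ a * c * (b * d)
    lem = solve-∀

  poly-^ : ∀ {g} m → PolynomiallyBounded g → PolynomiallyBounded (λ i → g i ^ m)
  poly-^ zero    p = poly-const 1
  poly-^ (suc m) p = poly-* p (poly-^ m p)

bits≤suc : ∀ v → bits v ≤ suc v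
bits≤suc v = ≤2^⇒bits≤ (<⇒≤ (n<2^n v))

num≥1 : ∀ p → 0ℚ ℚ.< p → 1 ≤ num p
num≥1 (mkℚ (ℤ.+ suc n) _ _) _ = s≤s z≤n
num≥1 p@(mkℚ (ℤ.+ zero) _ _) lt with () ← ℤ.Positive.pos (ℚ.positive lt)
num≥1 p@(mkℚ ℤ.-[1+ n ] _ _) lt with () ← ℤ.Positive.pos (ℚ.positive lt)

SATTime-intro : ∀ {l p Q} δ → num δ ≡ 1 → den δ ≡ Q → ∀ C e →
  (∀ N (φ : CNF N) → IsKCNF l φ → ∃[ s ] ∃[ t ] p ⊢ inputCNF φ ⇓ s within t × t ^ Q * 2 ^
      (1 * N) ≤ C * sizeCNF φ ^ e * 2 ^ (Q * N)) →
  SATTime l p δ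
SATTime-intro {l} {p} δ num≡1 refl C e h = C , e , λ N φ φ-l s t run →
  subst (λ z → t ^ den δ * 2 ^ (z * N) ≤ C * sizeCNF φ ^ e * 2 ^ (den δ * N)) (sym num≡1) (go φ (h N φ φ-l) run)
  where
  go : ∀ {N} (φ : CNF N) {s t} → ∃[ s ] ∃[ t ] p ⊢ inputCNF φ ⇓ s within t × t ^ den δ * 2 ^
      (1 * N) ≤ C * sizeCNF φ ^ e * 2 ^ (den δ * N) →
    p ⊢ inputCNF φ ⇓ s within t → t ^ den δ * 2 ^ (1 * N) ≤ C * sizeCNF φ ^ e * 2 ^ (den δ * N)
  go φ (_ , _ , run , le) run′ with ⇓-deterministic run run′
  ... | refl , refl = le

-- The parameters and the running time of the solver

module Reduction (A : Oracle) (c m d d₀ Q′ k pad C n₀ : ℕ) (c≤m : c ≤ m) (2≤m : 2 ≤ m) (d≡ : d ≡ suc d₀)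
  (Q≡ : suc Q′ ≡ suc m * d) (2≤k : 2 ≤ k) (n₀<pad : n₀ < pad) where

  Q : ℕ
  Q = suc Q′

  -- Free of `pad`, which is chosen only after n₀, and n₀ comes from the oracle's time bounds for
  -- this very function.
  f : ℕ → ℕ
  f n = (3 + 2 * Q * ⌊log₂ n ⌋) ^ k

  1≤d : 1 ≤ d
  1≤d = ≤-trans (s≤s z≤n) (≤-reflexive (sym d≡))

  1≤pad : 1 ≤ pad
  1≤pad = ≤-trans (s≤s z≤n) n₀<pad

  open Solver A k d Q′ pad

  Index : Set
  Index = Σ ℕ λ N → Σ (CNF N) λ φ → IsKCNF k φ

  S : Index → ℕ
  S (N , φ , _) = sizeCNF φ

  Poly : (Index → ℕ) → Set
  Poly = PolynomiallyBounded S (λ _ → s≤s z≤n)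

  module At (i : Index) where
    N : ℕ
    N = proj₁ i

    open Instance 2≤k 1≤d 1≤pad (proj₁ (proj₂ i)) (proj₂ (proj₂ i)) public

    -- Since `x` is the exact d-th root of 2^a, which is n up to the factor K + 1, `U` is n^(1 -
    -- 1/d) up to such factors. `E` is the target of the whole analysis.
    x V U E : ℕ
    x = 2 ^ (h + pad)
    V = C * n ^ c
    U = suc C * suc K * x ^ d₀
    E = 2 ^ (N ∸ h)

    h*Q≤N : h * Q ≤ N
    h*Q≤N = m/n*n≤m N Q

    d*h≤N : d * h ≤ N
    d*h≤N = ≤-trans (≤-trans (≤-reflexive (*-comm d h))
        (*-monoʳ-≤ h (≤-trans (m≤m+n d (m * d)) (≤-reflexive (sym Q≡))))) h*Q≤N

    2^a≡x^d : 2 ^ a ≡ x ^ d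
    2^a≡x^d = trans (cong (2 ^_) (*-comm d (h + pad))) (sym (^-*-assoc 2 (h + pad) d))

    n≤ : n ≤ suc K * 2 ^ a
    n≤ = ≤-trans (≤-reflexive (+-comm K _)) (+-monoʳ-≤ (2 ^ a) (≤-scale K (m^n>0 2 a)))

    a≥h+pad : h + pad ≤ a
    a≥h+pad = ≤-trans (≤-scale (h + pad) 1≤d) (≤-reflexive (*-comm (h + pad) d))

    n≥n₀ : n₀ ≤ n
    n≥n₀ = begin
      n₀    ≤⟨ <⇒≤ n₀<pad ⟩
      pad   ≤⟨ m≤n+m pad h ⟩
      h + pad ≤⟨ a≥h+pad ⟩
      a     ≤⟨ <⇒≤ (n<2^n a) ⟩
      2 ^ a ≤⟨ m≤n+m (2 ^ a) K ⟩
      n ∎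
      where open ≤-Reasoning

    -- N ≤ Q (h + 1), and h + 1 ≤ h + pad ≤ a ≤ log n. The rounding in h is absorbed by `pad`, so
    -- the constant Q suffices.
    K≤f : K ≤ f n
    K≤f = ^-monoˡ-≤ k (+-monoʳ-≤ 3 (≤-trans (*-monoʳ-≤ 2 N≤) (≤-reflexive (sym (*-assoc 2 Q ⌊log₂ n ⌋)))))
      where
      a≤log : a ≤ ⌊log₂ n ⌋
      a≤log = ≤-trans (≤-reflexive (sym (⌊log₂[2^n]⌋≡n a))) (⌊log₂⌋-mono-≤ (m≤n+m (2 ^ a) K))
      N≤ : N ≤ Q * ⌊log₂ n ⌋
      N≤ = ≤-trans (m≤n*suc[m/n] N Q) (*-monoʳ-≤ Q (≤-trans
          (≤-trans (≤-trans (≤-reflexive (+-comm 1 h)) (+-monoʳ-≤ h 1≤pad)) a≥h+pad) a≤log))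

    -- The first block has d times h + pad variables so that this d-th root
    -- is exact.
    update-time : ∀ t → t ^ d * n ≤ C * n ^ d → t ≤ U
    update-time t p = *-cancelʳ-≤ t U x {{m^n≢0 2 (h + pad)}} (^-cancel-≤ (t * x) (U * x) d 1≤d (begin
      (t * x) ^ d                         ≡⟨ ^-distribʳ-* t x d ⟩
      t ^ d * x ^ d                       ≡⟨ cong (t ^ d *_) 2^a≡x^d ⟨
      t ^ d * 2 ^ a                       ≤⟨ *-monoʳ-≤ (t ^ d) (m≤n+m (2 ^ a) K) ⟩
      t ^ d * n                           ≤⟨ p ⟩
      C * n ^ d                           ≤⟨ *-mono-≤ (≤-trans (n≤1+n C) (m≤m^n (suc C) d 1≤d)) (^-monoˡ-≤ d n≤) ⟩
      suc C ^ d * (suc K * 2 ^ a) ^ d     ≡⟨ ^-distribʳ-* (suc C) (suc K * 2 ^ a) d ⟨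
      (suc C * (suc K * 2 ^ a)) ^ d       ≡⟨ cong (λ y → (suc C * (suc K * y)) ^ d) 2^a≡x^d ⟩
      (suc C * (suc K * x ^ d)) ^ d       ≡⟨ cong (_^ d)
          (trans (cong (λ y → suc C * (suc K * x ^ y)) d≡) (lem (suc C) (suc K) x (x ^ d₀))) ⟩
      (U * x) ^ d ∎))
      where
      open ≤-Reasoning
      lem : ∀ a b x y → a * (b * (x * y)) ≡ a * b * y * x
      lem = solve-∀

    R Z : ℕ
    R = (suc K * 2 ^ (d * pad)) ^ m
    Z = suc (d * pad + N) + suc len + suc R + C * R + 2 * ((2 + C) * suc K * 2 ^ (pad * d₀))

    1≤E : 1 ≤ E
    1≤E = m^n>0 2 (N ∸ h)

    power-of-n : n ^ m ≤ R * E
    power-of-n = begin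
      n ^ m                                     ≤⟨ ^-monoˡ-≤ m n≤ ⟩
      (suc K * 2 ^ a) ^ m                       ≡⟨ cong (λ y → (suc K * 2 ^ y) ^ m)
          (trans (*-distribˡ-+ d h pad) (+-comm (d * h) _)) ⟩
      (suc K * 2 ^ (d * pad + d * h)) ^ m       ≡⟨ cong (λ y → (suc K * y) ^ m) (^-distribˡ-+-* 2 (d * pad) (d * h)) ⟩
      (suc K * (2 ^ (d * pad) * 2 ^ (d * h))) ^ m ≡⟨ cong (_^ m) (*-assoc (suc K) (2 ^ (d * pad)) (2 ^ (d * h))) ⟨
      (suc K * 2 ^ (d * pad) * 2 ^ (d * h)) ^ m ≡⟨ ^-distribʳ-* (suc K * 2 ^ (d * pad)) (2 ^ (d * h)) m ⟩
      R * (2 ^ (d * h)) ^ m                     ≡⟨ cong (R *_) (^-*-assoc 2 (d * h) m) ⟩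
      R * 2 ^ (d * h * m)                       ≤⟨ *-monoʳ-≤ R
          (^-monoʳ-≤ 2 (m+n≤o⇒m≤o∸n (d * h * m) (≤-trans fit h*Q≤N))) ⟩
      R * E ∎
      where
      open ≤-Reasoning
      fit : d * h * m + h ≤ h * Q
      fit = ≤-trans (+-monoʳ-≤ (d * h * m) (≤-trans (≤-scale h 1≤d) (≤-reflexive (*-comm h d))))
          (≤-reflexive (trans (lem d h m) (cong (h *_) (sym Q≡))))
        where
        lem : ∀ d h m → d * h * m + d * h ≡ h * (d + m * d)
        lem = solve-∀

    -- Up to padding the exponents add up to (N - d h) + (d - 1) h = N - h. The gain h is what an
    -- update saves against linear time.
    query-phase : 2 ^ b * x ^ d₀ ≤ 2 ^ (pad * d₀) * E
    query-phase = begin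
      2 ^ b * x ^ d₀                  ≡⟨ cong (2 ^ b *_) (^-*-assoc 2 (h + pad) d₀) ⟩
      2 ^ b * 2 ^ ((h + pad) * d₀)    ≡⟨ ^-distribˡ-+-* 2 b _ ⟨
      2 ^ (b + (h + pad) * d₀)        ≡⟨ cong (2 ^_) (lem b h pad d₀) ⟩
      2 ^ (pad * d₀ + (b + d₀ * h))   ≡⟨ ^-distribˡ-+-* 2 (pad * d₀) _ ⟩
      2 ^ (pad * d₀) * 2 ^ (b + d₀ * h) ≤⟨ *-monoʳ-≤ (2 ^ (pad * d₀))
          (^-monoʳ-≤ 2 (m+n≤o⇒m≤o∸n (b + d₀ * h) (≤-reflexive
           (trans (trans (+-assoc b _ h) (cong (b +_) (trans (+-comm (d₀ * h) h) (cong (_* h) (sym d≡)))))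
               (m∸n+n≡m d*h≤N))))) ⟩
      2 ^ (pad * d₀) * E ∎
      where
      open ≤-Reasoning
      lem : ∀ b h p d → b + (h + p) * d ≡ p * d + (b + d * h)
      lem = solve-∀

    a+b≡ : a + b ≡ d * pad + N
    a+b≡ = trans (cong (_+ b) (trans (*-distribˡ-+ d h pad) (+-comm (d * h) _)))
        (trans (+-assoc (d * pad) _ b) (cong (d * pad +_) (m+[n∸m]≡n d*h≤N)))

    duration≤ : duration V U ≤ Z * E
    duration≤ = begin
      suc (a + b) + suc len + suc (n * n) + V + suc (2 ^ b) * suc (K + U)
        ≤⟨ +-mono-≤ (+-mono-≤ (+-mono-≤ (+-mono-≤ (≤-trans (≤-reflexive (cong suc a+b≡)) (≤-scale _ 1≤E))
            (≤-scale _ 1≤E)) square) pre) queries ⟩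
      suc (d * pad + N) * E + suc len * E + suc R * E + C * R * E + 2 * ((2 + C) * suc K * 2 ^ (pad * d₀)) * E
        ≡⟨ lem (suc (d * pad + N)) (suc len) (suc R) (C * R) _ E ⟩
      Z * E ∎
      where
      open ≤-Reasoning
      lem : ∀ a b c d e x → a * x + b * x + c * x + d * x + e * x ≡ (a + b + c + d + e) * x
      lem = solve-∀
      square : suc (n * n) ≤ suc R * E
      square = +-mono-≤ 1≤E (≤-trans (≤-reflexive (cong (n *_) (sym (*-identityʳ n))))
          (≤-trans (^-monoʳ-≤ n {{>-nonZero 1≤n}} 2≤m) power-of-n))
      pre : V ≤ C * R * E
      pre = ≤-trans (*-monoʳ-≤ C (≤-trans (^-monoʳ-≤ n {{>-nonZero 1≤n}} c≤m) power-of-n))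
          (≤-reflexive (sym (*-assoc C R E)))
      queries : suc (2 ^ b) * suc (K + U) ≤ 2 * ((2 + C) * suc K * 2 ^ (pad * d₀)) * E
      queries = begin
        suc (2 ^ b) * (suc K + U)
          ≤⟨ *-mono-≤ (+-monoˡ-≤ (2 ^ b) (m^n>0 2 b))
              (+-monoˡ-≤ U (≤-scale (suc K) (m^n>0 x {{m^n≢0 2 (h + pad)}} d₀))) ⟩
        (2 ^ b + 2 ^ b) * (suc K * x ^ d₀ + U)
          ≡⟨ lem₁ (2 ^ b) (suc K) (x ^ d₀) C ⟩
        2 * ((2 + C) * suc K) * (2 ^ b * x ^ d₀)
          ≤⟨ *-monoʳ-≤ (2 * ((2 + C) * suc K)) query-phase ⟩
        2 * ((2 + C) * suc K) * (2 ^ (pad * d₀) * E)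
          ≡⟨ lem₂ ((2 + C) * suc K) (2 ^ (pad * d₀)) E ⟩
        2 * ((2 + C) * suc K * 2 ^ (pad * d₀)) * E ∎
        where
        lem₁ : ∀ b k x c → (b + b) * (k * x + suc c * k * x) ≡ 2 * ((2 + c) * k) * (b * x)
        lem₁ = solve-∀
        lem₂ : ∀ k p e → 2 * k * (p * e) ≡ 2 * (k * p) * e
        lem₂ = solve-∀

    Y : ℕ
    Y = (suc K + suc (d * pad + N)) + (suc K + suc (d * pad + N)) + (suc len + suc (d * pad + N))

    W≤ : W ≤ Y
    W≤ = begin
      bits (n * n + (len + 2 ^ (a + b)))                  ≤⟨ bits-op add (n * n) (len + 2 ^ (a + b)) ⟩
      bits (n * n) + bits (len + 2 ^ (a + b))             ≤⟨ +-mono-≤ (bits-op mul n n)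
          (bits-op add len (2 ^ (a + b))) ⟩
      bits n + bits n + (bits len + bits (2 ^ (a + b)))   ≤⟨ +-mono-≤ (+-mono-≤ n-bits n-bits)
          (+-mono-≤ (bits≤suc len) (power-bits ≤-refl)) ⟩
      Y ∎
      where
      open ≤-Reasoning
      power-bits : ∀ {j} → j ≤ a + b → bits (2 ^ j) ≤ suc (d * pad + N)
      power-bits {j} p = ≤-trans (≤2^⇒bits≤ {2 ^ j} {j} ≤-refl) (s≤s (≤-trans p (≤-reflexive a+b≡)))
      n-bits : bits n ≤ suc K + suc (d * pad + N)
      n-bits = ≤-trans (bits-op add K (2 ^ a)) (+-mono-≤ (bits≤suc K) (power-bits (m≤m+n a b)))

    -- Q (N - h) + N ≤ Q N + Q because N ≤ Q (h + 1); rounding h down costs the constant 2^Q.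
    E^Q*2^N : E ^ Q * 2 ^ N ≤ 2 ^ Q * 2 ^ (Q * N)
    E^Q*2^N = begin
      E ^ Q * 2 ^ N            ≡⟨ cong (_* 2 ^ N) (^-*-assoc 2 (N ∸ h) Q) ⟩
      2 ^ ((N ∸ h) * Q) * 2 ^ N ≡⟨ ^-distribˡ-+-* 2 ((N ∸ h) * Q) N ⟨
      2 ^ ((N ∸ h) * Q + N)    ≤⟨ ^-monoʳ-≤ 2 (≤-trans (+-monoʳ-≤ ((N ∸ h) * Q) (m≤n*suc[m/n] N Q))
          (≤-reflexive eq)) ⟩
      2 ^ (Q + Q * N)          ≡⟨ ^-distribˡ-+-* 2 Q (Q * N) ⟩
      2 ^ Q * 2 ^ (Q * N) ∎
      where
      open ≤-Reasoning
      lem : ∀ y h q → y * q + q * suc h ≡ q + q * (y + h)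
      lem = solve-∀
      eq : (N ∸ h) * Q + Q * suc h ≡ Q + Q * N
      eq = trans (lem (N ∸ h) h Q) (cong (λ y → Q + Q * y) (m∸n+n≡m (m/n≤m N Q)))

  Timely : Set
  Timely = ∀ n (G : Graph n) d⋆ → n₀ ≤ n → d⋆ ≤ f n → ∀ s t → preprocessing A ⊢ inputGraph G d⋆ ⇓ s within t →
    t ≤ C * n ^ c × (∀ (D : Subset n) → D ⊂ Subset.⊤ → ∣ D ∣ ≤ d⋆ → ∀ s′ t′ →
        updating A ⊢ loadQuery D s ⇓ s′ within t′ → t′ ^ d * n ≤ C * n ^ d)

  module _ (timely : Timely) where

    opaque
      solves : ∀ i → Runs solver (inputCNF (proj₁ (proj₂ i)))
          (solverWeight * (At.W i * At.duration i (At.V i) (At.U i)))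
        (λ s → Reflects (Satisfiable (proj₁ (proj₂ i))) (accepts s))
      solves i = solver-run record { timely = λ G s t run → fit {G} {s} {t} (timely n G K n≥n₀ K≤f s t run) }
        where
        open At i
        fit : ∀ {G : Graph n} {s t} → t ≤ C * n ^ c ×
            (∀ (D : Subset n) → D ⊂ Subset.⊤ → ∣ D ∣ ≤ K → ∀ s′ t′ → updating A ⊢ loadQuery D s ⇓ s′ within t′ →
            t′ ^ d * n ≤ C * n ^ d) →
          t ≤ V × (∀ (D : Subset n) → D ⊂ Subset.⊤ → ∣ D ∣ ≤ K → ∀ s′ t′ →
              updating A ⊢ loadQuery D s ⇓ s′ within t′ → t′ ≤ U)
        fit (p , u) = p , λ D D⊂⊤ D≤ s′ t′ run → update-time t′ (u D D⊂⊤ D≤ s′ t′ run)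

    factor : Index → ℕ
    factor i = solverWeight * (At.Y i * At.Z i)

    factor-poly : Poly factor
    factor-poly = times (constant solverWeight) (times (plus (plus K+ab K+ab) (plus suc-len ab)) Z-poly)
      where
      constant : ∀ m → Poly (const m)
      constant = poly-const S (λ _ → s≤s z≤n)
      plus : ∀ {g h} → Poly g → Poly h → Poly (λ i → g i + h i)
      plus = poly-+ S (λ _ → s≤s z≤n)
      times : ∀ {g h} → Poly g → Poly h → Poly (λ i → g i * h i)
      times = poly-* S (λ _ → s≤s z≤n)
      power : ∀ {g} m → Poly g → Poly (λ i → g i ^ m)
      power = poly-^ S (λ _ → s≤s z≤n)
      N-poly : Poly proj₁
      N-poly = poly-≤ S (λ _ → s≤s z≤n) (λ i → ≤-trans (m≤m+n (proj₁ i) _) (n≤1+n _)) (poly-size S (λ _ → s≤s z≤n))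
      suc-len : Poly (λ i → suc (At.len i))
      suc-len = poly-≤ S (λ _ → s≤s z≤n) (λ i → s≤s (m≤n+m _ (proj₁ i))) (poly-size S (λ _ → s≤s z≤n))
      suc-K : Poly (λ i → suc (At.K i))
      suc-K = plus (constant 1) (power k (plus (constant 3) (times (constant 2) N-poly)))
      ab : Poly (λ i → suc (d * pad + proj₁ i))
      ab = plus (constant (suc (d * pad))) N-poly
      K+ab : Poly (λ i → suc (At.K i) + suc (d * pad + proj₁ i))
      K+ab = plus suc-K ab
      R-poly : Poly At.R
      R-poly = power m (times suc-K (constant (2 ^ (d * pad))))
      Z-poly : Poly At.Z
      Z-poly = plus (plus (plus (plus ab suc-len) (plus (constant 1) R-poly)) (times (constant C) R-poly))
        (times (constant 2) (times (times (constant (2 + C)) suc-K) (constant (2 ^ (pad * d₀)))))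

    solver-time : ∀ i → time (solves i) ^ Q * 2 ^ (1 * proj₁ i) ≤ (2 ^ Q * factor i ^ Q) * 2 ^ (Q * proj₁ i)
    solver-time i = begin
      t ^ Q * 2 ^ (1 * N)                        ≡⟨ cong (λ y → t ^ Q * 2 ^ y) (*-identityˡ N) ⟩
      t ^ Q * 2 ^ N                              ≤⟨ *-monoˡ-≤ (2 ^ N) (^-monoˡ-≤ Q t≤) ⟩
      (factor i * E) ^ Q * 2 ^ N                 ≡⟨ cong (_* 2 ^ N) (^-distribʳ-* (factor i) E Q) ⟩
      factor i ^ Q * E ^ Q * 2 ^ N               ≡⟨ *-assoc (factor i ^ Q) _ _ ⟩
      factor i ^ Q * (E ^ Q * 2 ^ N)             ≤⟨ *-monoʳ-≤ (factor i ^ Q) E^Q*2^N ⟩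
      factor i ^ Q * (2 ^ Q * 2 ^ (Q * N))       ≡⟨ lem (factor i ^ Q) (2 ^ Q) _ ⟩
      (2 ^ Q * factor i ^ Q) * 2 ^ (Q * N) ∎
      where
      open At i
      open ≤-Reasoning
      t : ℕ
      t = time (solves i)
      lem : ∀ a b c → a * (b * c) ≡ (b * a) * c
      lem = solve-∀
      t≤ : t ≤ factor i * E
      t≤ = ≤-trans (bound (solves i)) (≤-trans (*-monoʳ-≤ solverWeight
          (≤-trans (*-mono-≤ W≤ duration≤) (≤-reflexive (sym (*-assoc Y Z E)))))
        (≤-reflexive (sym (*-assoc solverWeight (Y * Z) E))))

    solver-decides : ∀ {l} → l ≤ k → DecidesSAT l solver
    solver-decides l≤k N φ φ-l = _ , _ , run r , post r
      where
      r : Runs solver (inputCNF φ) _ (λ s → Reflects (Satisfiable φ) (accepts s))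
      r = solves (N , φ , All.map (λ p → ≤-trans p l≤k) φ-l)

    solver-fast : ∀ {l} δ → num δ ≡ 1 → den δ ≡ Q → l ≤ k → SATTime l solver δ
    solver-fast {l} δ num≡1 den≡Q l≤k = SATTime-intro δ num≡1 den≡Q (proj₁ total) (proj₁ (proj₂ total)) λ N φ φ-l →
        let i = N , φ , All.map (λ p → ≤-trans p l≤k) φ-l in
        final (solves i) , time (solves i) , run (solves i) , ≤-trans (solver-time i)
            (*-monoˡ-≤ (2 ^ (Q * N)) (proj₂ (proj₂ total) i))
      where
      total : Poly (λ i → 2 ^ Q * factor i ^ Q)
      total = poly-* S (λ _ → s≤s z≤n) (poly-const S (λ _ → s≤s z≤n) (2 ^ Q)) (poly-^ S (λ _ → s≤s z≤n) Q factor-poly)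

theorem1p3 : SETH → ∀ (c ε : ℚ) → 0ℚ ℚ.< c → 0ℚ ℚ.< ε → ¬ (Σ Oracle λ A → RunsInTime A c ε)
theorem1p3 seth c ε@(mkℚ _ d₀ _) _ 0<ε (A , runsInTime) =
  proj₂ hard (solver , solver-decides timely (m≤n+m l 2) , solver-fast timely δ refl refl (m≤n+m l 2))
  where
  m d Q′ : ℕ
  -- At least `num c` for preprocessing and at least 2 for the n * n entries of the adjacency
  -- matrix.
  m  = 2 + num c
  d  = suc d₀
  Q′ = d₀ + m * d
  δ : ℚ
  δ = mkℚ (ℤ.+ 1) Q′ (1-coprimeTo (suc Q′))
  hard : ∃[ l ] ¬ (∃[ p ] DecidesSAT l p × SATTime l p δ)
  hard = seth δ (positive⁻¹ δ)
  l : ℕ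
  l = proj₁ hard
  f : ℕ → ℕ
  f n = (3 + 2 * suc Q′ * ⌊log₂ n ⌋) ^ (2 + l)
  bounds : RunsInTimeFor A c ε f
  bounds = runsInTime f (polylog-subpolynomial (2 * suc Q′) (2 + l))
  n₀ : ℕ
  n₀ = proj₁ (proj₂ bounds)
  -- Width 2 + l instead of l makes room for the two literals of the hub, and an l-CNF formula is
  -- also a (2 + l)-CNF formula.
  open Reduction A (num c) m d d₀ Q′ (2 + l) (suc n₀) (proj₁ bounds) n₀ (m≤n+m (num c) 2) (s≤s (s≤s z≤n)) refl refl
      (s≤s (s≤s z≤n)) ≤-refl using (Timely; solver-decides; solver-fast)
  open Solver A (2 + l) d Q′ (suc n₀) using (solver)
  timely : Timely
  -- The exponents are rounded: t ≤ t^(den c) replaces c by its numerator, and n ≤ n^(num ε), where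
  -- ε > 0 enters, replaces ε by 1/d.
  timely n G d⋆ n₀≤n d⋆≤f s t run = ≤-trans (m≤m^n t (den c) (s≤s z≤n)) (proj₁ b) ,
    λ D D⊂⊤ D≤ s′ t′ run′ → ≤-trans (*-monoʳ-≤ (t′ ^ d) (m≤m^n n (num ε) (num≥1 ε 0<ε))) (proj₂ b D D⊂⊤ D≤ s′ t′ run′)
    where b = proj₂ (proj₂ bounds) n G d⋆ n₀≤n d⋆≤f s t run
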